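{- Let $\eta>0$ and let $H$ be a graph with at least one edge, chromatic number $\chi(H)=r$ (so $r\ge2$) and $h:=|H|$. Let $\sigma\in\mathbb{R}$ with $\sigma(H)\le\sigma\le h/r$, and $\omega:=(h-\sigma)/(r-1)$. Then there exists $n_0=n_0(\eta,\sigma,H)\in\mathbb{N}$ such that the following holds: if $G$ is a graph on $n\ge n_0$ vertices with degree sequence $d_1\le\dots\le d_n$ such that \[d_i\ge\left(1-\frac{\omega+\sigma}{h}\right)n+\frac{\sigma}{\omega}i\quad\text{for all }1\le i\le\frac{\omega n}{h},\] then $G$ contains an $H$-tiling covering all but at most $\eta n$ vertices.
   Context: For a graph $H$, $\sigma(H)$ denotes the smallest possible size of a colour class over all proper colourings of $H$ with $\chi(H)$ colours. An $H$-tiling in $G$ is a collection of vertex-disjoint copies of $H$ in $G$. Degree sequences list vertex degrees in non-decreasing order.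
   Formalization: The parameters η and σ are taken to be rational numbers instead of real numbers (so ω is rational as well). -}

module Defs where

open import Data.Nat as ℕ using (ℕ; suc)
open import Data.Fin as Fin using (Fin; toℕ)
open import Data.Fin.Properties using () renaming (_≟_ to _≟ᶠ_)
open import Data.Bool using (Bool; true; false; if_then_else_)
open import Data.List using (List; map; allFin)
open import Data.Nat.ListAction using (sum)
open import Data.Integer using (+_)
open import Data.Rational as ℚ using (ℚ; 0ℚ; _÷_; ≢-nonZero)
open import Data.Rational.Properties using () renaming (_≟_ to _≟ℚ_)
open import Data.Product using (Σ; ∃; _×_; _,_)
open import Relation.Nullary using (¬_; yes; no)
open import Relation.Nullary.Decidable using (⌊_⌋)
open import Relation.Binary.PropositionalEquality using (_≡_; _≢_)

record Graph (n : ℕ) : Set where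
  field
    adj    : Fin n → Fin n → Bool
    sym    : ∀ u v → adj u v ≡ adj v u
    irrefl : ∀ v → adj v v ≡ false
open Graph public

count : {n : ℕ} → (Fin n → Bool) → ℕ
count {n} p = sum (map (λ v → if p v then 1 else 0) (allFin n))

degree : {n : ℕ} → Graph n → Fin n → ℕ
degree G v = count (adj G v)

HasEdge : {n : ℕ} → Graph n → Set
HasEdge G = ∃ λ u → ∃ λ v → adj G u v ≡ true

ProperColouring : {n : ℕ} → Graph n → (k : ℕ) → (Fin n → Fin k) → Set
ProperColouring G k c = ∀ u v → adj G u v ≡ true → c u ≢ c v

Colourable : {n : ℕ} → Graph n → ℕ → Set
Colourable {n} G k = Σ (Fin n → Fin k) (ProperColouring G k)

IsChromaticNumber : {n : ℕ} → Graph n → ℕ → Set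
IsChromaticNumber G r = Colourable G r × (∀ k → Colourable G k → r ℕ.≤ k)

colourClassSize : {n k : ℕ} → (Fin n → Fin k) → Fin k → ℕ
colourClassSize c j = count (λ v → ⌊ c v ≟ᶠ j ⌋)

IsSigma : {n : ℕ} → Graph n → (r : ℕ) → ℕ → Set
IsSigma G r s =
  (∃ λ c → ProperColouring G r c × ∃ λ j → colourClassSize c j ≡ s)
  × (∀ c → ProperColouring G r c → ∀ j → s ℕ.≤ colourClassSize c j)

ℕ→ℚ : ℕ → ℚ
ℕ→ℚ n = + n ℚ./ 1

-- total division on ℚ (only ever used with nonzero divisors in the statement)
_÷'_ : ℚ → ℚ → ℚ
p ÷' q with q ≟ℚ 0ℚ
... | yes _  = 0ℚ
... | no q≢0 = _÷_ p q {{≢-nonZero q≢0}}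

-- a copy of H in G: an injective homomorphism (not necessarily induced)
-- an H-tiling of size t: t copies with pairwise disjoint vertex sets
record Tiling {h n : ℕ} (H : Graph h) (G : Graph n) (t : ℕ) : Set where
  field
    copy     : Fin t → Fin h → Fin n
    edges    : ∀ a u v → adj H u v ≡ true → adj G (copy a u) (copy a v) ≡ true
    disjoint : ∀ a b u v → copy a u ≡ copy b v → (a ≡ b) × (u ≡ v)
open Tiling public

-- ordering π of the vertices listing degrees in non-decreasing order:
-- d_i = degree G (π (i-1))
SortsDegrees : {n : ℕ} → Graph n → (Fin n → Fin n) → Set
SortsDegrees {n} G π =
  (∀ u v → π u ≡ π v → u ≡ v)
  × (∀ i j → toℕ i ℕ.≤ toℕ j → degree G (π i) ℕ.≤ degree G (π j))

{-# OPTIONS --safe #-}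
module Submission where

-- Allow unlimited auxiliary "ghost" vertices, adjacent to everything.  With them the graph is tiled
-- trivially by huge complete r-partite tiles with class ratio ω : … : ω : σ, and it remains to make the
-- number of ghosts small.  This is a local search.  While many ghosts are in use, dissolve a tile with an
-- average share of them, so that a few real vertices y are uncovered.  Counting the neighbours of y over
-- all tiles, the degree condition (in which the ghosts provide slack) forces for a positive proportion of
-- the tiles that y either sees all large classes of the tile, and then the tile can absorb vertices like
-- y, or sees all classes but one large class that contains many ghosts or vertices of larger degree, and
-- then y can be exchanged for those.  By pigeonhole many uncovered y have the same neighbourhood in such a
-- tile, so a positive fraction of a blow-up can be moved at once; no regularity lemma is needed.  Every
-- step lowers a potential that charges ghosts heavily and uncovered vertices more the smaller their
-- degree.  Each round shrinks the tile size by a constant factor and lowers the potential by a constant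
-- fraction of n, so a bounded number of rounds suffices.  Finally every tile is cut into copies of H using
-- rotations of an optimal colouring, and the copies containing ghosts are discarded.

module DegreeSequenceKomlós where

  open import Data.Bool using (Bool; true; false; not; if_then_else_) renaming (T to IsTrue)
  open import Data.Empty using (⊥; ⊥-elim)
  open import Data.Fin using (Fin; zero; suc; toℕ; fromℕ<)
  open import Data.Fin.Properties using (any?; all?; ¬∀⟶∃¬; toℕ<n; toℕ-injective; toℕ-fromℕ<) renaming (_≟_ to _≟ᶠ_)
  open import Data.List using (List; []; _∷_; _++_; map; length; allFin; replicate; concat; lookup; upTo)
  open import Data.List.Properties using (map-++; length-++; length-map; map-tabulate; map-∘; length-replicate;
      length-tabulate; length-upTo)
  open import Data.List.Membership.Propositional using (_∈_)
  open import Data.List.Membership.Propositional.Properties using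
      (∈-concat⁺′; ∈-++⁺ˡ; ∈-++⁺ʳ; ∈-++⁻; ∈-map⁺; ∈-map⁻; ∈-allFin; ∈-upTo⁺)
  open import Data.List.Relation.Unary.Any using (here; there)
  open import Data.Maybe using (Maybe; just; nothing; maybe′)
  open import Data.Nat using (ℕ; zero; suc; _+_; _*_; _∸_; _^_; _⊔_; _≤_; _<_; _<ᵇ_; _≡ᵇ_; >-nonZero; z≤n; s≤s;
      NonZero; nonZero; _≤?_; _<?_; _/_; _%_)
  open import Data.Nat.Properties
    hiding (_≟_)
  open import Data.Nat.DivMod using (m≡m%n+[m/n]*n; m%n<n; m/n*n≤m; /-mono-≤; m*n/n≡m)
  open import Data.Nat.ListAction using (sum)
  open import Data.Nat.ListAction.Properties using (sum-++)
  open import Data.Nat.Tactic.RingSolver using (solve-∀)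
  open import Data.Product using (Σ; ∃; ∃₂; _×_; _,_; proj₁; proj₂)
  open import Data.Sum using (_⊎_; inj₁; inj₂)
  open import Data.Unit using (tt)
  open import Function using (_∘_; id)
  open import Relation.Binary.PropositionalEquality using (_≡_; _≢_; refl; cong; cong₂; sym; trans; subst; module
      ≡-Reasoning)
  open import Relation.Nullary using (¬_; Dec; yes; no)
  open import Relation.Nullary.Decidable using (⌊_⌋; _×-dec_; _⊎-dec_; _→-dec_; ¬?)
  open import Data.Bool.Properties using () renaming (_≟_ to _≟ᵇ_)
  open import Data.Fin using (punchIn; punchOut; finToFun; funToFin)
  open import Data.Fin.Properties using (punchIn-injective; punchOut-injective; punchInᵢ≢i; punchIn-punchOut;
      injective⇒≤; finToFun-funToFin)
  open import Data.List.Membership.Propositional.Properties using (∈-lookup)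
  open import Data.Nat.DivMod using (%-distribˡ-+; m%n%n≡m%n; [m+n]%n≡m%n; m<n⇒m%n≡m)
  import Data.Integer as ℤ
  import Data.Integer.Properties as ℤ
  open import Data.Rational as ℚ using (ℚ; mkℚ; 0ℚ; 1ℚ; toℚᵘ; ≢-nonZero)
  import Data.Rational.Properties as ℚ
  open import Data.Rational.Solver using (module +-*-Solver)
  open import Data.Rational.Unnormalised as ℚᵘ using (mkℚᵘ; *≡*; *≤*; _≃_)
  import Data.Rational.Unnormalised.Properties as ℚᵘ
  open import Data.Sum using ([_,_])
  open import Defs hiding (sym)

  -- Weighted counting over lists

  𝟙 : Bool → ℕ
  𝟙 b = if b then 1 else 0

  𝟙≤1 : ∀ b → 𝟙 b ≤ 1
  𝟙≤1 true  = ≤-refl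
  𝟙≤1 false = z≤n

  𝟙-not : ∀ b → 𝟙 b + 𝟙 (not b) ≡ 1
  𝟙-not true  = refl
  𝟙-not false = refl

  cert : ∀ {a b} A B s → A ≤ B → a + B + s ≡ b + A → a ≤ b
  cert {a} {b} A B s A≤B eq = +-cancelʳ-≤ B a b
    (≤-trans (m≤m+n (a + B) s) (≤-trans (≤-reflexive eq) (+-monoʳ-≤ b A≤B)))

  wt : {A : Set} → (A → ℕ) → List A → ℕ
  wt φ xs = sum (map φ xs)

  wt-++ : ∀ {A : Set} (φ : A → ℕ) xs ys → wt φ (xs ++ ys) ≡ wt φ xs + wt φ ys
  wt-++ φ xs ys = trans (cong sum (map-++ φ xs ys)) (sum-++ (map φ xs) (map φ ys))

  wt-cong : ∀ {A : Set} {φ ψ : A → ℕ} xs → (∀ x → φ x ≡ ψ x) → wt φ xs ≡ wt ψ xs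
  wt-cong []       e = refl
  wt-cong (x ∷ xs) e = cong₂ _+_ (e x) (wt-cong xs e)

  wt-+ : ∀ {A : Set} (φ ψ : A → ℕ) xs → wt (λ x → φ x + ψ x) xs ≡ wt φ xs + wt ψ xs
  wt-+ φ ψ []       = refl
  wt-+ φ ψ (x ∷ xs) rewrite wt-+ φ ψ xs = lem (φ x) (ψ x) (wt φ xs) (wt ψ xs)
    where
    lem : ∀ a b c d → a + b + (c + d) ≡ a + c + (b + d)
    lem = solve-∀

  wt-* : ∀ {A : Set} k (φ : A → ℕ) xs → wt (λ x → k * φ x) xs ≡ k * wt φ xs
  wt-* k φ []       = sym (*-zeroʳ k)
  wt-* k φ (x ∷ xs) rewrite wt-* k φ xs = sym (*-distribˡ-+ k (φ x) (wt φ xs))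

  wt-const : ∀ {A : Set} k (xs : List A) → wt (λ _ → k) xs ≡ length xs * k
  wt-const k []       = refl
  wt-const k (x ∷ xs) = cong (k +_) (wt-const k xs)

  wt-1 : ∀ {A : Set} (xs : List A) → wt (λ _ → 1) xs ≡ length xs
  wt-1 xs = trans (wt-const 1 xs) (*-identityʳ _)

  wt-≤ : ∀ {A : Set} {φ ψ : A → ℕ} xs → (∀ {x} → x ∈ xs → φ x ≤ ψ x) → wt φ xs ≤ wt ψ xs
  wt-≤ []       h = z≤n
  wt-≤ (x ∷ xs) h = +-mono-≤ (h (here refl)) (wt-≤ xs (h ∘ there))

  wt≤length : ∀ {A : Set} {φ : A → ℕ} xs → (∀ x → φ x ≤ 1) → wt φ xs ≤ length xs
  wt≤length xs h = ≤-trans (wt-≤ xs (λ {x} _ → h x)) (≤-reflexive (wt-1 xs))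

  ∈⇒≤wt : ∀ {A : Set} (φ : A → ℕ) {x} xs → x ∈ xs → φ x ≤ wt φ xs
  ∈⇒≤wt φ (x ∷ xs) (here refl) = m≤m+n _ _
  ∈⇒≤wt φ (x ∷ xs) (there p)   = ≤-trans (∈⇒≤wt φ xs p) (m≤n+m _ _)

  wt-map : ∀ {A B : Set} (φ : B → ℕ) (f : A → B) xs → wt φ (map f xs) ≡ wt (φ ∘ f) xs
  wt-map φ f xs = cong sum (sym (map-∘ xs))

  wt-fubini : ∀ {A B : Set} (f : A → B → ℕ) xs ys →
    wt (λ a → wt (f a) ys) xs ≡ wt (λ b → wt (λ a → f a b) xs) ys
  wt-fubini f []       ys = sym (trans (wt-const 0 ys) (*-zeroʳ (length ys)))
  wt-fubini f (x ∷ xs) ys = trans (cong (wt (f x) ys +_) (wt-fubini f xs ys))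
    (sym (wt-+ (f x) (λ b → wt (λ a → f a b) xs) ys))

  wt-replicate : ∀ {A : Set} (φ : A → ℕ) k x → wt φ (replicate k x) ≡ k * φ x
  wt-replicate φ zero    x = refl
  wt-replicate φ (suc k) x = cong (φ x +_) (wt-replicate φ k x)

  Σᶠ : ∀ {r} → (Fin r → ℕ) → ℕ
  Σᶠ {r} f = wt f (allFin r)

  Σᶠ-suc : ∀ {r} (f : Fin (suc r) → ℕ) → Σᶠ f ≡ f zero + Σᶠ (f ∘ suc)
  Σᶠ-suc {r} f = cong (λ l → f zero + sum l)
    (trans (map-tabulate suc f) (sym (map-tabulate id (f ∘ suc))))

  Σᶠ-const : ∀ {r} k → Σᶠ {r} (λ _ → k) ≡ r * k
  Σᶠ-const {r} k = trans (wt-const k (allFin r)) (cong (_* k) (length-tabulate {n = r} (λ c → c)))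

  δ : ∀ {r} → Fin r → Fin r → ℕ
  δ c d = 𝟙 ⌊ d ≟ᶠ c ⌋

  δ-same : ∀ {r} (c : Fin r) → δ c c ≡ 1
  δ-same c with c ≟ᶠ c
  ... | yes _ = refl
  ... | no ¬p = ⊥-elim (¬p refl)

  δ-diff : ∀ {r} {c d : Fin r} → d ≢ c → δ c d ≡ 0
  δ-diff {c = c} {d} d≢c with d ≟ᶠ c
  ... | yes p = ⊥-elim (d≢c p)
  ... | no _  = refl

  Σᶠ-δ* : ∀ {r} (c : Fin r) k → Σᶠ (λ d → δ c d * k) ≡ k
  Σᶠ-δ* {suc r} zero k = trans (Σᶠ-suc {r} (λ d → δ zero d * k))
    (trans (cong (k + 0 +_) (trans (Σᶠ-const {r} 0) (*-zeroʳ r))) (lem k))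
    where
    lem : ∀ k → k + 0 + 0 ≡ k
    lem = solve-∀
  Σᶠ-δ* {suc r} (suc c) k = trans (Σᶠ-suc {r} (λ d → δ (suc c) d * k))
    (trans (wt-cong (allFin r) eq) (Σᶠ-δ* c k))
    where
    eq : ∀ d → δ (suc c) (suc d) * k ≡ δ c d * k
    eq d with d ≟ᶠ c
    ... | yes _ = refl
    ... | no  _ = refl

  -- Equality of multisets is expressed by equality of all weights.
  record Split {A : Set} (xs ys zs : List A) : Set where
    constructor split
    field
      weight : ∀ φ → wt φ xs ≡ wt φ ys + wt φ zs
      left   : ∀ {x} → x ∈ ys → x ∈ xs
      right  : ∀ {x} → x ∈ zs → x ∈ xs
  open Split public

  module _ {A : Set} where

    Split-length : ∀ {xs ys zs : List A} → Split xs ys zs → length xs ≡ length ys + length zs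
    Split-length {xs} {ys} {zs} s =
      trans (sym (wt-1 xs)) (trans (weight s (λ _ → 1)) (cong₂ _+_ (wt-1 ys) (wt-1 zs)))

    Split-trans : ∀ {xs ys zs us vs : List A} → Split xs ys zs → Split ys us vs → Split xs us (vs ++ zs)
    Split-trans {zs = zs} {us} {vs} s t = split
      (λ φ → trans (weight s φ) (trans (cong (_+ wt φ zs) (weight t φ))
        (trans (+-assoc (wt φ us) _ _) (cong (wt φ us +_) (sym (wt-++ φ vs zs))))))
      (left s ∘ left t)
      (λ p → [ left s ∘ right t , right s ] (∈-++⁻ vs p))

    choose : ∀ (p : A → Bool) a xs → a ≤ wt (𝟙 ∘ p) xs →
      ∃₂ λ ys zs → Split xs ys zs × length ys ≡ a × (∀ {x} → x ∈ ys → p x ≡ true)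
    choose p zero xs _ = [] , xs , split (λ _ → refl) (λ ()) id , refl , λ ()
    choose p (suc a) (x ∷ xs) h with p x in eq
    ... | true with choose p a xs (≤-pred h)
    ...   | ys , zs , s , l , q = x ∷ ys , zs ,
            split (λ φ → trans (cong (φ x +_) (weight s φ)) (sym (+-assoc (φ x) _ _)))
              (λ { (here e) → here e ; (there m) → there (left s m) }) (there ∘ right s) ,
            cong suc l , λ { (here refl) → eq ; (there m) → q m }
    choose p (suc a) (x ∷ xs) h | false with choose p (suc a) xs h
    ...   | ys , zs , s , l , q = ys , x ∷ zs ,
            split (λ φ → trans (cong (φ x +_) (weight s φ)) (lem (φ x) (wt φ ys) (wt φ zs)))
              (there ∘ left s) (λ { (here e) → here e ; (there m) → there (right s m) }) , l , q
      where
      lem : ∀ a b c → a + (b + c) ≡ b + (a + c)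
      lem = solve-∀

    chooseAny : ∀ a xs → a ≤ length xs → ∃₂ λ ys zs → Split {A} xs ys zs × length ys ≡ a
    chooseAny a xs h with choose (λ _ → true) a xs (subst (a ≤_) (sym (wt-1 xs)) h)
    ... | ys , zs , s , l , _ = ys , zs , s , l

    -- Iterated halving: one of the two truth values of each test keeps half of the list.
    homogeneous : ∀ (ts : List (A → Bool)) M xs → M * 2 ^ length ts ≤ length xs →
      ∃₂ λ ys zs → Split xs ys zs × M ≤ length ys ×
        (∀ {t} → t ∈ ts → ∀ {x y} → x ∈ ys → y ∈ ys → t x ≡ t y)
    homogeneous [] M xs h = xs , [] , split (λ φ → sym (+-identityʳ _)) id (λ ()) ,
      subst (_≤ length xs) (*-identityʳ M) h , λ ()
    homogeneous (t ∷ ts) M xs h = go (≤-total N (wt (𝟙 ∘ t) xs))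
      where
      N = M * 2 ^ length ts
      Result = ∃₂ λ ys zs → Split xs ys zs × M ≤ length ys ×
        (∀ {u} → u ∈ t ∷ ts → ∀ {x y} → x ∈ ys → y ∈ ys → u x ≡ u y)
      total : wt (𝟙 ∘ t) xs + wt (𝟙 ∘ not ∘ t) xs ≡ length xs
      total = trans (sym (wt-+ (𝟙 ∘ t) (𝟙 ∘ not ∘ t) xs))
        (trans (wt-cong xs (λ x → 𝟙-not (t x))) (wt-1 xs))
      half : ∀ (p : A → Bool) (v : Bool) → (∀ x → p x ≡ true → t x ≡ v) → N ≤ wt (𝟙 ∘ p) xs → Result
      half p v pv le with choose p _ xs le
      ... | us , vs , s , l , q with homogeneous ts M us (≤-reflexive (sym l))
      ...   | ys , zs , s′ , M≤ , hom = ys , zs ++ vs , Split-trans s s′ , M≤ , λ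
              { (here refl) x∈ y∈ → trans (pv _ (q (left s′ x∈))) (sym (pv _ (q (left s′ y∈))))
              ; (there u∈) → hom u∈ }
      double : ∀ M k → M * (k + (k + 0)) ≡ M * k + M * k
      double = solve-∀
      go : N ≤ wt (𝟙 ∘ t) xs ⊎ wt (𝟙 ∘ t) xs ≤ N → Result
      go (inj₁ le) = half t true (λ _ e → e) le
      go (inj₂ ge) = half (not ∘ t) false (λ x e → notInj (t x) e)
        (+-cancelˡ-≤ N N _ (≤-trans (≤-reflexive (sym (double M (2 ^ length ts))))
          (≤-trans h (≤-trans (≤-reflexive (sym total)) (+-monoˡ-≤ _ ge)))))
        where
        notInj : ∀ b → not b ≡ true → b ≡ false
        notInj false _ = refl

    above-average : ∀ (g : A → ℕ) L xs → length xs * L < wt g xs →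
      ∃₂ λ x ys → Split xs (x ∷ []) ys × L < g x
    above-average g L (x ∷ xs) h with L <? g x
    ... | yes L< = x , xs , split (λ φ → cong (_+ wt φ xs) (sym (+-identityʳ (φ x))))
                     (λ { (here e) → here e }) there , L<
    ... | no L≮ with above-average g L xs (+-cancelˡ-< L _ _ (≤-trans h (+-monoˡ-≤ _ (≮⇒≥ L≮))))
    ...   | y , ys , s , L< = y , x ∷ ys ,
            split (λ φ → trans (cong (φ x +_) (weight s φ)) (lem (φ x) (φ y) (wt φ ys)))
              (there ∘ left s) (λ { (here e) → here e ; (there m) → there (right s m) }) , L<
      where
      lem : ∀ a b c → a + (b + 0 + c) ≡ b + 0 + (a + c)
      lem = solve-∀

  -- Blocks, ghosts and tiles

  module Blocks {n : ℕ} (G : Graph n) (ρ Q Δ : ℕ) where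

    r P B : ℕ
    r = suc (suc ρ)
    P = Q + Δ
    B = suc ρ * P + Q

    V A : Set
    V = Fin n
    A = Maybe V

    -- nothing is a ghost: an auxiliary vertex adjacent to everything, available in unlimited supply.
    adjᵍ : A → A → Bool
    adjᵍ (just u) (just v) = adj G u v
    adjᵍ _        _        = true

    adjᵍ-sym : ∀ x y → adjᵍ x y ≡ adjᵍ y x
    adjᵍ-sym (just u) (just v) = Graph.sym G u v
    adjᵍ-sym (just _) nothing  = refl
    adjᵍ-sym nothing  (just _) = refl
    adjᵍ-sym nothing  nothing  = refl

    onReal : (V → ℕ) → A → ℕ
    onReal φ = maybe′ φ 0

    ghost : A → ℕ
    ghost = maybe′ (λ _ → 0) 1

    reals : List A → List V
    reals []             = []
    reals (just v ∷ xs)  = v ∷ reals xs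
    reals (nothing ∷ xs) = reals xs

    wt-reals : ∀ φ xs → wt φ (reals xs) ≡ wt (onReal φ) xs
    wt-reals φ []             = refl
    wt-reals φ (just v ∷ xs)  = cong (φ v +_) (wt-reals φ xs)
    wt-reals φ (nothing ∷ xs) = wt-reals φ xs

    real+ghost : ∀ xs → wt (onReal (λ _ → 1)) xs + wt ghost xs ≡ length xs
    real+ghost xs = trans (sym (wt-+ (onReal (λ _ → 1)) ghost xs)) (trans (wt-cong xs eq) (wt-1 xs))
      where
      eq : ∀ x → onReal (λ _ → 1) x + ghost x ≡ 1
      eq (just _) = refl
      eq nothing  = refl

    Block : Set
    Block = Fin r → List A

    Complete : Block → Set
    Complete S = ∀ {c d} → c ≢ d → ∀ {x y} → x ∈ S c → y ∈ S d → adjᵍ x y ≡ true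

    w : (A → ℕ) → Block → ℕ
    w φ S = Σᶠ (λ c → wt φ (S c))

    w-+ : ∀ φ ψ S → w (λ x → φ x + ψ x) S ≡ w φ S + w ψ S
    w-+ φ ψ S = trans (wt-cong (allFin r) (λ c → wt-+ φ ψ (S c)))
        (wt-+ (λ c → wt φ (S c)) (λ c → wt ψ (S c)) (allFin r))

    w-1 : ∀ S → w (λ _ → 1) S ≡ Σᶠ (length ∘ S)
    w-1 S = wt-cong (allFin r) (wt-1 ∘ S)

    w-≤ : ∀ {φ ψ} S → (∀ x → φ x ≤ ψ x) → w φ S ≤ w ψ S
    w-≤ S h = wt-≤ (allFin r) (λ {c} _ → wt-≤ (S c) (λ {x} _ → h x))

    sz : Fin r → Fin r → ℕ
    sz j c = Q + 𝟙 (not ⌊ c ≟ᶠ j ⌋) * Δ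

    sz+δ : ∀ j c → sz j c + δ j c * Δ ≡ P
    sz+δ j c = trans (lem (𝟙 (not ⌊ c ≟ᶠ j ⌋)) (δ j c) Q Δ)
      (trans (cong (λ t → Q + t * Δ) (trans (+-comm (𝟙 (not ⌊ c ≟ᶠ j ⌋)) (δ j c)) (𝟙-not ⌊ c ≟ᶠ j ⌋)))
        (cong (Q +_) (+-identityʳ Δ)))
      where
      lem : ∀ a b Q Δ → Q + a * Δ + b * Δ ≡ Q + (a + b) * Δ
      lem = solve-∀

    sz≤P : ∀ j c → sz j c ≤ P
    sz≤P j c = ≤-trans (m≤m+n _ _) (≤-reflexive (sz+δ j c))

    sz-diff : ∀ {j c} → c ≢ j → sz j c ≡ P
    sz-diff {j} {c} c≢j with c ≟ᶠ j
    ... | yes p = ⊥-elim (c≢j p)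
    ... | no _  = cong (Q +_) (+-identityʳ Δ)

    sz-same : ∀ j → sz j j ≡ Q
    sz-same j with j ≟ᶠ j
    ... | yes _ = +-identityʳ Q
    ... | no ¬p = ⊥-elim (¬p refl)

    sz-sym : ∀ j c → sz j c ≡ sz c j
    sz-sym j c with c ≟ᶠ j | j ≟ᶠ c
    ... | yes _ | yes _ = refl
    ... | no _  | no _  = refl
    ... | yes p | no ¬q = ⊥-elim (¬q (sym p))
    ... | no ¬p | yes q = ⊥-elim (¬p (sym q))

    Σsz : ∀ j → Σᶠ (sz j) ≡ B
    Σsz j = +-cancelʳ-≡ Δ _ _ (trans (cong (Σᶠ (sz j) +_) (sym (Σᶠ-δ* j Δ)))
      (trans (sym (wt-+ (sz j) (λ c → δ j c * Δ) (allFin r)))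
        (trans (wt-cong (allFin r) (sz+δ j)) (trans (Σᶠ-const {r} P) (lem ρ Q Δ)))))
      where
      lem : ∀ ρ Q Δ → suc (suc ρ) * (Q + Δ) ≡ suc ρ * (Q + Δ) + Q + Δ
      lem = solve-∀

    P≤B : P ≤ B
    P≤B = ≤-trans (m≤m+n P (ρ * P)) (m≤m+n _ Q)

    record Tile (m : ℕ) : Set where
      field
        small    : Fin r
        cls      : Block
        size     : ∀ c → length (cls c) ≡ sz small c * m
        complete : Complete cls
    open Tile public

    wᵗ : ∀ {m} → (A → ℕ) → Tile m → ℕ
    wᵗ φ K = w φ (cls K)

    ws : ∀ {m} → (A → ℕ) → List (Tile m) → ℕ
    ws φ = wt (wᵗ φ)

    tile-size : ∀ {m} (K : Tile m) → wᵗ (λ _ → 1) K ≡ B * m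
    tile-size {m} K = trans (w-1 (cls K)) (trans (wt-cong (allFin r)
        (λ c → trans (size K c) (*-comm (sz (small K) c) m)))
      (trans (wt-* m (sz (small K)) (allFin r)) (trans (cong (m *_) (Σsz (small K))) (*-comm m B))))

    tiles-size : ∀ {m} (Ts : List (Tile m)) → ws (λ _ → 1) Ts ≡ length Ts * (B * m)
    tiles-size {m} Ts = trans (wt-cong Ts tile-size) (wt-const (B * m) Ts)

    chooseBlock : (p : Fin r → A → Bool) (a : Fin r → ℕ) (S : Block) → (∀ c → a c ≤ wt (𝟙 ∘ p c) (S c)) →
      ∃₂ λ (Y Z : Block) → (∀ c → Split (S c) (Y c) (Z c)) × (∀ c → length (Y c) ≡ a c) ×
        (∀ c {x} → x ∈ Y c → p c x ≡ true)
    chooseBlock p a S h =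
      (λ c → proj₁ (f c)) , (λ c → proj₁ (proj₂ (f c))) , (λ c → proj₁ (proj₂ (proj₂ (f c)))) ,
      (λ c → proj₁ (proj₂ (proj₂ (proj₂ (f c))))) , (λ c → proj₂ (proj₂ (proj₂ (proj₂ (f c)))))
      where
      f : ∀ c → _
      f c = choose (p c) (a c) (S c) (h c)

    w-split : ∀ φ {S Y Z : Block} → (∀ c → Split (S c) (Y c) (Z c)) → w φ S ≡ w φ Y + w φ Z
    w-split φ {Y = Y} {Z} s = trans (wt-cong (allFin r) (λ c → weight (s c) φ))
      (wt-+ (λ c → wt φ (Y c)) (λ c → wt φ (Z c)) (allFin r))

    empty-wt : ∀ {X : Set} (φ : X → ℕ) xs → length xs ≡ 0 → wt φ xs ≡ 0
    empty-wt φ [] _ = refl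

    assemble : ∀ m js (S : Block) → Complete S → (∀ c → length (S c) ≡ wt (λ j → sz j c) js * m) →
      Σ (List (Tile m)) λ Ts → ∀ φ → ws φ Ts ≡ w φ S
    assemble m [] S _ len = [] , λ φ → sym (trans (wt-cong (allFin r) (λ c → empty-wt φ (S c) (len c)))
      (trans (Σᶠ-const {r} 0) (*-zeroʳ r)))
    assemble m (j ∷ js) S comp len =
      record { small = j ; cls = Y ; size = lenY ; complete = λ c≢d x y → comp c≢d (left (s _) x) (left (s _) y) }
        ∷ proj₁ rest ,
      λ φ → trans (cong (w φ Y +_) (proj₂ rest φ)) (sym (w-split φ s))
      where
      enough : ∀ c → sz j c * m ≤ wt (𝟙 ∘ (λ (_ : A) → true)) (S c)
      enough c = subst (sz j c * m ≤_) (sym (trans (wt-1 (S c)) (len c))) (*-monoˡ-≤ m (m≤m+n (sz j c) _))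
      chosen = chooseBlock (λ _ _ → true) (λ c → sz j c * m) S enough
      Y = proj₁ chosen
      Z = proj₁ (proj₂ chosen)
      s = proj₁ (proj₂ (proj₂ chosen))
      lenY = proj₁ (proj₂ (proj₂ (proj₂ chosen)))
      lenZ : ∀ c → length (Z c) ≡ wt (λ j → sz j c) js * m
      lenZ c = +-cancelˡ-≡ (sz j c * m) _ _ (trans (cong (_+ length (Z c)) (sym (lenY c)))
        (trans (sym (Split-length (s c))) (trans (len c) (*-distribʳ-+ m (sz j c) _))))
      rest = assemble m js Z (λ c≢d x y → comp c≢d (right (s _) x) (right (s _) y)) lenZ

    put : Fin r → List A → Block → Block
    put c₀ N S c = if ⌊ c ≟ᶠ c₀ ⌋ then N else S c

    w-put : ∀ φ c₀ N S → w φ (put c₀ N S) + wt φ (S c₀) ≡ w φ S + wt φ N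
    w-put φ c₀ N S = trans (cong (w φ (put c₀ N S) +_) (sym (Σᶠ-δ* c₀ (wt φ (S c₀)))))
      (trans (sym (wt-+ (λ c → wt φ (put c₀ N S c)) (λ c → δ c₀ c * wt φ (S c₀)) (allFin r)))
        (trans (wt-cong (allFin r) eq)
          (trans (wt-+ (λ c → wt φ (S c)) (λ c → δ c₀ c * wt φ N) (allFin r)) (cong (w φ S +_) (Σᶠ-δ* c₀ (wt φ N))))))
      where
      eq : ∀ c → wt φ (put c₀ N S c) + δ c₀ c * wt φ (S c₀) ≡ wt φ (S c) + δ c₀ c * wt φ N
      eq c with c ≟ᶠ c₀
      ... | yes refl = trans (cong (wt φ N +_) (+-identityʳ _))
          (trans (+-comm (wt φ N) _) (cong (wt φ (S c) +_) (sym (+-identityʳ _))))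
      ... | no _     = refl

    put-complete : ∀ {c₀ N S} → (∀ {c d} → c ≢ d → c ≢ c₀ → d ≢ c₀ → ∀ {x y} → x ∈ S c → y ∈ S d → adjᵍ x y ≡ true) →
      (∀ {d} → d ≢ c₀ → ∀ {x y} → x ∈ N → y ∈ S d → adjᵍ x y ≡ true) → Complete (put c₀ N S)
    put-complete {c₀} {N} {S} hS hN {c} {d} c≢d {x} {y} x∈ y∈ with c ≟ᶠ c₀ | d ≟ᶠ c₀
    ... | yes refl | yes refl = ⊥-elim (c≢d refl)
    ... | yes _    | no d≢    = hN d≢ x∈ y∈
    ... | no c≢    | yes _    = trans (adjᵍ-sym x y) (hN c≢ y∈ x∈)
    ... | no c≢    | no d≢    = hS c≢d c≢ d≢ x∈ y∈

    retile : ∀ {m′} e e′ (K : Tile ((e + e′) * m′)) {Y Z : Block} c₀ N js →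
      (∀ c → Split (cls K c) (Y c) (Z c)) → (∀ c → length (Y c) ≡ sz (small K) c * (e * m′)) →
      Complete (put c₀ N Y) → (∀ c → length (put c₀ N Y c) ≡ wt (λ j → sz j c) js * m′) →
      Σ (List (Tile m′)) λ Ts → ∀ φ → ws φ Ts + wt φ (Y c₀) ≡ wᵗ φ K + wt φ N
    retile {m′} e e′ K {Y} {Z} c₀ N js s lenY comp len =
      proj₁ T₁ ++ proj₁ T₂ , λ φ → trans (cong (_+ wt φ (Y c₀))
          (trans (wt-++ _ (proj₁ T₁) (proj₁ T₂)) (cong₂ _+_ (proj₂ T₁ φ) (proj₂ T₂ φ))))
        (trans (lem₁ (w φ (put c₀ N Y)) (w φ Z) (wt φ (Y c₀)))
          (trans (cong (_+ w φ Z) (w-put φ c₀ N Y))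
            (trans (lem₁ (w φ Y) (wt φ N) (w φ Z)) (cong (_+ wt φ N) (sym (w-split φ s))))))
      where
      lem₁ : ∀ a b c → a + b + c ≡ a + c + b
      lem₁ = solve-∀
      lem₂ : ∀ a e e′ m → a * ((e + e′) * m) ≡ a * (e * m) + e′ * a * m
      lem₂ = solve-∀
      j = small K
      lenZ : ∀ c → length (Z c) ≡ wt (λ j → sz j c) (replicate e′ j) * m′
      lenZ c = +-cancelˡ-≡ (sz j c * (e * m′)) _ _ (trans (cong (_+ length (Z c)) (sym (lenY c)))
        (trans (sym (Split-length (s c))) (trans (size K c)
          (trans (lem₂ (sz j c) e e′ m′) (cong (λ t → sz j c * (e * m′) + t * m′)
              (sym (wt-replicate (λ j → sz j c) e′ j)))))))
      T₁ = assemble m′ js (put c₀ N Y) comp len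
      T₂ = assemble m′ (replicate e′ j) Z (λ c≢d x y → complete K c≢d (right (s _) x) (right (s _) y)) lenZ

    cut : ∀ C m′ (Ts : List (Tile (C * m′))) → Σ (List (Tile m′)) λ Ts′ → ∀ φ → ws φ Ts′ ≡ ws φ Ts
    cut C m′ []       = [] , λ _ → refl
    cut C m′ (K ∷ Ts) with cut C m′ Ts | assemble m′ (replicate C (small K)) (cls K) (complete K) len
      where
      lem : ∀ a C m → a * (C * m) ≡ C * a * m
      lem = solve-∀
      len : ∀ c → length (cls K c) ≡ wt (λ j → sz j c) (replicate C (small K)) * m′
      len c = trans (size K c) (trans (lem (sz (small K) c) C m′)
          (cong (_* m′) (sym (wt-replicate (λ j → sz j c) C (small K)))))
    ... | Ts′ , e | Us , f = Us ++ Ts′ , λ φ → trans (wt-++ _ Us Ts′) (cong₂ _+_ (f φ) (e φ))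

  -- Improving a single tile

  <ᵇ-sound : ∀ a b → (a <ᵇ b) ≡ true → a < b
  <ᵇ-sound a b e = <ᵇ⇒< a b (subst IsTrue (sym e) tt)

  wt-concat-replicate : ∀ {A : Set} (φ : A → ℕ) k xs → wt φ (concat (replicate k xs)) ≡ k * wt φ xs
  wt-concat-replicate φ zero    xs = refl
  wt-concat-replicate φ (suc k) xs = trans (wt-++ φ xs _) (cong (wt φ xs +_) (wt-concat-replicate φ k xs))

  wt-lb : ∀ {A : Set} (φ : A → ℕ) k xs → (∀ {x} → x ∈ xs → k ≤ φ x) → length xs * k ≤ wt φ xs
  wt-lb φ k xs h = ≤-trans (≤-reflexive (sym (wt-const k xs))) (wt-≤ xs h)

  wt-ub : ∀ {A : Set} (φ : A → ℕ) k xs → (∀ {x} → x ∈ xs → φ x ≤ k) → wt φ xs ≤ length xs * k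
  wt-ub φ k xs h = ≤-trans (wt-≤ xs h) (≤-reflexive (wt-const k xs))

  module Improvement {n : ℕ} (G : Graph n) (ρ Q Δ : ℕ) (1≤Δ : 1 ≤ Δ) (C m′ : ℕ)
    (B≤C : Blocks.B G ρ Q Δ ≤ C) (u : Fin n → ℕ) (1≤u : ∀ v → 1 ≤ u v) where

    open Blocks G ρ Q Δ public

    1≤P : 1 ≤ P
    1≤P = ≤-trans 1≤Δ (m≤n+m Δ Q)

    1≤B : 1 ≤ B
    1≤B = ≤-trans 1≤P P≤B

    m : ℕ
    m = C * m′

    nbr : V → A → ℕ
    nbr y = 𝟙 ∘ adjᵍ (just y)

    cheaper : V → A → Bool
    cheaper y x = onReal u x <ᵇ u y

    Seen Throw : Tile m → V → Fin r → Set
    Seen  K y c = sz (small K) c * (B * m′) ≤ wt (nbr y) (cls K c)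
    Throw K y c = P * m′ ≤ wt (𝟙 ∘ cheaper y) (cls K c)

    Gain : Tile m → V → Set
    Gain K y = ∀ c → c ≢ small K → Seen K y c

    Swap : Tile m → V → Fin r → Set
    Swap K y c = c ≢ small K × (∀ d → d ≢ c → Seen K y d) × Throw K y c

    Improvable : Tile m → V → Set
    Improvable K y = Gain K y ⊎ ∃ (Swap K y)

    seen? : ∀ K y c → Dec (Seen K y c)
    seen? K y c = _ ≤? _

    throw? : ∀ K y c → Dec (Throw K y c)
    throw? K y c = _ ≤? _

    seenExcept? : ∀ K y c → Dec (∀ d → d ≢ c → Seen K y d)
    seenExcept? K y c = all? (λ d → ¬? (d ≟ᶠ c) →-dec seen? K y d)

    improvable? : ∀ K y → Dec (Improvable K y)
    improvable? K y = seenExcept? K y (small K) ⊎-dec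
      any? (λ c → ¬? (c ≟ᶠ small K) ×-dec (seenExcept? K y c ×-dec throw? K y c))

    supply : ℕ
    supply = P * m′ + Δ * B * m′

    record Move (K : Tile m) (Ys : List V) : Set where
      field
        tiles          : List (Tile m′)
        used rest back : List V
        splits         : Split Ys used rest
        conserved      : ∀ φ → ws (onReal φ) tiles + wt φ back ≡ wᵗ (onReal φ) K + wt φ used
        ghosts         : ws ghost tiles ≤ wᵗ ghost K
        decrease       : wt u back + m′ ≤ wt u used
        back≤used      : length back ≤ length used
        used≤          : length used ≤ supply

    ∈-map-just : ∀ {x : A} {ys : List V} → x ∈ map just ys → ∃ λ y → y ∈ ys × x ≡ just y
    ∈-map-just = ∈-map⁻ just

    wt-ghost-real : ∀ ys → wt ghost (map just ys) ≡ 0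
    wt-ghost-real []       = refl
    wt-ghost-real (y ∷ ys) = wt-ghost-real ys

    m≤k*m : ∀ {k} → 1 ≤ k → m′ ≤ k * m′
    m≤k*m h = ≤-trans (≤-reflexive (sym (*-identityˡ m′))) (*-monoˡ-≤ m′ h)

    module _ (K : Tile m) (Ys : List V) (enough : supply ≤ length Ys) (y₀ : V) (y₀∈ : y₀ ∈ Ys)
      (sameNbr : ∀ {y} → y ∈ Ys → ∀ {c x} → x ∈ cls K c → adjᵍ (just y) x ≡ adjᵍ (just y₀) x)
      (sameU : ∀ {y} → y ∈ Ys → u y ≡ u y₀) where

      private
        j : Fin r
        j = small K

      retile′ : ∀ {C} e e′ → C ≡ e + e′ → (K : Tile (C * m′)) {Y Z : Block} → ∀ c₀ N js →
        (∀ c → Split (cls K c) (Y c) (Z c)) → (∀ c → length (Y c) ≡ sz (small K) c * (e * m′)) →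
        Complete (put c₀ N Y) → (∀ c → length (put c₀ N Y c) ≡ wt (λ j → sz j c) js * m′) →
        Σ (List (Tile m′)) λ Ts → ∀ φ → ws φ Ts + wt φ (Y c₀) ≡ wᵗ φ K + wt φ N
      retile′ e e′ refl = retile e e′

      seesPart : Fin r → (A → Bool) → Fin r → A → Bool
      seesPart c q d = if ⌊ d ≟ᶠ c ⌋ then q else adjᵍ (just y₀)

      seesPart-same : ∀ c q {x} → seesPart c q c x ≡ q x
      seesPart-same c q with c ≟ᶠ c
      ... | yes _ = refl
      ... | no ¬p = ⊥-elim (¬p refl)

      seesPart-diff : ∀ {c q d x} → d ≢ c → seesPart c q d x ≡ adjᵍ (just y₀) x
      seesPart-diff {c} {d = d} d≢c with d ≟ᶠ c
      ... | yes p = ⊥-elim (d≢c p)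
      ... | no _  = refl

      select : ∀ c q e → (∀ d → d ≢ c → sz j d * (e * m′) ≤ wt (nbr y₀) (cls K d)) →
        sz j c * (e * m′) ≤ wt (𝟙 ∘ q) (cls K c) →
        ∃₂ λ (Y Z : Block) → (∀ d → Split (cls K d) (Y d) (Z d)) × (∀ d → length (Y d) ≡ sz j d * (e * m′)) ×
          (∀ {d} → d ≢ c → ∀ {x y} → y ∈ Ys → x ∈ Y d → adjᵍ (just y) x ≡ true) × (∀ {x} → x ∈ Y c → q x ≡ true)
      select c q e hd hc with chooseBlock (seesPart c q) (λ d → sz j d * (e * m′)) (cls K) enough′
        where
        enough′ : ∀ d → sz j d * (e * m′) ≤ wt (𝟙 ∘ seesPart c q d) (cls K d)
        enough′ d with d ≟ᶠ c
        ... | yes refl = hc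
        ... | no d≢c   = hd d d≢c
      ... | Y , Z , s , len , sees = Y , Z , s , len ,
            (λ d≢c y∈ x∈ → trans (sameNbr y∈ (left (s _) x∈)) (trans (sym (seesPart-diff d≢c)) (sees _ x∈))) ,
            (λ {x} x∈ → trans (sym (seesPart-same c q)) (sees c x∈))

      -- B units of K and (P − Q) B units of Ys form exactly P unit tiles for each choice of the small class.
      gain : Gain K y₀ → Move K Ys
      gain g with select j (λ _ → true) B g
               (≤-trans (*-monoʳ-≤ (sz j j) (*-monoˡ-≤ m′ B≤C))
                 (≤-reflexive (sym (trans (wt-1 (cls K j)) (size K j)))))
             | chooseAny (Δ * B * m′) Ys (≤-trans (m≤n+m _ (P * m′)) enough)
      ... | Y , Z , s , lenY , adjY , _ | used , rest , sp , lenU = record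
        { tiles = proj₁ T ; used = used ; rest = rest ; back = [] ; splits = sp
        ; conserved = λ φ → trans (+-identityʳ _) (trans (tilesWt (onReal φ))
            (cong (wᵗ (onReal φ) K +_) (wt-map (onReal φ) just used)))
        ; ghosts = ≤-reflexive (trans (tilesWt ghost) (trans (cong (wᵗ ghost K +_) (wt-ghost-real used))
            (+-identityʳ _)))
        ; decrease = ≤-trans (≤-trans (m≤k*m (*-mono-≤ 1≤Δ 1≤B))
            (≤-reflexive (trans (sym lenU) (sym (*-identityʳ _)))))
            (wt-lb u 1 used (λ {x} _ → 1≤u x))
        ; back≤used = z≤n
        ; used≤ = ≤-trans (≤-reflexive lenU) (m≤n+m _ (P * m′)) }
        where
        N = Y j ++ map just used
        js = concat (replicate P (allFin r))
        demand : ∀ c → wt (λ i → sz i c) js ≡ P * B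
        demand c = trans (wt-concat-replicate (λ i → sz i c) P (allFin r))
          (cong (P *_) (trans (wt-cong (allFin r) (λ i → sz-sym i c)) (Σsz c)))
        len : ∀ c → length (put j N Y c) ≡ wt (λ i → sz i c) js * m′
        len c with c ≟ᶠ j
        ... | yes refl = trans (length-++ (Y j)) (trans (cong₂ _+_ (trans (lenY j) (cong (_* (B * m′)) (sz-same j)))
            (trans (length-map just used) lenU))
                (trans (lem Q Δ B m′) (cong (_* m′) (sym (demand j)))))
          where
          lem : ∀ Q Δ B m → Q * (B * m) + Δ * B * m ≡ (Q + Δ) * B * m
          lem = solve-∀
        ... | no c≢j = trans (lenY c) (trans (cong (_* (B * m′)) (sz-diff c≢j))
            (trans (sym (*-assoc P B m′)) (cong (_* m′) (sym (demand c)))))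
        adjN : ∀ {d} → d ≢ j → ∀ {x y} → x ∈ N → y ∈ Y d → adjᵍ x y ≡ true
        adjN d≢j x∈ y∈ with ∈-++⁻ (Y j) x∈
        ... | inj₁ x∈Y = complete K (d≢j ∘ sym) (left (s _) x∈Y) (left (s _) y∈)
        ... | inj₂ x∈U with ∈-map-just x∈U
        ...   | y , y∈U , refl = adjY d≢j (left sp y∈U) y∈
        T = retile′ B (C ∸ B) (sym (m+[n∸m]≡n B≤C)) K j N js s lenY
              (put-complete (λ c≢d _ _ x y → complete K c≢d (left (s _) x) (left (s _) y)) adjN) len
        tilesWt : ∀ φ → ws φ (proj₁ T) ≡ wᵗ φ K + wt φ (map just used)
        tilesWt φ = +-cancelʳ-≡ (wt φ (Y j)) _ _ (trans (proj₂ T φ)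
          (trans (cong (wᵗ φ K +_) (wt-++ φ (Y j) (map just used))) (lem (wᵗ φ K) _ _)))
          where
          lem : ∀ a b c → a + (b + c) ≡ a + c + b
          lem = solve-∀

      swap : ∃ (Swap K y₀) → Move K Ys
      swap (c , c≢j , see , throw)
        with select c (cheaper y₀) 1 (λ d d≢c → ≤-trans (*-monoʳ-≤ (sz j d) (*-monoˡ-≤ m′ 1≤B)) (see d d≢c))
               (≤-trans (≤-reflexive (trans (cong (_* (1 * m′)) (sz-diff c≢j)) (cong (P *_) (*-identityˡ m′)))) throw)
           | chooseAny (P * m′) Ys (≤-trans (m≤m+n (P * m′) _) enough)
      ... | Y , Z , s , lenY , adjY , cheap | used , rest , sp , lenU = record
        { tiles = proj₁ T ; used = used ; rest = rest ; back = reals (Y c) ; splits = sp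
        ; conserved = λ φ → trans (cong (ws (onReal φ) (proj₁ T) +_) (wt-reals φ (Y c)))
            (trans (proj₂ T (onReal φ)) (cong (wᵗ (onReal φ) K +_) (wt-map (onReal φ) just used)))
        ; ghosts = ≤-trans (m≤m+n _ (wt ghost (Y c))) (≤-reflexive
            (trans (proj₂ T ghost) (trans (cong (wᵗ ghost K +_) (wt-ghost-real used)) (+-identityʳ _))))
        ; decrease = dec
        ; back≤used = ≤-trans (≤-reflexive (sym (wt-1 (reals (Y c))))) (≤-trans (≤-reflexive (wt-reals _ (Y c)))
            (≤-trans (≤-trans (m≤m+n _ _) (≤-reflexive (real+ghost (Y c)))) (≤-reflexive (trans lenYc (sym lenU)))))
        ; used≤ = ≤-trans (≤-reflexive lenU) (m≤m+n (P * m′) _) }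
        where
        lenYc : length (Y c) ≡ P * m′
        lenYc = trans (lenY c) (trans (cong (_* (1 * m′)) (sz-diff c≢j)) (cong (P *_) (*-identityˡ m′)))
        N = map just used
        len : ∀ d → length (put c N Y d) ≡ wt (λ i → sz i d) (j ∷ []) * m′
        len d with d ≟ᶠ c
        ... | yes refl = trans (length-map just used) (trans lenU
            (cong (_* m′) (trans (sym (sz-diff c≢j)) (sym (+-identityʳ _)))))
        ... | no _     = trans (lenY d) (cong₂ _*_ (sym (+-identityʳ (sz j d))) (*-identityˡ m′))
        adjN : ∀ {d} → d ≢ c → ∀ {x y} → x ∈ N → y ∈ Y d → adjᵍ x y ≡ true
        adjN d≢c x∈ y∈ with ∈-map-just x∈
        ... | y , y∈U , refl = adjY d≢c (left sp y∈U) y∈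
        T = retile′ 1 (C ∸ 1) (sym (m+[n∸m]≡n (≤-trans 1≤B B≤C))) K c N (j ∷ []) s lenY
              (put-complete (λ c≢d _ _ x y → complete K c≢d (left (s _) x) (left (s _) y)) adjN) len
        dec : wt u (reals (Y c)) + m′ ≤ wt u used
        dec = begin
          wt u (reals (Y c)) + m′                        ≤⟨ +-mono-≤ (≤-reflexive (wt-reals u (Y c))) (m≤k*m 1≤P) ⟩
          wt (onReal u) (Y c) + P * m′                   ≡⟨ cong (wt (onReal u) (Y c) +_)
              (trans (sym lenYc) (sym (wt-1 (Y c)))) ⟩
          wt (onReal u) (Y c) + wt (λ _ → 1) (Y c)       ≡⟨ wt-+ (onReal u) (λ _ → 1) (Y c) ⟨
          wt (λ x → onReal u x + 1) (Y c)                ≤⟨ wt-ub _ (u y₀) (Y c)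
              (λ x∈ → ≤-trans (≤-reflexive (+-comm _ 1)) (<ᵇ-sound _ _ (cheap x∈))) ⟩
          length (Y c) * u y₀                            ≡⟨ cong (_* u y₀) (trans lenYc (sym lenU)) ⟩
          length used * u y₀                             ≤⟨ wt-lb u (u y₀) used
              (λ y∈ → ≤-reflexive (sym (sameU (left sp y∈)))) ⟩
          wt u used                                      ∎
          where open ≤-Reasoning

      move : Improvable K y₀ → Move K Ys
      move (inj₁ g) = gain g
      move (inj₂ s) = swap s

  -- Many tiles are improvable

  step-arith : ∀ P0 deg Gh N s2 wl R I → deg + Gh ≤ N + (s2 + wl) → P0 * N ≤ R + I →
    P0 * (deg + Gh) ≤ R + I + P0 * (s2 + wl)
  step-arith P0 deg Gh N s2 wl R I h₁ h₂ = ≤-trans (*-monoʳ-≤ P0 h₁)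
    (≤-trans (≤-reflexive (*-distribˡ-+ P0 N (s2 + wl))) (+-monoˡ-≤ (P0 * (s2 + wl)) h₂))

  finish-arith : ∀ q c BP deg n b R Gh e K → 1 ≤ q →
    BP * (deg + Gh) ≤ R + c * Gh + e + K → q * R ≤ BP * (q * deg + n) + q * b → suc c ≤ BP →
    8 * e ≤ 3 * Gh → 8 * (BP * n) ≤ q * Gh → 8 * b ≤ Gh → Gh ≤ 3 * K
  finish-arith q@(suc _) c BP deg n b R Gh e K (s≤s _) hT hR hc he hn hb =
    *-cancelˡ-≤ 3 (≤-trans (*-cancelˡ-≤ q main) (≤-trans (*-monoˡ-≤ K (m≤m+n 8 1)) (≤-reflexive (nine K))))
    where
    nine : ∀ K → 9 * K ≡ 3 * (3 * K)
    nine = solve-∀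
    id₁ : ∀ q c BP deg n b R Gh e K →
      q * (3 * Gh) + (8 * q * (R + c * Gh + e + K) + (8 * (BP * (q * deg + n) + q * b) +
          (8 * q * Gh * BP + (q * (3 * Gh) + (q * Gh + q * Gh))))) + 0
      ≡ q * (8 * K) + (8 * q * (BP * (deg + Gh)) + (8 * (q * R) +
          (8 * q * Gh * suc c + (q * (8 * e) + (8 * (BP * n) + q * (8 * b))))))
    id₁ = solve-∀
    main : q * (3 * Gh) ≤ q * (8 * K)
    main = cert (8 * q * (BP * (deg + Gh)) + (8 * (q * R) + (8 * q * Gh * suc c +
        (q * (8 * e) + (8 * (BP * n) + q * (8 * b))))))
      (8 * q * (R + c * Gh + e + K) + (8 * (BP * (q * deg + n) + q * b) +
          (8 * q * Gh * BP + (q * (3 * Gh) + (q * Gh + q * Gh))))) 0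
      (+-mono-≤ (*-monoʳ-≤ (8 * q) hT) (+-mono-≤ (*-monoʳ-≤ 8 hR) (+-mono-≤ (*-monoʳ-≤ (8 * q * Gh) hc)
        (+-mono-≤ (*-monoʳ-≤ q he) (+-mono-≤ hn (*-monoʳ-≤ q hb))))))
      (id₁ q c BP deg n b R Gh e K)

  scaled-arith : ∀ {B0 P0 P B Q0} c f m n Gh → B0 * P ≡ P0 * B + Q0 → f * (B * m) ≤ n + Gh →
    B0 * (f * (c * P * m)) ≤ c * P0 * n + c * P0 * Gh + c * Q0 * (m * f)
  scaled-arith {B0} {P0} {P} {B} {Q0} c f m n Gh e h = begin
    B0 * (f * (c * P * m))                         ≡⟨ l₁ B0 f c P m ⟩
    c * f * m * (B0 * P)                           ≡⟨ cong (c * f * m *_) e ⟩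
    c * f * m * (P0 * B + Q0)                      ≡⟨ l₂ c f m P0 B Q0 ⟩
    c * P0 * (f * (B * m)) + c * Q0 * (m * f)      ≤⟨ +-monoˡ-≤ _ (*-monoʳ-≤ (c * P0) h) ⟩
    c * P0 * (n + Gh) + c * Q0 * (m * f)           ≡⟨ cong (_+ c * Q0 * (m * f)) (*-distribˡ-+ (c * P0) n Gh) ⟩
    c * P0 * n + c * P0 * Gh + c * Q0 * (m * f)    ∎
    where
    open ≤-Reasoning
    l₁ : ∀ B0 f c P m → B0 * (f * (c * P * m)) ≡ c * f * m * (B0 * P)
    l₁ = solve-∀
    l₂ : ∀ c f m P0 B Q0 → c * f * m * (P0 * B + Q0) ≡ c * P0 * (f * (B * m)) + c * Q0 * (m * f)
    l₂ = solve-∀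

  module Counting {n : ℕ} (G : Graph n) (ρ Q Δ : ℕ) (1≤Δ : 1 ≤ Δ) (C m′ : ℕ)
    (B≤C : Blocks.B G ρ Q Δ ≤ C) (u : Fin n → ℕ) (1≤u : ∀ v → 1 ≤ u v)
    (P0 Q0 q : ℕ) (1≤P0 : 1 ≤ P0) (1≤q : 1 ≤ q)
    (PQ : P0 * Q ≤ Q0 * Blocks.P G ρ Q Δ)
    (BP : (suc ρ * P0 + Q0) * Blocks.P G ρ Q Δ ≡ P0 * Blocks.B G ρ Q Δ + Q0) where

    open Improvement G ρ Q Δ 1≤Δ C m′ B≤C u 1≤u public

    B0 : ℕ
    B0 = suc ρ * P0 + Q0

    dear : V → V → ℕ
    dear y v = 𝟙 (not (u v <ᵇ u y))

    dearᵍ : ∀ y x → 𝟙 (not (cheaper y x)) ≡ onReal (dear y) x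
    dearᵍ y (just v) = refl
    dearᵍ y nothing with u y | 1≤u y
    ... | suc _ | _ = refl

    unseen : ℕ
    unseen = P * (B * m′)

    ε : ℕ
    ε = P0 * (r * (P * B)) + Q0 * P

    nbrs≤ : ∀ K y c → wt (nbr y) (cls K c) ≤ sz (small K) c * m
    nbrs≤ K y c = ≤-trans (wt≤length (cls K c) (λ x → 𝟙≤1 _)) (≤-reflexive (size K c))

    nbrs≤P : ∀ K y c → wt (nbr y) (cls K c) ≤ P * m
    nbrs≤P K y c = ≤-trans (nbrs≤ K y c) (*-monoˡ-≤ m (sz≤P (small K) c))

    nbrs-unseen : ∀ K y c → ¬ Seen K y c → wt (nbr y) (cls K c) ≤ unseen
    nbrs-unseen K y c ¬s = ≤-trans (<⇒≤ (≰⇒> ¬s)) (*-monoˡ-≤ (B * m′) (sz≤P (small K) c))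

    two-unseen : ∀ K y c₁ c₂ → c₁ ≢ c₂ → ¬ Seen K y c₁ → ¬ Seen K y c₂ →
      wᵗ (nbr y) K ≤ ρ * P * m + r * unseen
    two-unseen K y c₁ c₂ c₁≢c₂ ¬s₁ ¬s₂ = cert _ _ 0 summed (lem (wᵗ (nbr y) K) ρ P m unseen)
      where
      lem : ∀ N ρ P m t → N + suc (suc ρ) * (P * m + t) + 0 ≡ ρ * P * m + suc (suc ρ) * t + (N + (P * m + P * m))
      lem = solve-∀
      pointwise : ∀ c → wt (nbr y) (cls K c) + (δ c₁ c * (P * m) + δ c₂ c * (P * m)) ≤ P * m + unseen
      pointwise c with c ≟ᶠ c₁ | c ≟ᶠ c₂
      ... | yes refl | yes refl = ⊥-elim (c₁≢c₂ refl)
      ... | yes refl | no _ = ≤-trans (+-mono-≤ (nbrs-unseen K y c ¬s₁)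
          (≤-reflexive (trans (+-identityʳ _) (+-identityʳ _)))) (≤-reflexive (+-comm unseen _))
      ... | no _ | yes refl = ≤-trans (+-mono-≤ (nbrs-unseen K y c ¬s₂) (≤-reflexive (+-identityʳ _)))
          (≤-reflexive (+-comm unseen _))
      ... | no _ | no _ = ≤-trans (≤-reflexive (+-identityʳ _)) (≤-trans (nbrs≤P K y c) (m≤m+n _ unseen))
      summed : wᵗ (nbr y) K + (P * m + P * m) ≤ r * (P * m + unseen)
      summed = ≤-trans (≤-reflexive (trans (cong (wᵗ (nbr y) K +_)
          (sym (cong₂ _+_ (Σᶠ-δ* c₁ (P * m)) (Σᶠ-δ* c₂ (P * m)))))
          (trans (cong (wᵗ (nbr y) K +_) (sym (wt-+ (λ c → δ c₁ c * (P * m)) (λ c → δ c₂ c * (P * m)) (allFin r))))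
            (sym (wt-+ (λ c → wt (nbr y) (cls K c)) (λ c → δ c₁ c * (P * m) + δ c₂ c * (P * m)) (allFin r))))))
        (≤-trans (wt-≤ (allFin r) (λ {c} _ → pointwise c)) (≤-reflexive (Σᶠ-const {r} (P * m + unseen))))

    one-unseen : ∀ K y c₁ → c₁ ≢ small K → ¬ Seen K y c₁ →
      wᵗ (nbr y) K ≤ ρ * P * m + Q * m + r * unseen
    one-unseen K y c₁ c₁≢j ¬s₁ = cert _ _ 0 summed (lem (wᵗ (nbr y) K) ρ Q Δ m unseen)
      where
      j = small K
      lem : ∀ N ρ Q Δ m t → N + suc (suc ρ) * ((Q + Δ) * m + t) + 0
        ≡ ρ * (Q + Δ) * m + Q * m + suc (suc ρ) * t + (N + ((Q + Δ) * m + Δ * m))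
      lem = solve-∀
      pointwise : ∀ c → wt (nbr y) (cls K c) + (δ c₁ c * (P * m) + δ j c * (Δ * m)) ≤ P * m + unseen
      pointwise c with c ≟ᶠ c₁
      ... | yes refl = ≤-trans (+-mono-≤ (nbrs-unseen K y c ¬s₁)
          (≤-reflexive (trans (cong (λ t → P * m + 0 + t * (Δ * m)) (δ-diff c₁≢j))
              (trans (+-identityʳ _) (+-identityʳ _))))) (≤-reflexive (+-comm unseen _))
      ... | no _ = ≤-trans (+-monoˡ-≤ _ (nbrs≤ K y c)) (≤-trans
          (≤-reflexive (trans (lem₂ (sz j c) (δ j c) Δ m) (cong (_* m) (sz+δ j c)))) (m≤m+n _ unseen))
        where
        lem₂ : ∀ a b Δ m → a * m + b * (Δ * m) ≡ (a + b * Δ) * m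
        lem₂ = solve-∀
      summed : wᵗ (nbr y) K + (P * m + Δ * m) ≤ r * (P * m + unseen)
      summed = ≤-trans (≤-reflexive (trans (cong (wᵗ (nbr y) K +_)
          (sym (cong₂ _+_ (Σᶠ-δ* c₁ (P * m)) (Σᶠ-δ* j (Δ * m)))))
          (trans (cong (wᵗ (nbr y) K +_) (sym (wt-+ (λ c → δ c₁ c * (P * m)) (λ c → δ j c * (Δ * m)) (allFin r))))
            (sym (wt-+ (λ c → wt (nbr y) (cls K c)) (λ c → δ c₁ c * (P * m) + δ j c * (Δ * m)) (allFin r))))))
        (≤-trans (wt-≤ (allFin r) (λ {c} _ → pointwise c)) (≤-reflexive (Σᶠ-const {r} (P * m + unseen))))

    dear-in-class : ∀ K y c → c ≢ small K → ¬ Throw K y c → P * m ≤ wᵗ (onReal (dear y)) K + P * m′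
    dear-in-class K y c c≢j ¬t = begin
      P * m                                                                        ≡⟨ trans
          (cong (_* m) (sym (sz-diff c≢j))) (sym (size K c)) ⟩
      length (cls K c)                                                             ≡⟨ trans (sym (wt-1 (cls K c)))
          (wt-cong (cls K c) (λ x → sym (trans (+-comm (𝟙 (not (cheaper y x))) _) (𝟙-not (cheaper y x))))) ⟩
      wt (λ x → 𝟙 (not (cheaper y x)) + 𝟙 (cheaper y x)) (cls K c)                 ≡⟨ wt-+ (𝟙 ∘ not ∘ cheaper y)
          (𝟙 ∘ cheaper y) (cls K c) ⟩
      wt (𝟙 ∘ not ∘ cheaper y) (cls K c) + wt (𝟙 ∘ cheaper y) (cls K c)            ≤⟨ +-mono-≤
          (≤-reflexive (wt-cong (cls K c) (dearᵍ y))) (<⇒≤ (≰⇒> ¬t)) ⟩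
      wt (onReal (dear y)) (cls K c) + P * m′                                      ≤⟨ +-monoˡ-≤ (P * m′)
          (∈⇒≤wt (λ d → wt (onReal (dear y)) (cls K d)) (allFin r) (∈-allFin c)) ⟩
      wᵗ (onReal (dear y)) K + P * m′                                              ∎
      where open ≤-Reasoning

    stuck-bounds : ∀ K y → ¬ Improvable K y →
      P0 * wᵗ (nbr y) K ≤ ρ * P0 * P * m + Q0 * wᵗ (onReal (dear y)) K + ε * m′ ×
      P0 * wᵗ (nbr y) K ≤ (ρ * P0 + Q0) * P * m + ε * m′
    stuck-bounds K y ¬imp with ¬∀⟶∃¬ r _ (λ c → ¬? (c ≟ᶠ small K) →-dec seen? K y c) (¬imp ∘ inj₁)
    ... | c₁ , ¬c₁ with seenExcept? K y c₁
    ...   | no ¬all with ¬∀⟶∃¬ r _ (λ c → ¬? (c ≟ᶠ c₁) →-dec seen? K y c) ¬all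
    ...     | c₂ , ¬c₂ = ≤-trans bound (+-monoˡ-≤ (ε * m′) (m≤m+n (ρ * P0 * P * m) (Q0 * wᵗ (onReal (dear y)) K))) ,
        ≤-trans bound (+-monoˡ-≤ (ε * m′) (*-monoˡ-≤ m (*-monoˡ-≤ P (m≤m+n (ρ * P0) Q0))))
      where
      lem : ∀ P0 ρ P m r B m′ e → P0 * (ρ * P * m + r * (P * (B * m′))) + e * P * m′ ≡ ρ * P0 * P * m +
          (P0 * (r * (P * B)) + e * P) * m′
      lem = solve-∀
      bound : P0 * wᵗ (nbr y) K ≤ ρ * P0 * P * m + ε * m′
      bound = ≤-trans (*-monoʳ-≤ P0 (two-unseen K y c₁ c₂ (λ e → ¬c₂ (λ ≢ → ⊥-elim (≢ (sym e)))) (λ s → ¬c₁ (λ _ → s))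
          (λ s → ¬c₂ (λ _ → s))))
        (≤-trans (m≤m+n _ (Q0 * P * m′)) (≤-reflexive (lem P0 ρ P m r B m′ Q0)))
    stuck-bounds K y ¬imp | c₁ , ¬c₁ | yes all =
        ≤-trans bound (≤-trans (+-monoʳ-≤ (ρ * P0 * P * m) (+-monoˡ-≤ (P0 * (r * unseen))
            (*-monoʳ-≤ Q0 (dear-in-class K y c₁ c₁≢j ¬throw))))
          (≤-reflexive (lem₂ P0 ρ P m r B m′ Q0 (wᵗ (onReal (dear y)) K)))) ,
        ≤-trans bound (≤-trans (m≤m+n _ (Q0 * P * m′)) (≤-reflexive (lem₃ P0 ρ P m r B m′ Q0)))
      where
      c₁≢j : c₁ ≢ small K
      c₁≢j e = ¬c₁ (λ ≢ → ⊥-elim (≢ e))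
      ¬throw : ¬ Throw K y c₁
      ¬throw t = ¬imp (inj₂ (c₁ , c₁≢j , all , t))
      lem₂ : ∀ P0 ρ P m r B m′ Q0 X → ρ * P0 * P * m + (Q0 * (X + P * m′) + P0 * (r * (P * (B * m′)))) ≡ ρ * P0 * P *
          m + Q0 * X + (P0 * (r * (P * B)) + Q0 * P) * m′
      lem₂ = solve-∀
      lem₃ : ∀ P0 ρ P m r B m′ Q0 → ρ * P0 * P * m + (Q0 * (P * m) + P0 * (r * (P * (B * m′)))) + Q0 * P * m′ ≡
          (ρ * P0 + Q0) * P * m + (P0 * (r * (P * B)) + Q0 * P) * m′
      lem₃ = solve-∀
      lem₁ : ∀ P0 ρ P m Q t → P0 * (ρ * P * m + Q * m + t) ≡ ρ * P0 * P * m + (P0 * Q * m + P0 * t)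
      lem₁ = solve-∀
      lem₄ : ∀ Q0 P m → Q0 * P * m ≡ Q0 * (P * m)
      lem₄ = solve-∀
      bound : P0 * wᵗ (nbr y) K ≤ ρ * P0 * P * m + (Q0 * (P * m) + P0 * (r * (P * (B * m′))))
      bound = ≤-trans (*-monoʳ-≤ P0 (one-unseen K y c₁ c₁≢j (λ s → ¬c₁ (λ _ → s))))
        (≤-trans (≤-reflexive (lem₁ P0 ρ P m Q (r * unseen)))
            (+-monoʳ-≤ (ρ * P0 * P * m) (+-monoˡ-≤ (P0 * (r * unseen))
          (≤-trans (*-monoˡ-≤ m PQ) (≤-reflexive (lem₄ Q0 P m))))))

    imp : V → Tile m → ℕ
    imp y K = 𝟙 ⌊ improvable? K y ⌋

    tile-bounds : ∀ y K →
      P0 * wᵗ (nbr y) K ≤ (ρ * P0 * P * m + ε * m′ + Q0 * wᵗ (onReal (dear y)) K) + P0 * (B * m) * imp y K ×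
      P0 * wᵗ (nbr y) K ≤ ((ρ * P0 + Q0) * P * m + ε * m′) + P0 * (B * m) * imp y K
    tile-bounds y K with improvable? K y
    ... | yes _ = ≤-trans all (m≤n+m _ _) , ≤-trans all (m≤n+m _ _)
      where
      all : P0 * wᵗ (nbr y) K ≤ P0 * (B * m) * 1
      all = ≤-trans (*-monoʳ-≤ P0 (≤-trans (w-≤ (cls K) (λ x → 𝟙≤1 (adjᵍ (just y) x))) (≤-reflexive (tile-size K))))
          (≤-reflexive (sym (*-identityʳ _)))
    ... | no ¬i = ≤-trans (proj₁ (stuck-bounds K y ¬i)) (≤-trans (≤-reflexive (lem (ρ * P0 * P * m) _ (ε * m′)))
        (m≤m+n _ _)) ,
                  ≤-trans (proj₂ (stuck-bounds K y ¬i)) (m≤m+n _ _)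
      where
      lem : ∀ a b c → a + b + c ≡ a + c + b
      lem = solve-∀

    module _ (y : V) (F : List (Tile m)) where

      private
        f N X I : ℕ
        f = length F
        N = ws (nbr y) F
        X = ws (onReal (dear y)) F
        I = wt (imp y) F

      sum-low : P0 * N ≤ (f * (ρ * P0 * P * m) + f * (ε * m′) + Q0 * X) + P0 * (B * m) * I
      sum-low = ≤-trans (≤-reflexive (sym (wt-* P0 (wᵗ (nbr y)) F)))
          (≤-trans (wt-≤ F (λ {K} _ → proj₁ (tile-bounds y K)))
        (≤-reflexive (trans (wt-+ (λ K → ρ * P0 * P * m + ε * m′ + Q0 * wᵗ (onReal (dear y)) K)
            (λ K → P0 * (B * m) * imp y K) F)
          (cong₂ _+_ (trans (wt-+ (λ _ → ρ * P0 * P * m + ε * m′) (λ K → Q0 * wᵗ (onReal (dear y)) K) F)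
              (cong₂ _+_ (trans (wt-const _ F) (*-distribˡ-+ f _ _)) (wt-* Q0 (wᵗ (onReal (dear y))) F)))
            (wt-* (P0 * (B * m)) (imp y) F)))))

      sum-high : P0 * N ≤ (f * ((ρ * P0 + Q0) * P * m) + f * (ε * m′)) + P0 * (B * m) * I
      sum-high = ≤-trans (≤-reflexive (sym (wt-* P0 (wᵗ (nbr y)) F)))
          (≤-trans (wt-≤ F (λ {K} _ → proj₂ (tile-bounds y K)))
        (≤-reflexive (trans (wt-+ (λ _ → (ρ * P0 + Q0) * P * m + ε * m′) (λ K → P0 * (B * m) * imp y K) F)
          (cong₂ _+_ (trans (wt-const _ F) (*-distribˡ-+ f _ _)) (wt-* (P0 * (B * m)) (imp y) F)))))

    Conserved : List (Tile m) → List (Tile m′) → List V → Set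
    Conserved F D W = ∀ φ → wt φ W + (ws (onReal φ) F + ws (onReal φ) D) ≡ Σᶠ φ

    ws-≤ : ∀ {k φ ψ} (Ts : List (Tile k)) → (∀ x → φ x ≤ ψ x) → ws φ Ts ≤ ws ψ Ts
    ws-≤ Ts h = wt-≤ Ts (λ {K} _ → w-≤ (cls K) h)

    ws-+ : ∀ {k} φ ψ (Ts : List (Tile k)) → ws (λ x → φ x + ψ x) Ts ≡ ws φ Ts + ws ψ Ts
    ws-+ φ ψ Ts = trans (wt-cong Ts (λ K → w-+ φ ψ (cls K))) (wt-+ (wᵗ φ) (wᵗ ψ) Ts)

    ws-cong : ∀ {k φ ψ} (Ts : List (Tile k)) → (∀ x → φ x ≡ ψ x) → ws φ Ts ≡ ws ψ Ts
    ws-cong Ts h = wt-cong Ts (λ K → wt-cong (allFin r) (λ c → wt-cong (cls K c) h))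

    one : A → ℕ
    one _ = 1

    real : A → ℕ
    real = onReal (λ _ → 1)

    real+ghost≡one : ∀ {k} (Ts : List (Tile k)) → ws real Ts + ws ghost Ts ≡ ws one Ts
    real+ghost≡one Ts = trans (sym (ws-+ real ghost Ts)) (ws-cong Ts (λ { (just _) → refl ; nothing → refl }))

    ghosts : List (Tile m) → List (Tile m′) → ℕ
    ghosts F D = ws ghost F + ws ghost D

    module _ (F : List (Tile m)) (D : List (Tile m′)) (W : List V) (cons : Conserved F D W) where

      private
        Gh sD : ℕ
        Gh = ghosts F D
        sD = ws one D

      total-size : n + Gh ≡ length W + (length F * (B * m) + sD)
      total-size = trans (cong (_+ Gh) (trans (trans (sym (*-identityʳ n)) (sym (Σᶠ-const {n} 1)))
          (sym (cons (λ _ → 1)))))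
        (trans (lem (wt (λ _ → 1) W) (ws real F) (ws real D) (ws ghost F) (ws ghost D))
            (cong₂ _+_ (wt-1 W) (cong₂ _+_ (trans (real+ghost≡one F) (tiles-size F)) (real+ghost≡one D))))
        where
        lem : ∀ a b c d e → a + (b + c) + (d + e) ≡ a + ((b + d) + (c + e))
        lem = solve-∀

      fresh-size : length F * (B * m) ≤ n + Gh
      fresh-size = ≤-trans (≤-trans (m≤m+n _ sD) (m≤n+m _ (length W))) (≤-reflexive (sym total-size))

      degree-bound : ∀ y → degree G y + Gh ≤ ws (nbr y) F + (sD + sD + length W)
      degree-bound y = begin
        degree G y + Gh                                                                   ≡⟨ cong (_+ Gh)
            (sym (cons (λ v → 𝟙 (adj G y v)))) ⟩
        wt a W + (ws aᵍ F + ws aᵍ D) + (ws ghost F + ws ghost D)                          ≡⟨ lem (wt a W) (ws aᵍ F)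
            (ws aᵍ D) (ws ghost F) (ws ghost D) ⟩
        (ws aᵍ F + ws ghost F) + (ws aᵍ D + ws ghost D + wt a W)                          ≤⟨ +-mono-≤
            (≤-reflexive nbrF) (+-mono-≤ (+-mono-≤ (ws-≤ D aᵍ≤1) (ws-≤ D ghost≤1)) (wt≤length W (λ v → 𝟙≤1 _))) ⟩
        ws (nbr y) F + (sD + sD + length W)                                               ∎
        where
        open ≤-Reasoning
        a : V → ℕ
        a v = 𝟙 (adj G y v)
        aᵍ : A → ℕ
        aᵍ = onReal a
        lem : ∀ w p q s t → w + (p + q) + (s + t) ≡ (p + s) + (q + t + w)
        lem = solve-∀
        nbrF : ws aᵍ F + ws ghost F ≡ ws (nbr y) F
        nbrF = trans (sym (ws-+ aᵍ ghost F)) (ws-cong F (λ { (just v) → +-identityʳ _ ; nothing → refl }))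
        aᵍ≤1 : ∀ x → aᵍ x ≤ 1
        aᵍ≤1 (just v) = 𝟙≤1 _
        aᵍ≤1 nothing  = z≤n
        ghost≤1 : ∀ x → ghost x ≤ 1
        ghost≤1 (just v) = z≤n
        ghost≤1 nothing  = ≤-refl

      dear-bound : ∀ y → ws (onReal (dear y)) F ≤ Σᶠ (dear y)
      dear-bound y = ≤-trans (≤-trans (m≤m+n _ _) (m≤n+m _ (wt (dear y) W))) (≤-reflexive (cons (dear y)))

      module _ (low : ∀ y → B0 * Σᶠ (dear y) ≤ P0 * n →
                  q * (ρ * P0 * P0 * n + B0 * (Q0 * Σᶠ (dear y))) ≤ B0 * P0 * (q * degree G y + n) + q * (B0 * Q0))
               (high : ∀ y → P0 * n ≤ B0 * Σᶠ (dear y) →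
                  q * ((ρ * P0 + Q0) * P0 * n) ≤ B0 * P0 * (q * degree G y + n) + q * (B0 * Q0))
               (e₁ : 8 * (B0 * P0 * n) ≤ q * Gh)
               (e₂ : 8 * ((ρ * P0 + Q0) * Q0 * (m * length F)) ≤ Gh)
               (e₃ : 8 * (B0 * (length F * (ε * m′))) ≤ Gh)
               (e₄ : 8 * (B0 * (P0 * (sD + sD + length W))) ≤ Gh)
               (e₅ : 8 * (B0 * Q0) ≤ Gh) where

        many-improvable : ∀ y → Gh ≤ 3 * (B0 * (P0 * (B * m) * wt (imp y) F))
        many-improvable y with ≤-total (B0 * Σᶠ (dear y)) (P0 * n)
        ... | inj₁ x≤ = finish-arith q (ρ * P0 * P0) (B0 * P0) (degree G y) n (B0 * Q0)
            (ρ * P0 * P0 * n + B0 * (Q0 * Σᶠ (dear y))) Gh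
              (ρ * P0 * Q0 * (m * length F) + B0 * (length F * (ε * m′)) + B0 * (P0 * (sD + sD + length W)))
              (B0 * (P0 * (B * m) * wt (imp y) F)) 1≤q main (low y x≤)
              (≤-trans (+-monoˡ-≤ _ (*-mono-≤ 1≤P0 1≤P0)) (≤-trans (m≤m+n _ (Q0 * P0)) (≤-reflexive (idc ρ P0 Q0)))) e
                  e₁ e₅
          where
          idc : ∀ ρ P0 Q0 → P0 * P0 + ρ * P0 * P0 + Q0 * P0 ≡ (suc ρ * P0 + Q0) * P0
          idc = solve-∀
          e : 8 * (ρ * P0 * Q0 * (m * length F) + B0 * (length F * (ε * m′)) + B0 * (P0 * (sD + sD + length W))) ≤ 3 *
              Gh
          e = ≤-trans (≤-reflexive (dist (ρ * P0 * Q0 * (m * length F)) _ _)) (≤-trans (+-mono-≤ (+-mono-≤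
                (≤-trans (*-monoʳ-≤ 8 (*-monoˡ-≤ (m * length F) (*-monoˡ-≤ Q0 (m≤m+n (ρ * P0) Q0)))) e₂) e₃) e₄)
                    (≤-reflexive (three Gh)))
            where
            dist : ∀ a b c → 8 * (a + b + c) ≡ 8 * a + 8 * b + 8 * c
            dist = solve-∀
            three : ∀ a → a + a + a ≡ 3 * a
            three = solve-∀
          idm : ∀ B0 a b x c d → B0 * (a + b + x + c + d) ≡ B0 * a + (B0 * b + B0 * x + B0 * c + B0 * d)
          idm = solve-∀
          idr : ∀ A0 c1 l b x i t → A0 + c1 + l + (b + x + i + t) ≡ A0 + x + c1 + (l + b + t) + i
          idr = solve-∀
          main : B0 * P0 * (degree G y + Gh) ≤ ρ * P0 * P0 * n + B0 * (Q0 * Σᶠ (dear y)) + ρ * P0 * P0 * Gh +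
            (ρ * P0 * Q0 * (m * length F) + B0 * (length F * (ε * m′)) + B0 * (P0 * (sD + sD + length W))) + B0 *
                (P0 * (B * m) * wt (imp y) F)
          main = begin
            B0 * P0 * (degree G y + Gh) ≡⟨ *-assoc B0 P0 _ ⟩
            B0 * (P0 * (degree G y + Gh)) ≤⟨ *-monoʳ-≤ B0 (step-arith P0 (degree G y) Gh (ws (nbr y) F) (sD + sD)
                (length W)
               (length F * (ρ * P0 * P * m) + length F * (ε * m′) + Q0 * Σᶠ (dear y)) (P0 * (B * m) * wt (imp y) F)
                   (degree-bound y)
               (≤-trans (sum-low y F) (+-monoˡ-≤ (P0 * (B * m) * wt (imp y) F)
                   (+-monoʳ-≤ (length F * (ρ * P0 * P * m) + length F * (ε * m′)) (*-monoʳ-≤ Q0 (dear-bound y)))))) ⟩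
            B0 * (length F * (ρ * P0 * P * m) + length F * (ε * m′) + Q0 * Σᶠ (dear y) + P0 * (B * m) * wt (imp y) F +
                P0 * (sD + sD + length W))
              ≡⟨ idm B0 (length F * (ρ * P0 * P * m)) _ _ _ _ ⟩
            B0 * (length F * (ρ * P0 * P * m)) + (B0 * (length F * (ε * m′)) + B0 * (Q0 * Σᶠ (dear y)) + B0 *
                (P0 * (B * m) * wt (imp y) F) + B0 * (P0 * (sD + sD + length W)))
              ≤⟨ +-monoˡ-≤ _ (scaled-arith {B0} {P0} {P} {B} {Q0} (ρ * P0) (length F) m n Gh BP fresh-size) ⟩
            ρ * P0 * P0 * n + ρ * P0 * P0 * Gh + ρ * P0 * Q0 * (m * length F) +
                (B0 * (length F * (ε * m′)) + B0 * (Q0 * Σᶠ (dear y)) + B0 * (P0 * (B * m) * wt (imp y) F) + B0 *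
                (P0 * (sD + sD + length W)))
              ≡⟨ idr (ρ * P0 * P0 * n) (ρ * P0 * P0 * Gh) (ρ * P0 * Q0 * (m * length F)) (B0 * (length F * (ε * m′)))
                  (B0 * (Q0 * Σᶠ (dear y))) (B0 * (P0 * (B * m) * wt (imp y) F)) (B0 * (P0 * (sD + sD + length W))) ⟩
            ρ * P0 * P0 * n + B0 * (Q0 * Σᶠ (dear y)) + ρ * P0 * P0 * Gh +
              (ρ * P0 * Q0 * (m * length F) + B0 * (length F * (ε * m′)) + B0 * (P0 * (sD + sD + length W))) + B0 *
                  (P0 * (B * m) * wt (imp y) F) ∎
            where open ≤-Reasoning
        ... | inj₂ x≥ = finish-arith q ((ρ * P0 + Q0) * P0) (B0 * P0) (degree G y) n (B0 * Q0)
            ((ρ * P0 + Q0) * P0 * n) Gh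
              ((ρ * P0 + Q0) * Q0 * (m * length F) + B0 * (length F * (ε * m′)) + B0 * (P0 * (sD + sD + length W)))
              (B0 * (P0 * (B * m) * wt (imp y) F)) 1≤q main (high y x≥)
              (≤-trans (+-monoˡ-≤ _ (*-mono-≤ 1≤P0 1≤P0)) (≤-reflexive (idc ρ P0 Q0))) e e₁ e₅
          where
          idc : ∀ ρ P0 Q0 → P0 * P0 + (ρ * P0 + Q0) * P0 ≡ (suc ρ * P0 + Q0) * P0
          idc = solve-∀
          e : 8 * ((ρ * P0 + Q0) * Q0 * (m * length F) + B0 * (length F * (ε * m′)) + B0 *
              (P0 * (sD + sD + length W))) ≤ 3 * Gh
          e = ≤-trans (≤-reflexive (dist ((ρ * P0 + Q0) * Q0 * (m * length F)) _ _))
              (≤-trans (+-mono-≤ (+-mono-≤ e₂ e₃) e₄) (≤-reflexive (three Gh)))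
            where
            dist : ∀ a b c → 8 * (a + b + c) ≡ 8 * a + 8 * b + 8 * c
            dist = solve-∀
            three : ∀ a → a + a + a ≡ 3 * a
            three = solve-∀
          idm : ∀ B0 a b c d → B0 * (a + b + c + d) ≡ B0 * a + (B0 * b + B0 * c + B0 * d)
          idm = solve-∀
          idr : ∀ A0 c1 l b i t → A0 + c1 + l + (b + i + t) ≡ A0 + c1 + (l + b + t) + i
          idr = solve-∀
          main : B0 * P0 * (degree G y + Gh) ≤ (ρ * P0 + Q0) * P0 * n + (ρ * P0 + Q0) * P0 * Gh +
            ((ρ * P0 + Q0) * Q0 * (m * length F) + B0 * (length F * (ε * m′)) + B0 * (P0 * (sD + sD + length W))) + B0
                * (P0 * (B * m) * wt (imp y) F)
          main = begin
            B0 * P0 * (degree G y + Gh) ≡⟨ *-assoc B0 P0 _ ⟩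
            B0 * (P0 * (degree G y + Gh)) ≤⟨ *-monoʳ-≤ B0 (step-arith P0 (degree G y) Gh (ws (nbr y) F) (sD + sD)
                (length W)
               (length F * ((ρ * P0 + Q0) * P * m) + length F * (ε * m′)) (P0 * (B * m) * wt (imp y) F)
                   (degree-bound y) (sum-high y F)) ⟩
            B0 * (length F * ((ρ * P0 + Q0) * P * m) + length F * (ε * m′) + P0 * (B * m) * wt (imp y) F + P0 *
                (sD + sD + length W))
              ≡⟨ idm B0 (length F * ((ρ * P0 + Q0) * P * m)) _ _ _ ⟩
            B0 * (length F * ((ρ * P0 + Q0) * P * m)) + (B0 * (length F * (ε * m′)) + B0 *
                (P0 * (B * m) * wt (imp y) F) + B0 * (P0 * (sD + sD + length W)))
              ≤⟨ +-monoˡ-≤ _ (scaled-arith {B0} {P0} {P} {B} {Q0} (ρ * P0 + Q0) (length F) m n Gh BP fresh-size) ⟩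
            (ρ * P0 + Q0) * P0 * n + (ρ * P0 + Q0) * P0 * Gh + (ρ * P0 + Q0) * Q0 * (m * length F) +
                (B0 * (length F * (ε * m′)) + B0 * (P0 * (B * m) * wt (imp y) F) + B0 * (P0 * (sD + sD + length W)))
              ≡⟨ idr ((ρ * P0 + Q0) * P0 * n) ((ρ * P0 + Q0) * P0 * Gh) ((ρ * P0 + Q0) * Q0 * (m * length F))
                  (B0 * (length F * (ε * m′))) (B0 * (P0 * (B * m) * wt (imp y) F)) (B0 * (P0 * (sD + sD + length W)))
                  ⟩
            (ρ * P0 + Q0) * P0 * n + (ρ * P0 + Q0) * P0 * Gh +
              ((ρ * P0 + Q0) * Q0 * (m * length F) + B0 * (length F * (ε * m′)) + B0 * (P0 * (sD + sD + length W))) +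
                  B0 * (P0 * (B * m) * wt (imp y) F) ∎
            where open ≤-Reasoning

        target-tile : ∀ E L → n ≤ E * Gh → 1 ≤ Gh → 3 * (B0 * P0) * (suc E * L) < length W →
          ∃₂ λ K F′ → Split F (K ∷ []) F′ × L < wt (λ y → imp y K) W
        target-tile E L n≤ 1≤Gh W> = above-average (λ K → wt (λ y → imp y K) W) L F (≰⇒> contra)
          where
          S = wt (λ K → wt (λ y → imp y K) W) F
          contra : ¬ (S ≤ length F * L)
          contra S≤ = <-irrefl refl (<-≤-trans (*-monoˡ-< Gh ⦃ >-nonZero 1≤Gh ⦄ W>) (begin
            length W * Gh ≡⟨ sym (wt-const Gh W) ⟩
            wt (λ _ → Gh) W ≤⟨ wt-≤ W (λ {y} _ → many-improvable y) ⟩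
            wt (λ y → 3 * (B0 * (P0 * (B * m) * wt (imp y) F))) W ≡⟨ wt-cong W (λ y → l₁ B0 P0 (B * m) (wt (imp y) F))
                ⟩
            wt (λ y → 3 * (B0 * P0) * (B * m) * wt (imp y) F) W ≡⟨ wt-* (3 * (B0 * P0) * (B * m)) (λ y → wt (imp y) F)
                W ⟩
            3 * (B0 * P0) * (B * m) * wt (λ y → wt (imp y) F) W ≡⟨ cong (3 * (B0 * P0) * (B * m) *_)
                (wt-fubini imp W F) ⟩
            3 * (B0 * P0) * (B * m) * S ≤⟨ *-monoʳ-≤ (3 * (B0 * P0) * (B * m)) S≤ ⟩
            3 * (B0 * P0) * (B * m) * (length F * L) ≡⟨ l₂ (3 * (B0 * P0)) (B * m) (length F) L ⟩
            3 * (B0 * P0) * (length F * (B * m) * L) ≤⟨ *-monoʳ-≤ (3 * (B0 * P0))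
                (*-monoˡ-≤ L (≤-trans fresh-size (≤-trans (+-monoˡ-≤ Gh n≤) (≤-reflexive (+-comm (E * Gh) Gh))))) ⟩
            3 * (B0 * P0) * (suc E * Gh * L) ≡⟨ l₃ (3 * (B0 * P0)) (suc E) Gh L ⟩
            3 * (B0 * P0) * (suc E * L) * Gh ∎))
            where
            open ≤-Reasoning
            l₁ : ∀ a b c d → 3 * (a * (b * c * d)) ≡ 3 * (a * b) * c * d
            l₁ = solve-∀
            l₂ : ∀ a b c d → a * b * (c * d) ≡ a * (c * b * d)
            l₂ = solve-∀
            l₃ : ∀ a b c d → a * (b * c * d) ≡ a * (b * d) * c
            l₃ = solve-∀

  -- One step of the local search

  module Stepping {n : ℕ} (G : Graph n) (ρ Q Δ : ℕ) (1≤Δ : 1 ≤ Δ) (C m′ : ℕ)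
    (B≤C : Blocks.B G ρ Q Δ ≤ C) (u : Fin n → ℕ) (1≤u : ∀ v → 1 ≤ u v)
    (P0 Q0 q : ℕ) (1≤P0 : 1 ≤ P0) (1≤q : 1 ≤ q)
    (PQ : P0 * Q ≤ Q0 * Blocks.P G ρ Q Δ)
    (BP : (suc ρ * P0 + Q0) * Blocks.P G ρ Q Δ ≡ P0 * Blocks.B G ρ Q Δ + Q0)
    (1≤m′ : 1 ≤ m′) (U E : ℕ) (u≤U : ∀ v → u v ≤ U) (1≤E : 1 ≤ E) (1≤n : 1 ≤ n)
    (Z L wmin α : ℕ) (Z-def : Z ≡ 8 * ((suc ρ * P0 + Q0) * P0) * E)
    (L-def : L ≡ (Blocks.P G ρ Q Δ * m′ + Δ * Blocks.B G ρ Q Δ * m′) * 2 ^ (Blocks.B G ρ Q Δ * (C * m′) + suc U))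
    (wmin-def : wmin ≡ 3 * ((suc ρ * P0 + Q0) * P0) * (suc E * L))
    (α-def : α ≡ suc U * (4 * suc E)) where

    open Counting G ρ Q Δ 1≤Δ C m′ B≤C u 1≤u P0 Q0 q 1≤P0 1≤q PQ BP public

    cost : List (Tile m) → List (Tile m′) → List V → ℕ
    cost F D W = α * ghosts F D + wt u W

    elems : Tile m → List A
    elems K = concat (map (cls K) (allFin r))

    wt-elems : ∀ φ K → wt φ (elems K) ≡ wᵗ φ K
    wt-elems φ K = go (allFin r)
      where
      go : ∀ cs → wt φ (concat (map (cls K) cs)) ≡ wt (λ c → wt φ (cls K c)) cs
      go []       = refl
      go (c ∷ cs) = trans (wt-++ φ (cls K c) _) (cong (wt φ (cls K c) +_) (go cs))

    length-elems : ∀ K → length (elems K) ≡ B * m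
    length-elems K = trans (sym (wt-1 (elems K))) (trans (wt-elems (λ _ → 1) K) (tile-size K))

    ∈-elems : ∀ K {c x} → x ∈ cls K c → x ∈ elems K
    ∈-elems K {c} x∈ = ∈-concat⁺′ x∈ (∈-map⁺ (cls K) (∈-allFin c))

    1≤B0 : 1 ≤ B0
    1≤B0 = ≤-trans 1≤P0 (≤-trans (m≤m+n P0 (ρ * P0)) (m≤m+n _ Q0))

    m′≤Bm : m′ ≤ B * m
    m′≤Bm = ≤-trans (m≤k*m (≤-trans 1≤B B≤C)) (≤-trans (≤-reflexive (sym (*-identityˡ m))) (*-monoˡ-≤ m 1≤B))

    tests : Tile m → List (V → Bool)
    tests K = map (λ x y → adjᵍ (just y) x) (elems K) ++ map (λ ℓ y → u y ≡ᵇ ℓ) (upTo (suc U))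

    length-tests : ∀ K → length (tests K) ≡ B * m + suc U
    length-tests K = trans (length-++ (map (λ x y → adjᵍ (just y) x) (elems K)))
      (cong₂ _+_ (trans (length-map _ (elems K)) (length-elems K))
          (trans (length-map _ (upTo (suc U))) (length-upTo (suc U))))

    improve-many : ∀ K Ys → L ≤ length Ys → (∀ {y} → y ∈ Ys → Improvable K y) →
      ∃₂ λ Ys′ Zs → Split Ys Ys′ Zs × Move K Ys′
    improve-many K Ys L≤ imps with homogeneous (tests K) supply Ys
      (≤-trans (≤-reflexive (trans (cong (λ k → supply * 2 ^ k) (length-tests K)) (sym L-def))) L≤)
    ... | [] , Zs , s , h , _ = ⊥-elim (<⇒≱ (*-mono-≤ 1≤P 1≤m′) (≤-trans (m≤m+n (P * m′) _) h))
    ... | y₀ ∷ Ys′ , Zs , s , h , hom = y₀ ∷ Ys′ , Zs , s ,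
          move K (y₀ ∷ Ys′) h y₀ (here refl)
            (λ y∈ x∈ → hom (∈-++⁺ˡ (∈-map⁺ (λ x y → adjᵍ (just y) x) (∈-elems K x∈))) y∈ (here refl))
            (λ y∈ → ≡ᵇ-sound (trans (hom (∈-++⁺ʳ (map _ (elems K))
                (∈-map⁺ (λ ℓ y → u y ≡ᵇ ℓ) (∈-upTo⁺ (s≤s (u≤U y₀))))) y∈ (here refl))
              (≡ᵇ-refl (u y₀))))
            (imps (left s (here refl)))
      where
      ≡ᵇ-sound : ∀ {a b} → (a ≡ᵇ b) ≡ true → a ≡ b
      ≡ᵇ-sound {a} {b} e = ≡ᵇ⇒≡ a b (subst IsTrue (sym e) tt)
      ≡ᵇ-refl : ∀ a → (a ≡ᵇ a) ≡ true
      ≡ᵇ-refl zero    = refl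
      ≡ᵇ-refl (suc a) = ≡ᵇ-refl a

    record Progress (F : List (Tile m)) (D : List (Tile m′)) (W : List V) : Set where
      field
        F′        : List (Tile m)
        D′        : List (Tile m′)
        W′        : List V
        conserved : Conserved F′ D′ W′
        cheaper′  : cost F′ D′ W′ + m′ ≤ cost F D W
        done≤     : ws one D′ ≤ ws one D + (B * m + supply)
        W≤        : length W′ ≤ length W ⊔ (wmin + B * m)

    dissolve : ∀ F D W → Conserved F D W → length W ≤ wmin → ∀ K F′ → Split F (K ∷ []) F′ →
      B * m < 4 * suc E * wᵗ ghost K → Progress F D W
    dissolve F D W cons W≤ K F′ s big = record
      { F′ = F′ ; D′ = D ; W′ = R ++ W ; done≤ = m≤m+n _ _
      ; conserved = λ φ → trans (cong (_+ (ws (onReal φ) F′ + ws (onReal φ) D))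
          (trans (wt-++ φ R W) (cong (_+ wt φ W) (wtR φ))))
          (trans (lem (wᵗ (onReal φ) K) (wt φ W) (ws (onReal φ) F′) (ws (onReal φ) D))
            (trans (cong (λ t → wt φ W + (t + ws (onReal φ) D)) (sym (trans (weight s (wᵗ (onReal φ))) refl)))
                (cons φ)))
      ; cheaper′ = dec
      ; W≤ = ≤-trans (≤-reflexive (length-++ R)) (≤-trans (+-mono-≤ lenR W≤)
          (≤-trans (≤-reflexive (+-comm (B * m) wmin)) (m≤n⊔m (length W) _))) }
      where
      R : List V
      R = reals (elems K)
      wtR : ∀ φ → wt φ R ≡ wᵗ (onReal φ) K
      wtR φ = trans (wt-reals φ (elems K)) (wt-elems (onReal φ) K)
      lem : ∀ k w f d → k + w + (f + d) ≡ w + (k + 0 + f + d)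
      lem = solve-∀
      lenR : length R ≤ B * m
      lenR = ≤-trans (≤-reflexive (trans (sym (wt-1 R)) (wt-reals (λ _ → 1) (elems K))))
        (≤-trans (≤-trans (m≤m+n _ _) (≤-reflexive (real+ghost (elems K)))) (≤-reflexive (length-elems K)))
      gain-ghost : wt u R + m′ ≤ α * wᵗ ghost K
      gain-ghost = begin
        wt u R + m′                              ≤⟨ +-mono-≤ (wt-ub u U R (λ {v} _ → u≤U v)) m′≤Bm ⟩
        length R * U + B * m                     ≤⟨ +-monoˡ-≤ (B * m) (*-monoˡ-≤ U lenR) ⟩
        B * m * U + B * m                        ≡⟨ l₁ (B * m) U ⟩
        suc U * (B * m)                          ≤⟨ *-monoʳ-≤ (suc U) (<⇒≤ big) ⟩
        suc U * (4 * suc E * wᵗ ghost K)         ≡⟨ trans (sym (*-assoc (suc U) (4 * suc E) (wᵗ ghost K)))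
            (cong (_* wᵗ ghost K) (sym α-def)) ⟩
        α * wᵗ ghost K                           ∎
        where
        open ≤-Reasoning
        l₁ : ∀ b u → b * u + b ≡ suc u * b
        l₁ = solve-∀
      dec : cost F′ D (R ++ W) + m′ ≤ cost F D W
      dec = begin
        α * (ws ghost F′ + ws ghost D) + wt u (R ++ W) + m′                ≡⟨ cong
            (λ t → α * (ws ghost F′ + ws ghost D) + t + m′) (wt-++ u R W) ⟩
        α * (ws ghost F′ + ws ghost D) + (wt u R + wt u W) + m′            ≡⟨ l₂ (α * (ws ghost F′ + ws ghost D))
            (wt u R) (wt u W) m′ ⟩
        α * (ws ghost F′ + ws ghost D) + wt u W + (wt u R + m′)            ≤⟨ +-monoʳ-≤
            (α * (ws ghost F′ + ws ghost D) + wt u W) gain-ghost ⟩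
        α * (ws ghost F′ + ws ghost D) + wt u W + α * wᵗ ghost K           ≡⟨ l₃ α (ws ghost F′) (ws ghost D) (wt u W)
            (wᵗ ghost K) ⟩
        α * (wᵗ ghost K + 0 + ws ghost F′ + ws ghost D) + wt u W           ≡⟨ cong
            (λ t → α * (t + ws ghost D) + wt u W) (sym (weight s (wᵗ ghost))) ⟩
        cost F D W                                                         ∎
        where
        open ≤-Reasoning
        l₂ : ∀ a b c d → a + (b + c) + d ≡ a + c + (b + d)
        l₂ = solve-∀
        l₃ : ∀ a f d w k → a * (f + d) + w + a * k ≡ a * (k + 0 + f + d) + w
        l₃ = solve-∀

    exchange : ∀ F D W → Conserved F D W → ∀ K F′ → Split F (K ∷ []) F′ → ∀ Ys R′ → Split W Ys R′ → Move K Ys →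
      Progress F D W
    exchange F D W cons K F′ s Ys R′ sW mv = record
      { F′ = F′ ; D′ = tiles ++ D ; W′ = back ++ R
      ; conserved = λ φ → trans (cong₂ (λ a b → a + (ws (onReal φ) F′ + b)) (wt-++ φ back R)
          (wt-++ (wᵗ (onReal φ)) tiles D))
          (trans (l₁ (wt φ back) (wt φ R) (ws (onReal φ) F′) (ws (onReal φ) tiles) (ws (onReal φ) D))
            (trans (cong (_+ (wt φ R + ws (onReal φ) F′ + ws (onReal φ) D)) (Move.conserved mv φ))
              (trans (l₂ (wᵗ (onReal φ) K) (wt φ used) (wt φ R) (ws (onReal φ) F′) (ws (onReal φ) D))
                (trans (cong₂ (λ a b → a + (b + ws (onReal φ) D)) (sym (weight sU φ))
                    (sym (weight s (wᵗ (onReal φ))))) (cons φ)))))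
      ; cheaper′ = dec
      ; done≤ = ≤-trans (≤-reflexive (trans (wt-++ (wᵗ one) tiles D) (+-comm (ws one tiles) _)))
          (+-monoʳ-≤ (ws one D) tiles≤)
      ; W≤ = ≤-trans (≤-trans (≤-reflexive (length-++ back))
          (≤-trans (+-monoˡ-≤ (length R) back≤used) (≤-reflexive (sym (Split-length sU))))) (m≤m⊔n _ _) }
      where
      open Move mv hiding (conserved; ghosts)
      R = rest ++ R′
      sU : Split W used R
      sU = Split-trans sW splits
      l₁ : ∀ b r f t d → b + r + (f + (t + d)) ≡ t + b + (r + f + d)
      l₁ = solve-∀
      l₂ : ∀ k u r f d → k + u + (r + f + d) ≡ u + r + (k + 0 + f + d)
      l₂ = solve-∀
      tiles≤ : ws one tiles ≤ B * m + supply
      tiles≤ = begin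
        ws one tiles                                 ≡⟨ real+ghost≡one tiles ⟨
        ws real tiles + ws ghost tiles               ≤⟨ +-mono-≤
            (≤-trans (m≤m+n _ _) (≤-reflexive (Move.conserved mv (λ _ → 1)))) (Move.ghosts mv) ⟩
        wᵗ real K + wt (λ _ → 1) used + wᵗ ghost K   ≡⟨ l₃ (wᵗ real K) (wt (λ _ → 1) used) (wᵗ ghost K) ⟩
        (wᵗ real K + wᵗ ghost K) + wt (λ _ → 1) used ≡⟨ cong₂ _+_
            (trans (sym (w-+ real ghost (cls K))) (trans (wt-cong (allFin r)
            (λ c → wt-cong (cls K c) λ { (just _) → refl ; nothing → refl })) (tile-size K))) (wt-1 used) ⟩
        B * m + length used                          ≤⟨ +-monoʳ-≤ (B * m) used≤ ⟩
        B * m + supply                               ∎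
        where
        open ≤-Reasoning
        l₃ : ∀ a b c → a + b + c ≡ a + c + b
        l₃ = solve-∀
      dec : cost F′ (tiles ++ D) (back ++ R) + m′ ≤ cost F D W
      dec = begin
        α * (ws ghost F′ + ws ghost (tiles ++ D)) + wt u (back ++ R) + m′               ≡⟨ cong₂
            (λ a b → α * (ws ghost F′ + a) + b + m′) (wt-++ (wᵗ ghost) tiles D) (wt-++ u back R) ⟩
        α * (ws ghost F′ + (ws ghost tiles + ws ghost D)) + (wt u back + wt u R) + m′   ≡⟨ l₄
            (α * (ws ghost F′ + (ws ghost tiles + ws ghost D))) (wt u back) (wt u R) m′ ⟩
        α * (ws ghost F′ + (ws ghost tiles + ws ghost D)) + (wt u back + m′ + wt u R)   ≤⟨ +-mono-≤
            (*-monoʳ-≤ α (+-monoʳ-≤ (ws ghost F′) (+-monoˡ-≤ (ws ghost D) (Move.ghosts mv))))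
            (+-monoˡ-≤ (wt u R) decrease) ⟩
        α * (ws ghost F′ + (wᵗ ghost K + ws ghost D)) + (wt u used + wt u R)            ≡⟨ cong₂ _+_
            (cong (α *_) (l₅ (ws ghost F′) (wᵗ ghost K) (ws ghost D))) (sym (weight sU u)) ⟩
        α * (wᵗ ghost K + 0 + ws ghost F′ + ws ghost D) + wt u W                        ≡⟨ cong
            (λ t → α * (t + ws ghost D) + wt u W) (sym (weight s (wᵗ ghost))) ⟩
        cost F D W                                                                      ∎
        where
        open ≤-Reasoning
        l₄ : ∀ a b c d → a + (b + c) + d ≡ a + (b + d + c)
        l₄ = solve-∀
        l₅ : ∀ f k d → f + (k + d) ≡ k + 0 + f + d
        l₅ = solve-∀

    module _
      (low : ∀ y → B0 * Σᶠ (dear y) ≤ P0 * n →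
        q * (ρ * P0 * P0 * n + B0 * (Q0 * Σᶠ (dear y))) ≤ B0 * P0 * (q * degree G y + n) + q * (B0 * Q0))
      (high : ∀ y → P0 * n ≤ B0 * Σᶠ (dear y) →
        q * ((ρ * P0 + Q0) * P0 * n) ≤ B0 * P0 * (q * degree G y + n) + q * (B0 * Q0))
      (q-big : Z ≤ q)
      (B-big : 8 * ((ρ * P0 + Q0) * Q0) * suc E ≤ B)
      (C-big : 8 * (B0 * ε) * suc E ≤ C * B)
      (n-big : 8 * (B0 * Q0) * E ≤ n) where

      step : ∀ F D W → Conserved F D W → n ≤ E * ghosts F D → 4 * (Z * ws one D) ≤ n → 4 * (Z * length W) ≤ n →
        Progress F D W
      step F D W cons n≤ hD hW = go (length W ≤? wmin)
        where
        Gh = ghosts F D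
        f = length F
        sD = ws one D
        gF = ws ghost F
        1≤Gh : 1 ≤ Gh
        1≤Gh = n≢0⇒n>0 (λ e → <⇒≱ 1≤n (≤-trans n≤ (≤-reflexive (trans (cong (E *_) e) (*-zeroʳ E)))))
        size≤ : f * (B * m) ≤ suc E * Gh
        size≤ = ≤-trans (fresh-size F D W cons) (≤-trans (+-monoˡ-≤ Gh n≤) (≤-reflexive (+-comm (E * Gh) Gh)))
        e₁ : 8 * (B0 * P0 * n) ≤ q * Gh
        e₁ = ≤-trans (*-monoʳ-≤ 8 (*-monoʳ-≤ (B0 * P0) n≤)) (≤-trans
            (≤-reflexive (trans (l (B0 * P0) E Gh) (cong (_* Gh) (sym Z-def)))) (*-monoˡ-≤ Gh q-big))
          where
          l : ∀ b E g → 8 * (b * (E * g)) ≡ 8 * b * E * g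
          l = solve-∀
        e₂ : 8 * ((ρ * P0 + Q0) * Q0 * (m * f)) ≤ Gh
        e₂ = *-cancelˡ-≤ (suc E) (≤-trans (≤-reflexive (l₁ (suc E) ((ρ * P0 + Q0) * Q0) (m * f)))
            (≤-trans (*-monoˡ-≤ (m * f) B-big)
          (≤-trans (≤-reflexive (l₂ B m f)) size≤)))
          where
          l₁ : ∀ e c x → e * (8 * (c * x)) ≡ 8 * c * e * x
          l₁ = solve-∀
          l₂ : ∀ b m f → b * (m * f) ≡ f * (b * m)
          l₂ = solve-∀
        e₃ : 8 * (B0 * (f * (ε * m′))) ≤ Gh
        e₃ = *-cancelˡ-≤ (suc E) (≤-trans (≤-reflexive (l₁ (suc E) B0 f ε m′)) (≤-trans (*-monoˡ-≤ (f * m′) C-big)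
          (≤-trans (≤-reflexive (l₂ C B f m′)) size≤)))
          where
          l₁ : ∀ e b f ε m → e * (8 * (b * (f * (ε * m)))) ≡ 8 * (b * ε) * e * (f * m)
          l₁ = solve-∀
          l₂ : ∀ c b f m → c * b * (f * m) ≡ f * (b * (c * m))
          l₂ = solve-∀
        e₄ : 8 * (B0 * (P0 * (sD + sD + length W))) ≤ Gh
        e₄ = *-cancelˡ-≤ E ⦃ >-nonZero 1≤E ⦄ (≤-trans (*-cancelˡ-≤ 4 (begin
          4 * (E * (8 * (B0 * (P0 * (sD + sD + length W)))))         ≡⟨ trans (l₁ E B0 P0 sD (length W))
              (cong (λ z → 4 * (z * sD) + 4 * (z * sD) + 4 * (z * length W)) (sym Z-def)) ⟩
          4 * (Z * sD) + 4 * (Z * sD) + 4 * (Z * length W)           ≤⟨ +-mono-≤ (+-mono-≤ hD hD) hW ⟩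
          n + n + n                                                  ≤⟨ m≤m+n (n + n + n) n ⟩
          n + n + n + n                                              ≡⟨ l₂ n ⟩
          4 * n                                                      ∎)) n≤)
          where
          open ≤-Reasoning
          l₁ : ∀ E b p s w → 4 * (E * (8 * (b * (p * (s + s + w))))) ≡ 4 * (8 * (b * p) * E * s) + 4 *
              (8 * (b * p) * E * s) + 4 * (8 * (b * p) * E * w)
          l₁ = solve-∀
          l₂ : ∀ n → n + n + n + n ≡ 4 * n
          l₂ = solve-∀
        e₅ : 8 * (B0 * Q0) ≤ Gh
        e₅ = *-cancelˡ-≤ E ⦃ >-nonZero 1≤E ⦄ (≤-trans (≤-reflexive (*-comm E (8 * (B0 * Q0)))) (≤-trans n-big n≤))
        D≤ : 2 * sD ≤ Gh
        D≤ = *-cancelˡ-≤ E ⦃ >-nonZero 1≤E ⦄ (≤-trans (≤-trans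
            (≤-trans (≤-reflexive (l₁ E sD)) (*-monoʳ-≤ (2 * (E * sD))
            (*-mono-≤ {1} {16} (s≤s z≤n) (*-mono-≤ 1≤B0 1≤P0))))
          (≤-reflexive (trans (l₂ E sD (B0 * P0)) (cong (λ z → 4 * (z * sD)) (sym Z-def))))) (≤-trans hD n≤))
          where
          l₁ : ∀ E s → E * (2 * s) ≡ 2 * (E * s) * (1 * 1)
          l₁ = solve-∀
          l₂ : ∀ E s b → 2 * (E * s) * (16 * b) ≡ 4 * (8 * b * E * s)
          l₂ = solve-∀
        ghost≤one : ∀ x → ghost x ≤ 1
        ghost≤one (just _) = z≤n
        ghost≤one nothing  = ≤-refl
        Gh≤ : Gh ≤ 2 * gF
        Gh≤ = cert _ _ 0 (+-mono-≤ (*-monoʳ-≤ 2 (ws-≤ D ghost≤one)) D≤) (l₃ gF (ws ghost D) sD)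
          where
          l₃ : ∀ f d s → f + d + (2 * s + (f + d)) + 0 ≡ 2 * f + (2 * d + 2 * s)
          l₃ = solve-∀
        ghostly : length F * (B * m) < wt (λ K → 4 * suc E * wᵗ ghost K) F
        ghostly = begin-strict
          length F * (B * m)                     ≤⟨ ≤-trans (fresh-size F D W cons)
              (≤-trans (+-monoˡ-≤ Gh n≤) (≤-reflexive (+-comm (E * Gh) Gh))) ⟩
          suc E * Gh                             <⟨ m<m+n (suc E * Gh) (*-mono-≤ {1} {suc E} (s≤s z≤n) 1≤Gh) ⟩
          suc E * Gh + suc E * Gh                ≤⟨ +-mono-≤ (*-monoʳ-≤ (suc E) Gh≤) (*-monoʳ-≤ (suc E) Gh≤) ⟩
          suc E * (2 * gF) + suc E * (2 * gF)    ≡⟨ l₄ (suc E) gF ⟩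
          4 * suc E * gF                         ≡⟨ wt-* (4 * suc E) (wᵗ ghost) F ⟨
          wt (λ K → 4 * suc E * wᵗ ghost K) F    ∎
          where
          open ≤-Reasoning
          l₄ : ∀ e g → e * (2 * g) + e * (2 * g) ≡ 4 * e * g
          l₄ = solve-∀
        witness : ∀ K y → ⌊ improvable? K y ⌋ ≡ true → Improvable K y
        witness K y e with improvable? K y
        ... | yes i = i
        improve-tile : (∃₂ λ K F′ → Split F (K ∷ []) F′ × L < wt (λ y → imp y K) W) → Progress F D W
        improve-tile (K , F′ , s , L<) = restrict (choose (λ y → ⌊ improvable? K y ⌋) L W (<⇒≤ L<))
          where
          apply : ∀ {Ys R₀} → Split W Ys R₀ → (∃₂ λ Ys′ R₁ → Split Ys Ys′ R₁ × Move K Ys′) → Progress F D W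
          apply {R₀ = R₀} sY (Ys′ , R₁ , sY′ , mv) = exchange F D W cons K F′ s Ys′ (R₁ ++ R₀) (Split-trans sY sY′) mv
          restrict : (∃₂ λ Ys R₀ → Split W Ys R₀ × length Ys ≡ L × (∀ {y} → y ∈ Ys → ⌊ improvable? K y ⌋ ≡ true)) →
              Progress F D W
          restrict (Ys , R₀ , sY , len , imps) = apply sY (improve-many K Ys (≤-reflexive (sym len))
              (λ {y} y∈ → witness K y (imps y∈)))
        dissolve-tile : length W ≤ wmin → (∃₂ λ K F′ → Split F (K ∷ []) F′ × B * m < 4 * suc E * wᵗ ghost K) →
            Progress F D W
        dissolve-tile W≤ (K , F′ , s , big) = dissolve F D W cons W≤ K F′ s big
        go : Dec (length W ≤ wmin) → Progress F D W
        go (yes W≤) = dissolve-tile W≤ (above-average (λ K → 4 * suc E * wᵗ ghost K) (B * m) F ghostly)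
        go (no W≰)  = improve-tile (target-tile F D W cons low high e₁ e₂ e₃ e₄ e₅ E L n≤ 1≤Gh
            (≤-<-trans (≤-reflexive (sym wmin-def)) (≰⇒> W≰)))

  -- Rounds of the local search

  notCheaper : ∀ {n} → (Fin n → ℕ) → Fin n → Fin n → ℕ
  notCheaper u y v = 𝟙 (not (u v <ᵇ u y))

  -- reserve m is the size up to which the list of uncovered vertices is refilled by dissolving a tile.
  roundsNeed : (Z Y P B C : ℕ) (reserve : ℕ → ℕ) → ℕ → ℕ → ℕ
  roundsNeed Z Y P B C reserve zero    m = 4 * (Z * (P * m))
  roundsNeed Z Y P B C reserve (suc T) m =
    m * Y + 4 * (Z * (reserve m + B * (C * m))) + roundsNeed Z Y P B C reserve T (C * m)

  module Rounds {n : ℕ} (G : Graph n) (ρ Q Δ : ℕ) (1≤Δ : 1 ≤ Δ) (C : ℕ)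
    (B≤C : Blocks.B G ρ Q Δ ≤ C) (u : Fin n → ℕ) (1≤u : ∀ v → 1 ≤ u v)
    (P0 Q0 q : ℕ) (1≤P0 : 1 ≤ P0) (1≤q : 1 ≤ q)
    (PQ : P0 * Q ≤ Q0 * Blocks.P G ρ Q Δ)
    (BP : (suc ρ * P0 + Q0) * Blocks.P G ρ Q Δ ≡ P0 * Blocks.B G ρ Q Δ + Q0)
    (U E : ℕ) (u≤U : ∀ v → u v ≤ U) (1≤E : 1 ≤ E) (1≤n : 1 ≤ n)
    (low : ∀ y → (suc ρ * P0 + Q0) * Σᶠ (notCheaper u y) ≤ P0 * n →
      q * (ρ * P0 * P0 * n + (suc ρ * P0 + Q0) * (Q0 * Σᶠ (notCheaper u y)))
        ≤ (suc ρ * P0 + Q0) * P0 * (q * degree G y + n) + q * ((suc ρ * P0 + Q0) * Q0))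
    (high : ∀ y → P0 * n ≤ (suc ρ * P0 + Q0) * Σᶠ (notCheaper u y) →
      q * ((ρ * P0 + Q0) * P0 * n) ≤ (suc ρ * P0 + Q0) * P0 * (q * degree G y + n) + q * ((suc ρ * P0 + Q0) * Q0))
    (q-big : 8 * ((suc ρ * P0 + Q0) * P0) * E ≤ q)
    (B-big : 8 * ((ρ * P0 + Q0) * Q0) * suc E ≤ Blocks.B G ρ Q Δ)
    (C-big : 8 * ((suc ρ * P0 + Q0) * (P0 * (suc (suc ρ) * (Blocks.P G ρ Q Δ * Blocks.B G ρ Q Δ)) + Q0 * Blocks.P G ρ
        Q Δ)) * suc E
       ≤ C * Blocks.B G ρ Q Δ)
    (n-big : 8 * ((suc ρ * P0 + Q0) * Q0) * E ≤ n)
    (Z α Y : ℕ) (patterns reserve : ℕ → ℕ) (Z-def : Z ≡ 8 * ((suc ρ * P0 + Q0) * P0) * E)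
    (α-def : α ≡ suc U * (4 * suc E))
    (Y-def : Y ≡ 4 * (Z * (Blocks.B G ρ Q Δ * C + (Blocks.P G ρ Q Δ + Δ * Blocks.B G ρ Q Δ))))
    (patterns-def : ∀ m → patterns m ≡ (Blocks.P G ρ Q Δ * m + Δ * Blocks.B G ρ Q Δ * m) * 2 ^
        (Blocks.B G ρ Q Δ * (C * m) + suc U))
    (reserve-def : ∀ m → reserve m ≡ 3 * ((suc ρ * P0 + Q0) * P0) * (suc E * patterns m)) where

    open Blocks G ρ Q Δ

    need : ℕ → ℕ → ℕ
    need = roundsNeed Z Y P B C reserve

    B0 : ℕ
    B0 = suc ρ * P0 + Q0

    record State (m : ℕ) : Set where
      field
        tiles     : List (Tile m)
        left-over : List V
        conserved : ∀ φ → wt φ left-over + ws (onReal φ) tiles ≡ Σᶠ φ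
        few-left  : 4 * (Z * length left-over) ≤ n
    open State public

    price : ∀ {m} → State m → ℕ
    price s = α * ws ghost (tiles s) + wt u (left-over s)

    Finished : ∀ {m} → State m → Set
    Finished s = E * ws ghost (tiles s) < n

    1≤P : 1 ≤ P
    1≤P = ≤-trans 1≤Δ (m≤n+m Δ Q)

    1≤B0P0 : 1 ≤ B0 * P0
    1≤B0P0 = *-mono-≤ {1} {B0} (≤-trans 1≤P0 (≤-trans (m≤m+n P0 (ρ * P0)) (m≤m+n _ Q0))) 1≤P0

    1≤Z : 1 ≤ Z
    1≤Z = ≤-trans (*-mono-≤ {1} {8 * (B0 * P0)} (*-mono-≤ {1} {8} (s≤s z≤n) 1≤B0P0) 1≤E) (≤-reflexive (sym Z-def))

    1≤Y : 1 ≤ Y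
    1≤Y = ≤-trans (*-mono-≤ {1} {4} (s≤s z≤n) (*-mono-≤ 1≤Z (≤-trans 1≤P (≤-trans (m≤m+n P _) (m≤n+m _ (B * C))))))
      (≤-reflexive (sym Y-def))

    ghost-only : ∀ k {x} → x ∈ replicate k (nothing {A = V}) → x ≡ nothing
    ghost-only (suc k) (here e)  = e
    ghost-only (suc k) (there p) = ghost-only k p

    adj-ghostʳ : ∀ x → adjᵍ x nothing ≡ true
    adj-ghostʳ (just _) = refl
    adj-ghostʳ nothing  = refl

    padded-tile : ∀ m ys → length ys ≡ P * m → Σ (Tile m) λ K → ∀ φ → wᵗ (onReal φ) K ≡ wt φ ys
    padded-tile m ys len = record { small = zero ; cls = put one′ N S ; size = sizes ; complete = comp } , weights
      where
      one′ : Fin r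
      one′ = suc zero
      N : List A
      N = map just ys
      S : Block
      S c = replicate (sz zero c * m) nothing
      sizes : ∀ c → length (put one′ N S c) ≡ sz zero c * m
      sizes c with c ≟ᶠ one′
      ... | yes refl = trans (length-map just ys) (trans len (cong (_* m) (sym (sz-diff {zero} {one′} λ ()))))
      ... | no _     = length-replicate (sz zero c * m)
      comp : Complete (put one′ N S)
      comp = put-complete
        (λ {c} {d} _ _ _ {x} {y} x∈ y∈ → trans (cong (adjᵍ x) (ghost-only _ y∈)) (adj-ghostʳ x))
        (λ {d} _ {x} {y} x∈ y∈ → trans (cong (adjᵍ x) (ghost-only _ y∈)) (adj-ghostʳ x))
      weights : ∀ φ → w (onReal φ) (put one′ N S) ≡ wt φ ys
      weights φ = +-cancelʳ-≡ (wt (onReal φ) (S one′)) _ _ (trans (w-put (onReal φ) one′ N S)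
        (trans (+-comm (w (onReal φ) S) _) (cong₂ _+_ (wt-map (onReal φ) just ys)
          (trans (trans (wt-cong (allFin r) zeroS) (trans (Σᶠ-const {r} 0) (*-zeroʳ r))) (sym (zeroS one′))))))
        where
        zeroS : ∀ c → wt (onReal φ) (S c) ≡ 0
        zeroS c = trans (wt-replicate (onReal φ) (sz zero c * m) nothing) (*-zeroʳ (sz zero c * m))

    pad : ∀ m a b xs → length xs ≡ a * (P * m) + b → ∃₂ λ (Ts : List (Tile m)) W →
      (∀ φ → wt φ W + ws (onReal φ) Ts ≡ wt φ xs) × length W ≡ b × length Ts ≡ a
    pad m zero    b xs e = [] , xs , (λ φ → +-identityʳ _) , e , refl
    pad m (suc a) b xs e with chooseAny (P * m) xs (≤-trans (≤-trans (m≤m+n (P * m) (a * (P * m) + b))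
        (≤-reflexive (sym (+-assoc (P * m) _ b)))) (≤-reflexive (sym e)))
    ... | ys , zs , s , len with padded-tile m ys len | pad m a b zs
        (+-cancelˡ-≡ (P * m) _ _ (trans (cong (_+ length zs) (sym len))
        (trans (sym (Split-length s)) (trans e (+-assoc (P * m) _ b)))))
    ...   | K , k | Ts , W , c , lW , lT = K ∷ Ts , W ,
            (λ φ → trans (lem (wt φ W) (wᵗ (onReal φ) K) (ws (onReal φ) Ts))
                (trans (cong₂ _+_ (k φ) (c φ)) (sym (weight s φ)))) , lW , cong suc lT
      where
      lem : ∀ a b c → a + (b + c) ≡ b + (a + c)
      lem = solve-∀

    ws≤size : ∀ {m} φ (Ts : List (Tile m)) → (∀ x → φ x ≤ 1) → ws φ Ts ≤ length Ts * (B * m)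
    ws≤size φ Ts h = ≤-trans (wt-≤ Ts (λ {K} _ → w-≤ (cls K) h)) (≤-reflexive (tiles-size Ts))

    ghost≤1 : ∀ x → ghost x ≤ 1
    ghost≤1 (just _) = z≤n
    ghost≤1 nothing  = ≤-refl

    initial : ∀ m → 1 ≤ m → need 0 m ≤ n → Σ (State m) λ s → price s ≤ (α * r + U) * n
    initial m 1≤m enough = fromPad (pad m a (n % (P * m)) (allFin n)
        (trans (length-tabulate {n = n} (λ i → i)) (trans (m≡m%n+[m/n]*n n (P * m)) (+-comm (n % (P * m)) _))))
      where
      instance
        nzP : NonZero (P * m)
        nzP = >-nonZero (*-mono-≤ 1≤P 1≤m)
      a : ℕ
      a = n / (P * m)
      open ≤-Reasoning
      lem : ∀ α r n U → α * (r * n) + n * U ≡ (α * r + U) * n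
      lem = solve-∀
      lem₂ : ∀ a r P m → a * (r * P * m) ≡ r * (a * (P * m))
      lem₂ = solve-∀
      B≤rP : B ≤ r * P
      B≤rP = ≤-trans (+-monoʳ-≤ (suc ρ * P) (m≤m+n Q Δ)) (≤-reflexive (+-comm (suc ρ * P) P))
      fromPad : (∃₂ λ (Ts : List (Tile m)) W → (∀ φ → wt φ W + ws (onReal φ) Ts ≡ Σᶠ φ) × length W ≡ n % (P * m) ×
          length Ts ≡ a) →
        Σ (State m) λ s → price s ≤ (α * r + U) * n
      fromPad (Ts , W , c , lW , lT) = record { tiles = Ts ; left-over = W ; conserved = c
            ; few-left = ≤-trans (*-monoʳ-≤ 4 (*-monoʳ-≤ Z (≤-trans (≤-reflexive lW) (<⇒≤ (m%n<n n (P * m)))))) enough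
                } , (begin
          α * ws ghost Ts + wt u W     ≤⟨ +-mono-≤ (*-monoʳ-≤ α ghosts≤)
              (≤-trans (wt-ub u U W (λ {v} _ → u≤U v)) (*-monoˡ-≤ U W≤n)) ⟩
          α * (r * n) + n * U          ≡⟨ lem α r n U ⟩
          (α * r + U) * n              ∎)
        where
        W≤n : length W ≤ n
        W≤n = ≤-trans (≤-reflexive lW) (≤-trans (m≤m+n _ (a * (P * m))) (≤-reflexive (sym (m≡m%n+[m/n]*n n (P * m)))))
        ghosts≤ : ws ghost Ts ≤ r * n
        ghosts≤ = begin
          ws ghost Ts                       ≤⟨ ws≤size ghost Ts ghost≤1 ⟩
          length Ts * (B * m)               ≡⟨ cong (_* (B * m)) lT ⟩
          a * (B * m)                       ≤⟨ *-monoʳ-≤ a (*-monoˡ-≤ m B≤rP) ⟩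
          a * (r * P * m)                   ≡⟨ lem₂ a r P m ⟩
          r * (a * (P * m))                 ≤⟨ *-monoʳ-≤ r (m/n*n≤m n (P * m)) ⟩
          r * n                             ∎

    module _ (m′ : ℕ) (1≤m′ : 1 ≤ m′) (enough : m′ * Y + 4 * (Z * (reserve m′ + B * (C * m′))) ≤ n)
        (s₀ : State (C * m′)) where

      private
        module S = Stepping G ρ Q Δ 1≤Δ C m′ B≤C u 1≤u P0 Q0 q 1≤P0 1≤q PQ BP 1≤m′ U E u≤U 1≤E 1≤n
          Z (patterns m′) (reserve m′) α Z-def (patterns-def m′) (reserve-def m′) α-def

      Running : ℕ → Set
      Running t = ∃₂ λ F D → ∃ λ W → S.Conserved F D W × 4 * (Z * length W) ≤ n × ws S.one D ≤ t *
          (B * S.m + S.supply) ×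
        (E * S.ghosts F D < n ⊎ S.cost F D W + t * m′ ≤ price s₀)

      run : ∀ t → t * (m′ * Y) ≤ n → Running t
      run zero _ = tiles s₀ , [] , left-over s₀ , (λ φ → trans (cong (wt φ (left-over s₀) +_) (+-identityʳ _))
          (conserved s₀ φ)) , few-left s₀ , z≤n ,
        inj₂ (≤-reflexive (trans (+-identityʳ _) (cong (λ t → α * t + wt u (left-over s₀)) (+-identityʳ _))))
      run (suc t) t≤ = continue (run t (≤-trans (m≤n+m _ (m′ * Y)) t≤))
        where
        grow = *-monoˡ-≤ (B * S.m + S.supply) (n≤1+n t)
        rate : 4 * (Z * (t * (B * S.m + S.supply))) ≡ t * (m′ * Y)
        rate = trans (lem B C m′ P Δ Z t) (cong (λ y → t * (m′ * y)) (sym Y-def))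
          where
          lem : ∀ B C m′ P Δ Z t → 4 * (Z * (t * (B * (C * m′) + (P * m′ + Δ * B * m′)))) ≡ t *
              (m′ * (4 * (Z * (B * C + (P + Δ * B)))))
          lem = solve-∀
        continue : Running t → Running (suc t)
        continue (F , D , W , cons , W≤ , D≤ , inj₁ fin) = F , D , W , cons , W≤ , ≤-trans D≤ grow , inj₁ fin
        continue (F , D , W , cons , W≤ , D≤ , inj₂ c) = decide (n ≤? E * S.ghosts F D)
          where
          advance : S.Progress F D W → Running (suc t)
          advance pr = F′ , D′ , W′ , S.Progress.conserved pr , few′ ,
              ≤-trans done≤ (≤-trans (+-monoˡ-≤ (B * S.m + S.supply) D≤)
                  (≤-reflexive (+-comm (t * (B * S.m + S.supply)) (B * S.m + S.supply)))) ,
              inj₂ (≤-trans (≤-reflexive (sym (+-assoc (S.cost F′ D′ W′) m′ (t * m′))))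
                  (≤-trans (+-monoˡ-≤ (t * m′) cheaper′) c))
            where
            open S.Progress pr hiding (W≤)
            few′ : 4 * (Z * length W′) ≤ n
            few′ with ≤-total (length W) (reserve m′ + B * S.m)
            ... | inj₁ W<  = ≤-trans (*-monoʳ-≤ 4 (*-monoʳ-≤ Z
                (≤-trans (S.Progress.W≤ pr) (≤-reflexive (m≤n⇒m⊔n≡n W<))))) (≤-trans (m≤n+m _ (m′ * Y)) enough)
            ... | inj₂ W> = ≤-trans (*-monoʳ-≤ 4 (*-monoʳ-≤ Z
                (≤-trans (S.Progress.W≤ pr) (≤-reflexive (m≥n⇒m⊔n≡m W>))))) W≤
          decide : Dec (n ≤ E * S.ghosts F D) → Running (suc t)
          decide (no n≰) = F , D , W , cons , W≤ , ≤-trans D≤ grow , inj₁ (≰⇒> n≰)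
          decide (yes n≤) = advance (S.step low high (≤-trans (≤-reflexive Z-def) q-big) B-big C-big n-big F D W cons
              n≤
            (≤-trans (*-monoʳ-≤ 4 (*-monoʳ-≤ Z D≤)) (≤-trans (≤-reflexive rate) (≤-trans (m≤n+m _ (m′ * Y)) t≤))) W≤)

      round : Σ (State m′) λ s → Finished s ⊎ 2 * Y * price s + n ≤ 2 * Y * price s₀
      round = result (run t (m/n*n≤m n (m′ * Y)))
        where
        instance
          nzY : NonZero (m′ * Y)
          nzY = >-nonZero (*-mono-≤ 1≤m′ 1≤Y)
        t : ℕ
        t = n / (m′ * Y)
        R : ℕ
        R = n % (m′ * Y)
        R< : R < m′ * Y
        R< = m%n<n n (m′ * Y)
        n≤′ : ∀ t → n ≡ R + t * (m′ * Y) → n ≤ 2 * Y * (t * m′)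
        n≤′ zero    e = ⊥-elim (<⇒≱ (≤-<-trans (≤-reflexive (trans e (+-identityʳ R))) R<)
            (≤-trans (m≤m+n (m′ * Y) _) enough))
        n≤′ (suc t) e = begin
          n                                    ≡⟨ e ⟩
          R + suc t * (m′ * Y)                 ≤⟨ +-monoˡ-≤ (suc t * (m′ * Y))
              (≤-trans (<⇒≤ R<) (m≤m+n (m′ * Y) (t * (m′ * Y)))) ⟩
          suc t * (m′ * Y) + suc t * (m′ * Y)  ≡⟨ lem (suc t) m′ Y ⟩
          2 * Y * (suc t * m′)                 ∎
          where
          open ≤-Reasoning
          lem : ∀ t m Y → t * (m * Y) + t * (m * Y) ≡ 2 * Y * (t * m)
          lem = solve-∀
        n≤ : n ≤ 2 * Y * (t * m′)
        n≤ = n≤′ t (m≡m%n+[m/n]*n n (m′ * Y))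
        result : Running t → _
        result (F , D , W , cons , W≤ , _ , c) with cut C m′ F
        ... | F′ , e = s , final c
          where
          wsE : ∀ φ → ws φ (F′ ++ D) ≡ ws φ F + ws φ D
          wsE φ = trans (wt-++ (wᵗ φ) F′ D) (cong (_+ ws φ D) (e φ))
          s : State m′
          s = record { tiles = F′ ++ D ; left-over = W ; few-left = W≤
            ; conserved = λ φ → trans (cong (wt φ W +_) (wsE (onReal φ))) (cons φ) }
          final : E * S.ghosts F D < n ⊎ S.cost F D W + t * m′ ≤ price s₀ → Finished s ⊎ 2 * Y * price s + n ≤ 2 * Y *
              price s₀
          final (inj₁ fin) = inj₁ (subst (λ g → E * g < n) (sym (wsE ghost)) fin)
          final (inj₂ c)   = inj₂ (≤-trans (+-monoʳ-≤ (2 * Y * price s) n≤)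
              (≤-trans (≤-reflexive (sym (*-distribˡ-+ (2 * Y) (price s) (t * m′))))
            (*-monoʳ-≤ (2 * Y) (subst (λ g → α * g + wt u W + t * m′ ≤ price s₀) (sym (wsE ghost)) c))))

    recut : ∀ m → (s : State (C * m)) → Σ (State m) λ s′ → ws ghost (tiles s′) ≡ ws ghost (tiles s)
    recut m s with cut C m (tiles s)
    ... | Ts , e = record { tiles = Ts ; left-over = left-over s ; few-left = few-left s
          ; conserved = λ φ → trans (cong (wt φ (left-over s) +_) (e (onReal φ))) (conserved s φ) } , e ghost

    rounds : ∀ T m → 1 ≤ m → need T m ≤ n →
      Σ (State m) λ s → Finished s ⊎ 2 * Y * price s + T * n ≤ 2 * Y * ((α * r + U) * n)
    rounds zero m 1≤m enough = start (initial m 1≤m enough)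
      where
      start : Σ (State m) (λ s → price s ≤ (α * r + U) * n) → _
      start (s , p) = s , inj₂ (≤-trans (≤-reflexive (+-identityʳ _)) (*-monoʳ-≤ (2 * Y) p))
    rounds (suc T) m 1≤m enough = continue (rounds T (C * m) (*-mono-≤ {1} {C} (≤-trans 1≤P (≤-trans P≤B B≤C)) 1≤m)
        (≤-trans (m≤n+m _ _) enough))
      where
      Goal = Σ (State m) λ s → Finished s ⊎ 2 * Y * price s + suc T * n ≤ 2 * Y * ((α * r + U) * n)
      continue : Σ (State (C * m)) (λ s → Finished s ⊎ 2 * Y * price s + T * n ≤ 2 * Y * ((α * r + U) * n)) → Goal
      continue (s , inj₁ fin) = proj₁ (recut m s) , inj₁ (subst (λ g → E * g < n) (sym (proj₂ (recut m s))) fin)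
      continue (s , inj₂ p) = next (round m 1≤m (≤-trans (m≤m+n _ (need T (C * m))) enough) s)
        where
        next : Σ (State m) (λ s′ → Finished s′ ⊎ 2 * Y * price s′ + n ≤ 2 * Y * price s) → Goal
        next (s′ , inj₁ fin) = s′ , inj₁ fin
        next (s′ , inj₂ p′)  = s′ , inj₂ (≤-trans (≤-reflexive (sym (+-assoc (2 * Y * price s′) n (T * n))))
            (≤-trans (+-monoˡ-≤ (T * n) p′) p))

    finished : ∀ m → 1 ≤ m → need (suc (2 * Y * (α * r + U))) m ≤ n → Σ (State m) Finished
    finished m 1≤m enough = conclude (rounds (suc (2 * Y * (α * r + U))) m 1≤m enough)
      where
      conclude : Σ (State m) (λ s → Finished s ⊎ 2 * Y * price s + suc (2 * Y * (α * r + U)) * n ≤ 2 * Y *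
          ((α * r + U) * n)) → Σ (State m) Finished
      conclude (s , inj₁ fin) = s , fin
      conclude (s , inj₂ p) = ⊥-elim (<⇒≱ (m<n+m (2 * Y * (α * r + U) * n) 1≤n)
        (≤-trans (m≤n+m _ (2 * Y * price s)) (≤-trans p (≤-reflexive (sym (*-assoc (2 * Y) (α * r + U) n))))))

  -- Extracting copies of H

  δ-cong : ∀ {r r′} {c d : Fin r} {c′ d′ : Fin r′} → (d ≡ c → d′ ≡ c′) → (d′ ≡ c′ → d ≡ c) → δ c d ≡ δ c′ d′
  δ-cong {c = c} {d} {c′} {d′} to from with d ≟ᶠ c | d′ ≟ᶠ c′
  ... | yes _ | yes _ = refl
  ... | no _  | no _  = refl
  ... | yes p | no ¬q = ⊥-elim (¬q (to p))
  ... | no ¬p | yes q = ⊥-elim (¬p (from q))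

  Σᶠ-δ : ∀ {r} (c : Fin r) → Σᶠ (δ c) ≡ 1
  Σᶠ-δ {r} c = trans (wt-cong (allFin r) (λ d → sym (*-identityʳ (δ c d)))) (Σᶠ-δ* c 1)

  module _ {k : ℕ} where

    private
      N : ℕ
      N = suc k

    rot : Fin N → Fin N → Fin N
    rot a x = fromℕ< (m%n<n (toℕ a + toℕ x) N)

    unrot : Fin N → Fin N → Fin N
    unrot p x = fromℕ< (m%n<n (toℕ p + (N ∸ toℕ x)) N)

    toℕ-rot : ∀ a x → toℕ (rot a x) ≡ (toℕ a + toℕ x) % N
    toℕ-rot a x = toℕ-fromℕ< (m%n<n (toℕ a + toℕ x) N)

    toℕ-unrot : ∀ p x → toℕ (unrot p x) ≡ (toℕ p + (N ∸ toℕ x)) % N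
    toℕ-unrot p x = toℕ-fromℕ< (m%n<n (toℕ p + (N ∸ toℕ x)) N)

    shift-back : ∀ u t v → v < N → u + t ≡ v + N → (u % N + t) % N ≡ v
    shift-back u t v v< e = begin
      (u % N + t) % N           ≡⟨ %-distribˡ-+ (u % N) t N ⟩
      (u % N % N + t % N) % N   ≡⟨ cong (λ z → (z + t % N) % N) (m%n%n≡m%n u N) ⟩
      (u % N + t % N) % N       ≡⟨ %-distribˡ-+ u t N ⟨
      (u + t) % N               ≡⟨ cong (_% N) e ⟩
      (v + N) % N               ≡⟨ [m+n]%n≡m%n v N ⟩
      v % N                     ≡⟨ m<n⇒m%n≡m v< ⟩
      v                         ∎
      where open ≡-Reasoning

    rot-unrot : ∀ p x → rot (unrot p x) x ≡ p
    rot-unrot p x = toℕ-injective (trans (toℕ-rot (unrot p x) x) (trans (cong (λ z → (z + toℕ x) % N) (toℕ-unrot p x))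
      (shift-back (toℕ p + (N ∸ toℕ x)) (toℕ x) (toℕ p) (toℕ<n p)
          (trans (+-assoc (toℕ p) _ _) (cong (toℕ p +_) (m∸n+n≡m (<⇒≤ (toℕ<n x))))))))

    unrot-rot : ∀ a x → unrot (rot a x) x ≡ a
    unrot-rot a x = toℕ-injective (trans (toℕ-unrot (rot a x) x)
        (trans (cong (λ z → (z + (N ∸ toℕ x)) % N) (toℕ-rot a x))
      (shift-back (toℕ a + toℕ x) (N ∸ toℕ x) (toℕ a) (toℕ<n a)
          (trans (+-assoc (toℕ a) _ _) (cong (toℕ a +_) (m+[n∸m]≡n (<⇒≤ (toℕ<n x))))))))

    rot-comm : ∀ a x → rot a x ≡ rot x a
    rot-comm a x = toℕ-injective (trans (toℕ-rot a x) (trans (cong (_% N) (+-comm (toℕ a) (toℕ x)))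
        (sym (toℕ-rot x a))))

    rot-injective : ∀ a {x y} → rot a x ≡ rot a y → x ≡ y
    rot-injective a {x} {y} e = trans (sym (unrot-rot x a)) (trans
        (cong (λ z → unrot z a) (trans (rot-comm x a) (trans e (rot-comm a y)))) (unrot-rot y a))

    rot-uniform : ∀ p x → Σᶠ (λ a → δ p (rot a x)) ≡ 1
    rot-uniform p x = trans (wt-cong (allFin N) (λ a → δ-cong {c = p} {rot a x} {unrot p x} {a}
      (λ e → trans (sym (unrot-rot a x)) (cong (λ z → unrot z x) e))
          (λ e → trans (cong (λ z → rot z x) e) (rot-unrot p x)))) (Σᶠ-δ (unrot p x))

    module _ (j j₀ : Fin (suc N)) where

      semi : Fin N → Fin (suc N) → Fin (suc N)
      semi a d with j₀ ≟ᶠ d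
      ... | yes _ = j
      ... | no ne = punchIn j (rot a (punchOut ne))

      semi-injective : ∀ a {c d} → semi a c ≡ semi a d → c ≡ d
      semi-injective a {c} {d} e with j₀ ≟ᶠ c | j₀ ≟ᶠ d
      ... | yes p | yes q = trans (sym p) q
      ... | yes _ | no _  = ⊥-elim (punchInᵢ≢i j _ (sym e))
      ... | no _  | yes _ = ⊥-elim (punchInᵢ≢i j _ e)
      ... | no p  | no q  = punchOut-injective p q (rot-injective a (punchIn-injective j _ _ e))

      semi-small : ∀ d → Σᶠ (λ a → δ j (semi a d)) ≡ N * δ j₀ d
      semi-small d with j₀ ≟ᶠ d
      ... | yes refl = trans (wt-cong (allFin N) (λ _ → δ-same j))
          (trans (Σᶠ-const {N} 1) (cong (N *_) (sym (δ-same j₀))))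
      ... | no ne = trans (wt-cong (allFin N) (λ a → δ-diff {c = j} (punchInᵢ≢i j _)))
              (trans (Σᶠ-const {N} 0) (cong (N *_) (sym (δ-diff {c = j₀} {d} (ne ∘ sym)))))

      semi-large : ∀ {p} → j ≢ p → ∀ d → Σᶠ (λ a → δ p (semi a d)) + δ j₀ d ≡ 1
      semi-large {p} j≢p d with j₀ ≟ᶠ d
      ... | yes refl = cong₂ _+_ (trans (wt-cong (allFin N) (λ _ → δ-diff {c = p} j≢p))
          (trans (Σᶠ-const {N} 0) (*-zeroʳ N))) (δ-same j₀)
      ... | no ne = cong₂ _+_ (trans (wt-cong (allFin N) (λ a → δ-cong {c = p} {c′ = punchOut j≢p}
                (λ e → punchIn-injective j _ _ (trans e (sym (punchIn-punchOut j≢p))))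
                (λ e → trans (cong (punchIn j) e) (punchIn-punchOut j≢p))))
                (rot-uniform (punchOut j≢p) (punchOut ne)))
              (δ-diff {c = j₀} {d} (ne ∘ sym))

  wt-lookup : ∀ {A : Set} (φ : A → ℕ) xs → wt φ xs ≡ Σᶠ (λ i → φ (lookup xs i))
  wt-lookup φ []       = refl
  wt-lookup φ (x ∷ xs) = trans (cong (φ x +_) (wt-lookup φ xs)) (sym (Σᶠ-suc (λ i → φ (lookup (x ∷ xs) i))))

  Σᶠ-two : ∀ {k} (f : Fin k → ℕ) {a b} → a ≢ b → 1 ≤ f a → 1 ≤ f b → 2 ≤ Σᶠ f
  Σᶠ-two {k} f {a} {b} a≢b fa fb = ≤-trans (≤-reflexive (sym
      (trans (wt-+ (δ a) (δ b) (allFin k)) (cong₂ _+_ (Σᶠ-δ a) (Σᶠ-δ b)))))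
    (wt-≤ (allFin k) (λ {c} _ → pointwise c))
    where
    pointwise : ∀ c → δ a c + δ b c ≤ f c
    pointwise c with c ≟ᶠ a | c ≟ᶠ b
    ... | yes refl | yes refl = ⊥-elim (a≢b refl)
    ... | yes refl | no _     = fa
    ... | no _     | yes refl = fb
    ... | no _     | no _     = z≤n

  ∈-concat-replicate : ∀ {A : Set} {x : A} l (xs : List A) → x ∈ concat (replicate l xs) → x ∈ xs
  ∈-concat-replicate (suc l) xs p with ∈-++⁻ xs p
  ... | inj₁ q = q
  ... | inj₂ q = ∈-concat-replicate l xs q

  Σᶠ-one : ∀ {k} (f : Fin k → ℕ) a → f a ≤ Σᶠ f
  Σᶠ-one f a = ∈⇒≤wt f (allFin _) (∈-allFin a)

  module Copies {n : ℕ} (G : Graph n) (ρ Q Δ : ℕ) {h : ℕ} (H : Graph h) where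

    open Blocks G ρ Q Δ

    demand : ∀ {h} → Fin r → (Fin h → Fin r) → ℕ
    demand p χ = Σᶠ (λ v → δ p (χ v))

    wc : ∀ {h} {X : Set} → (X → ℕ) → (Fin h → X) → ℕ
    wc φ f = Σᶠ (λ v → φ (f v))

    uncons : ∀ (xs : List A) → 1 ≤ length xs → ∃₂ λ y ys → xs ≡ y ∷ ys
    uncons (x ∷ xs) _ = x , xs , refl

    record Pick {h : ℕ} (χ : Fin h → Fin r) (S : Block) : Set where
      field
        image   : Fin h → A
        rest    : Block
        image∈  : ∀ v → image v ∈ S (χ v)
        rest⊆   : ∀ p {x} → x ∈ rest p → x ∈ S p
        weights : ∀ φ → w φ S ≡ wc φ image + w φ rest
        lengths : ∀ p → length (S p) ≡ demand p χ + length (rest p)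

    pick : ∀ {h} (χ : Fin h → Fin r) (S : Block) → (∀ p → demand p χ ≤ length (S p)) → Pick χ S
    pick {zero} χ S _ = record { image = λ () ; rest = S ; image∈ = λ () ; rest⊆ = λ p x → x ; weights = λ _ → refl ;
        lengths = λ _ → refl }
    pick {suc h} χ S enough with uncons (S (χ zero)) (≤-trans
        (≤-trans (≤-reflexive (sym (δ-same (χ zero)))) (Σᶠ-one (λ v → δ (χ zero) (χ v)) zero)) (enough (χ zero)))
    ... | x , xs , e = extend (pick (χ ∘ suc) S₁ enough₁)
      where
      c = χ zero
      S₁ = put c xs S
      len₁ : ∀ p → length (S p) ≡ δ p c + length (S₁ p)
      len₁ p with c ≟ᶠ p | p ≟ᶠ c
      ... | yes refl | yes _ = cong length e
      ... | no _ | no _ = refl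
      ... | yes q | no ¬q = ⊥-elim (¬q (sym q))
      ... | no ¬q | yes q = ⊥-elim (¬q (sym q))
      sub : ∀ p {y} → y ∈ S₁ p → y ∈ S p
      sub p y∈ with p ≟ᶠ c
      ... | yes refl = subst (_ ∈_) (sym e) (there y∈)
      ... | no _     = y∈
      enough₁ : ∀ p → demand p (χ ∘ suc) ≤ length (S₁ p)
      enough₁ p = +-cancelˡ-≤ (δ p c) _ _ (≤-trans (≤-reflexive (sym (Σᶠ-suc (λ v → δ p (χ v)))))
          (≤-trans (enough p) (≤-reflexive (len₁ p))))
      w₁ : ∀ φ → w φ S ≡ φ x + w φ S₁
      w₁ φ = +-cancelʳ-≡ (wt φ xs) _ _ (trans (sym (w-put φ c xs S))
          (trans (cong (λ l → w φ S₁ + wt φ l) e) (lem (w φ S₁) (φ x) (wt φ xs))))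
        where
        lem : ∀ a b c → a + (b + c) ≡ b + a + c
        lem = solve-∀
      extend : Pick (χ ∘ suc) S₁ → Pick χ S
      extend pk = record { image = f⁺ ; rest = rest ; image∈ = f⁺∈ ; rest⊆ = λ p y∈ → sub p (rest⊆ p y∈)
        ; weights = λ φ → trans (w₁ φ) (trans (cong (φ x +_) (weights φ))
            (trans (sym (+-assoc (φ x) (wc φ image) (w φ rest)))
            (cong (_+ w φ rest) (sym (Σᶠ-suc (λ v → φ (f⁺ v)))))))
        ; lengths = λ p → trans (len₁ p) (trans (cong (δ p c +_) (lengths p))
            (trans (sym (+-assoc (δ p c) _ (length (rest p))))
            (cong (_+ length (rest p)) (sym (Σᶠ-suc (λ v → δ p (χ v))))))) }
        where
        open Pick pk
        f⁺ : Fin (suc h) → A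
        f⁺ zero    = x
        f⁺ (suc v) = image v
        f⁺∈ : ∀ v → f⁺ v ∈ S (χ v)
        f⁺∈ zero    = subst (x ∈_) (sym e) (here refl)
        f⁺∈ (suc v) = sub _ (image∈ v)

    record Picks (cs : List (Fin h → Fin r)) (S : Block) : Set where
      field
        images : List (Fin h → A)
        number : length images ≡ length cs
        weight≤ : ∀ φ → wt (wc φ) images ≤ w φ S
        colour : ∀ {f} → f ∈ images → ∃ λ χ → χ ∈ cs × (∀ v → f v ∈ S (χ v))

    pickAll : ∀ (cs : List (Fin h → Fin r)) (S : Block) → (∀ p → wt (demand p) cs ≤ length (S p)) → Picks cs S
    pickAll []       S _      = record { images = [] ; number = refl ; weight≤ = λ _ → z≤n ; colour = λ () }
    pickAll (χ ∷ cs) S enough = extend (pickAll cs rest (λ p → +-cancelˡ-≤ (demand p χ) _ _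
        (≤-trans (enough p) (≤-reflexive (lengths p)))))
      where
      open Pick (pick χ S (λ p → ≤-trans (m≤m+n _ _) (enough p)))
      extend : Picks cs rest → Picks (χ ∷ cs) S
      extend ps = record { images = image ∷ images ; number = cong suc number
        ; weight≤ = λ φ → ≤-trans (+-monoʳ-≤ (wc φ image) (weight≤ φ)) (≤-reflexive (sym (weights φ)))
        ; colour = λ { (here refl) → χ , here refl , image∈
                     ; (there p) → proj₁ (colour p) , there (proj₁ (proj₂ (colour p))) , λ v → rest⊆ _
                         (proj₂ (proj₂ (colour p)) v) } }
        where open Picks ps

    IsHom : (Fin h → A) → Set
    IsHom f = ∀ u v → adj H u v ≡ true → adjᵍ (f u) (f v) ≡ true

    module _ (χ₀ : Fin h → Fin r) (proper : ProperColouring H r χ₀) (j₀ : Fin r) (s s′ : ℕ)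
      (size-s : colourClassSize χ₀ j₀ ≡ s) (h≡ : h ≡ s + s′) (a b k M P0 Q0 : ℕ)
      (large : a * h + b * s′ ≡ P0 * M) (small-eq : a * h + b * (suc ρ * s) ≡ Q0 * M)
      (Q≡ : Q ≡ Q0 * k) (P≡ : P ≡ P0 * k + 1) where

      rotations : List (Fin h → Fin r)
      rotations = map (λ c v → rot c (χ₀ v)) (allFin r)

      semis : Fin r → List (Fin h → Fin r)
      semis j = map (λ c v → semi j j₀ c (χ₀ v)) (allFin (suc ρ))

      family : Fin r → List (Fin h → Fin r)
      family j = concat (replicate (k * a) rotations) ++ concat (replicate (k * b) (semis j))

      demand-rotations : ∀ p → wt (demand p) rotations ≡ h
      demand-rotations p = trans (wt-map (demand p) (λ c v → rot c (χ₀ v)) (allFin r))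
        (trans (wt-fubini (λ c v → δ p (rot c (χ₀ v))) (allFin r) (allFin h))
          (trans (wt-cong (allFin h) (λ v → rot-uniform p (χ₀ v))) (trans (Σᶠ-const {h} 1) (*-identityʳ h))))

      demand-semis : ∀ j p → wt (demand p) (semis j) ≡ Σᶠ (λ v → Σᶠ (λ c → δ p (semi j j₀ c (χ₀ v))))
      demand-semis j p = trans (wt-map (demand p) (λ c v → semi j j₀ c (χ₀ v)) (allFin (suc ρ)))
        (wt-fubini (λ c v → δ p (semi j j₀ c (χ₀ v))) (allFin (suc ρ)) (allFin h))

      demand-semis-small : ∀ j → wt (demand j) (semis j) ≡ suc ρ * s
      demand-semis-small j = trans (demand-semis j j) (trans (wt-cong (allFin h) (λ v → semi-small j j₀ (χ₀ v)))
        (trans (wt-* (suc ρ) (λ v → δ j₀ (χ₀ v)) (allFin h)) (cong (suc ρ *_) size-s)))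

      demand-semis-large : ∀ {j p} → j ≢ p → wt (demand p) (semis j) ≡ s′
      demand-semis-large {j} {p} j≢p = +-cancelʳ-≡ s _ _ (trans (cong₂ _+_ (demand-semis j p) (sym size-s))
        (trans (sym (wt-+ (λ v → Σᶠ (λ c → δ p (semi j j₀ c (χ₀ v)))) (λ v → δ j₀ (χ₀ v)) (allFin h)))
          (trans (wt-cong (allFin h) (λ v → semi-large j j₀ j≢p (χ₀ v)))
              (trans (Σᶠ-const {h} 1) (trans (*-identityʳ h) (trans h≡ (+-comm s s′)))))))

      demand-family : ∀ j p → wt (demand p) (family j) ≡ k * a * h + k * b * wt (demand p) (semis j)
      demand-family j p = trans (wt-++ (demand p) (concat (replicate (k * a) rotations)) _)
        (cong₂ _+_ (trans (wt-concat-replicate (demand p) (k * a) rotations) (cong (k * a *_) (demand-rotations p)))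
          (wt-concat-replicate (demand p) (k * b) (semis j)))

      -- At most one vertex per unit of each large class is wasted, since P = P0 k + 1.
      family-fits : ∀ j p → wt (demand p) (family j) ≤ sz j p * M
      family-fits j p with p ≟ᶠ j
      ... | yes refl = ≤-reflexive (begin
            wt (demand p) (family p)                         ≡⟨ demand-family p p ⟩
            k * a * h + k * b * wt (demand p) (semis p)      ≡⟨ cong (λ t → k * a * h + k * b * t)
                (demand-semis-small p) ⟩
            k * a * h + k * b * (suc ρ * s)                  ≡⟨ lem k a h b (suc ρ * s) ⟩
            k * (a * h + b * (suc ρ * s))                    ≡⟨ cong (k *_) small-eq ⟩
            k * (Q0 * M)                                     ≡⟨ lem₂ k Q0 M ⟩
            (Q0 * k + 0) * M                                 ≡⟨ cong (λ q → (q + 0) * M) Q≡ ⟨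
            (Q + 0) * M                                      ∎)
        where
        open ≡-Reasoning
        lem : ∀ k a h b x → k * a * h + k * b * x ≡ k * (a * h + b * x)
        lem = solve-∀
        lem₂ : ∀ k q M → k * (q * M) ≡ (q * k + 0) * M
        lem₂ = solve-∀
      ... | no p≢j = begin
            wt (demand p) (family j)                         ≡⟨ demand-family j p ⟩
            k * a * h + k * b * wt (demand p) (semis j)      ≡⟨ cong (λ t → k * a * h + k * b * t)
                (demand-semis-large (p≢j ∘ sym)) ⟩
            k * a * h + k * b * s′                           ≡⟨ lem k a h b s′ ⟩
            k * (a * h + b * s′)                             ≡⟨ cong (k *_) large ⟩
            k * (P0 * M)                                     ≤⟨ m≤m+n _ M ⟩
            k * (P0 * M) + M                                 ≡⟨ lem₂ k P0 M ⟩
            (P0 * k + 1) * M                                 ≡⟨ cong (_* M) P≡ ⟨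
            P * M                                            ≡⟨ cong (λ t → (Q + t) * M) (+-identityʳ Δ) ⟨
            (Q + (Δ + 0)) * M                                ∎
        where
        open ≤-Reasoning
        lem : ∀ k a h b x → k * a * h + k * b * x ≡ k * (a * h + b * x)
        lem = solve-∀
        lem₂ : ∀ k q M → k * (q * M) + M ≡ (q * k + 1) * M
        lem₂ = solve-∀

      family-hom : ∀ {j χ} → χ ∈ family j → ProperColouring H r χ
      family-hom {j} {χ} χ∈ with ∈-++⁻ (concat (replicate (k * a) rotations)) χ∈
      ... | inj₁ p = fromRot (∈-map⁻ (λ c v → rot c (χ₀ v)) (∈-concat-replicate (k * a) rotations p))
        where
        fromRot : (∃ λ c → c ∈ allFin r × χ ≡ (λ v → rot c (χ₀ v))) → ProperColouring H r χ
        fromRot (c , _ , refl) u v e = proper u v e ∘ rot-injective c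
      ... | inj₂ p = fromSemi (∈-map⁻ (λ c v → semi j j₀ c (χ₀ v)) (∈-concat-replicate (k * b) (semis j) p))
        where
        fromSemi : (∃ λ c → c ∈ allFin (suc ρ) × χ ≡ (λ v → semi j j₀ c (χ₀ v))) → ProperColouring H r χ
        fromSemi (c , _ , refl) u v e = proper u v e ∘ semi-injective j j₀ c

      copies : ℕ
      copies = k * a * r + k * b * suc ρ

      length-family : ∀ j → length (family j) ≡ copies
      length-family j = trans (sym (wt-1 (family j))) (trans
          (wt-++ (λ _ → 1) (concat (replicate (k * a) rotations)) _)
        (cong₂ _+_ (trans (wt-concat-replicate (λ _ → 1) (k * a) rotations)
            (cong (k * a *_) (trans (wt-1 rotations) (trans (length-map _ (allFin r))
            (length-tabulate {n = r} (λ c → c))))))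
          (trans (wt-concat-replicate (λ _ → 1) (k * b) (semis j))
              (cong (k * b *_) (trans (wt-1 (semis j)) (trans (length-map _ (allFin (suc ρ)))
              (length-tabulate {n = suc ρ} (λ c → c))))))))

      tile-copies : ∀ (Ts : List (Tile M)) → Σ (List (Fin h → A)) λ fs →
        length fs ≡ length Ts * copies × (∀ φ → wt (wc φ) fs ≤ ws φ Ts) × (∀ {f} → f ∈ fs → IsHom f)
      tile-copies []       = [] , refl , (λ _ → z≤n) , λ ()
      tile-copies (K ∷ Ts) = join (pickAll (family (small K)) (cls K)
          (λ p → ≤-trans (family-fits (small K) p) (≤-reflexive (sym (size K p))))) (tile-copies Ts)
        where
        join : Picks (family (small K)) (cls K) →
          (Σ (List (Fin h → A)) λ fs → length fs ≡ length Ts * copies × (∀ φ → wt (wc φ) fs ≤ ws φ Ts) ×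
              (∀ {f} → f ∈ fs → IsHom f)) →
          (Σ (List (Fin h → A)) λ fs → length fs ≡ suc (length Ts) * copies × (∀ φ → wt (wc φ) fs ≤ ws φ (K ∷ Ts)) ×
              (∀ {f} → f ∈ fs → IsHom f))
        join ps (gs , l′ , ω′ , hom) = fs ++ gs ,
          trans (length-++ fs) (cong₂ _+_ (trans number (length-family (small K))) l′) ,
          (λ φ → ≤-trans (≤-reflexive (wt-++ (wc φ) fs gs)) (+-mono-≤ (weight≤ φ) (ω′ φ))) ,
          hom⁺
          where
          open Picks ps renaming (images to fs)
          hom⁺ : ∀ {f} → f ∈ fs ++ gs → IsHom f
          hom⁺ f∈ with ∈-++⁻ fs f∈
          ... | inj₂ q = hom q
          ... | inj₁ q with colour q
          ...   | χ , χ∈ , f∈S = λ u v e → complete K (family-hom χ∈ u v e) (f∈S u) (f∈S v)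

      realise : (x : A) → Dec (∃ λ v → x ≡ just v)
      realise (just v) = yes (v , refl)
      realise nothing  = no λ ()

      ghost-free : ∀ (fs : List (Fin h → A)) → Σ (List (Fin h → V)) λ gs →
        length fs ≤ length gs + wt (wc ghost) fs × (∀ φ → wt (wc φ) gs ≤ wt (wc (onReal φ)) fs) ×
        (∀ {g} → g ∈ gs → ∃ λ f → f ∈ fs × (∀ v → f v ≡ just (g v)))
      ghost-free []       = [] , z≤n , (λ _ → z≤n) , λ ()
      ghost-free (f ∷ fs) with ghost-free fs | all? (λ v → realise (f v))
      ... | gs , l , ω , mem | yes real = g ∷ gs , s≤s (≤-trans l (+-monoʳ-≤ (length gs) (m≤n+m _ (wc ghost f)))) ,
            (λ φ → +-mono-≤ (≤-reflexive (wt-cong (allFin h) (λ v → cong (onReal φ) (sym (proj₂ (real v)))))) (ω φ)) ,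
            λ { (here refl) → f , here refl , (λ v → proj₂ (real v)) ; (there p) → proj₁ (mem p) , there
                (proj₁ (proj₂ (mem p))) , proj₂ (proj₂ (mem p)) }
        where
        g : Fin h → V
        g v = proj₁ (real v)
      ... | gs , l , ω , mem | no ¬real = gs , ≤-trans (+-mono-≤ hasGhost l)
          (≤-reflexive (lem (wc ghost f) (length gs) (wt (wc ghost) fs))) ,
            (λ φ → ≤-trans (ω φ) (m≤n+m _ (wc (onReal φ) f))) , λ p → proj₁ (mem p) , there (proj₁ (proj₂ (mem p))) ,
                proj₂ (proj₂ (mem p))
        where
        lem : ∀ a b c → a + (b + c) ≡ b + (a + c)
        lem = solve-∀
        isGhost : ∀ x → ¬ (∃ λ v → x ≡ just v) → 1 ≤ ghost x
        isGhost (just v) ¬p = ⊥-elim (¬p (v , refl))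
        isGhost nothing  _  = ≤-refl
        hasGhost : 1 ≤ wc ghost f
        hasGhost with ¬∀⟶∃¬ h _ (λ v → realise (f v)) ¬real
        ... | v , ¬p = ≤-trans (isGhost (f v) ¬p) (Σᶠ-one (λ v → ghost (f v)) v)

      tiling : ∀ (gs : List (Fin h → V)) → (∀ {g} → g ∈ gs → ∀ u v → adj H u v ≡ true → adj G (g u) (g v) ≡ true) →
        (∀ φ → wt (wc φ) gs ≤ Σᶠ φ) → Tiling H G (length gs)
      tiling gs hom packed = record
        { copy = lookup gs
        ; edges = λ c u v e → hom (∈-lookup c) u v e
        ; disjoint = disj }
        where
        disj : ∀ c d x y → lookup gs c x ≡ lookup gs d y → c ≡ d × x ≡ y
        disj c d x y e with c ≟ᶠ d
        ... | no c≢d = ⊥-elim (<⇒≱ (n<1+n 1) (≤-trans (≤-trans (Σᶠ-two (λ i → wc (δ z) (lookup gs i)) c≢d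
                  (hit c x refl) (hit d y (sym e)))
                  (≤-reflexive (sym (wt-lookup (wc (δ z)) gs)))) (≤-trans (packed (δ z)) (≤-reflexive (Σᶠ-δ z)))))
          where
          z = lookup gs c x
          hit : ∀ i v → lookup gs i v ≡ z → 1 ≤ wc (δ z) (lookup gs i)
          hit i v eq = ≤-trans (≤-reflexive (sym (trans (cong (δ z) eq) (δ-same z))))
              (Σᶠ-one (λ v → δ z (lookup gs i v)) v)
        ... | yes refl with x ≟ᶠ y
        ...   | yes x≡y = refl , x≡y
        ...   | no x≢y = ⊥-elim (<⇒≱ (n<1+n 1) (≤-trans (≤-trans (Σᶠ-two (λ v → δ z (lookup gs c v)) x≢y
                  (≤-reflexive (sym (δ-same z))) (≤-reflexive (sym (trans (cong (δ z) (sym e)) (δ-same z)))))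
                  (≤-trans (Σᶠ-one (λ i → wc (δ z) (lookup gs i)) c) (≤-reflexive (sym (wt-lookup (wc (δ z)) gs)))))
                      (≤-trans (packed (δ z)) (≤-reflexive (Σᶠ-δ z)))))
          where
          z = lookup gs c x

      extract : ∀ (Ts : List (Tile M)) W → (∀ φ → wt φ W + ws (onReal φ) Ts ≡ Σᶠ φ) →
        ∃ λ t → Tiling H G t × n ≤ t * h + (length W + ws ghost Ts * h + length Ts * (suc ρ * M))
      extract Ts W cons = build (tile-copies Ts)
        where
        build : (Σ (List (Fin h → A)) λ fs → length fs ≡ length Ts * copies × (∀ φ → wt (wc φ) fs ≤ ws φ Ts) ×
            (∀ {f} → f ∈ fs → IsHom f)) → _
        build (fs , len , ω , hom) = build′ (ghost-free fs)
          where
          build′ : (Σ (List (Fin h → V)) λ gs → length fs ≤ length gs + wt (wc ghost) fs ×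
              (∀ φ → wt (wc φ) gs ≤ wt (wc (onReal φ)) fs) ×
            (∀ {g} → g ∈ gs → ∃ λ f → f ∈ fs × (∀ v → f v ≡ just (g v)))) → _
          build′ (gs , l , ω′ , mem) = length gs ,
              tiling gs (λ {g} g∈ → hom⁺ g (mem g∈)) (λ φ → ≤-trans (ω′ φ)
                  (≤-trans (ω (onReal φ)) (≤-trans (m≤n+m _ (wt φ W)) (≤-reflexive (cons φ))))) ,
              bound
            where
            hom⁺ : ∀ g → (∃ λ f → f ∈ fs × (∀ v → f v ≡ just (g v))) → ∀ u v → adj H u v ≡ true → adj G (g u) (g v) ≡
                true
            hom⁺ g (f , f∈ , eq) u v e = trans (cong₂ adjᵍ (sym (eq u)) (sym (eq v))) (hom f∈ u v e)
            unit : B * M ≡ copies * h + suc ρ * M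
            unit = begin
              (suc ρ * P + Q) * M                                     ≡⟨ cong₂ (λ p q → (suc ρ * p + q) * M) P≡ Q≡ ⟩
              (suc ρ * (P0 * k + 1) + Q0 * k) * M                     ≡⟨ l₁ ρ P0 k Q0 M ⟩
              k * (suc ρ * (P0 * M) + Q0 * M) + suc ρ * M             ≡⟨ cong₂
                  (λ x y → k * (suc ρ * x + y) + suc ρ * M) large small-eq ⟨
              k * (suc ρ * (a * h + b * s′) + (a * h + b * (suc ρ * s))) + suc ρ * M  ≡⟨ l₂ k ρ a b h s s′ (suc ρ * M)
                  ⟩
              k * a * r * h + k * b * suc ρ * (s + s′) + suc ρ * M    ≡⟨ cong
                  (λ x → k * a * r * h + k * b * suc ρ * x + suc ρ * M) h≡ ⟨
              k * a * r * h + k * b * suc ρ * h + suc ρ * M           ≡⟨ cong (_+ suc ρ * M)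
                  (*-distribʳ-+ h (k * a * r) (k * b * suc ρ)) ⟨
              copies * h + suc ρ * M                                  ∎
              where
              open ≡-Reasoning
              l₁ : ∀ ρ P0 k Q0 M → (suc ρ * (P0 * k + 1) + Q0 * k) * M ≡ k * (suc ρ * (P0 * M) + Q0 * M) + suc ρ * M
              l₁ = solve-∀
              l₂ : ∀ k ρ a b h s s′ x → k * (suc ρ * (a * h + b * s′) + (a * h + b * (suc ρ * s))) + x ≡ k * a * suc
                  (suc ρ) * h + k * b * suc ρ * (s + s′) + x
              l₂ = solve-∀
            reals≤ : ws (onReal (λ _ → 1)) Ts ≤ ws (λ _ → 1) Ts
            reals≤ = wt-≤ Ts (λ {K} _ → w-≤ (cls K) λ { (just _) → ≤-refl ; nothing → z≤n })
            bound : n ≤ length gs * h + (length W + ws ghost Ts * h + length Ts * (suc ρ * M))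
            bound = begin
              n                                                                  ≡⟨ trans
                  (trans (sym (*-identityʳ n)) (sym (Σᶠ-const {n} 1))) (sym (cons (λ _ → 1))) ⟩
              wt (λ _ → 1) W + ws (onReal (λ _ → 1)) Ts                          ≤⟨ +-mono-≤ (≤-reflexive (wt-1 W))
                  reals≤ ⟩
              length W + ws (λ _ → 1) Ts                                         ≡⟨ cong (length W +_)
                  (trans (tiles-size Ts) (cong (length Ts *_) unit)) ⟩
              length W + length Ts * (copies * h + suc ρ * M)                    ≡⟨ l₁ (length W) (length Ts) copies h
                  (suc ρ * M) ⟩
              length Ts * copies * h + (length W + length Ts * (suc ρ * M))      ≤⟨ +-monoˡ-≤ _
                  (*-monoˡ-≤ h (≤-trans (≤-reflexive (sym len)) (≤-trans l (+-monoʳ-≤ (length gs) (ω ghost))))) ⟩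
              (length gs + ws ghost Ts) * h + (length W + length Ts * (suc ρ * M)) ≡⟨ l₂ (length gs) (ws ghost Ts) h
                  (length W) (length Ts * (suc ρ * M)) ⟩
              length gs * h + (length W + ws ghost Ts * h + length Ts * (suc ρ * M)) ∎
              where
              open ≤-Reasoning
              l₁ : ∀ w t c h x → w + t * (c * h + x) ≡ t * c * h + (w + t * x)
              l₁ = solve-∀
              l₂ : ∀ g G h w x → (g + G) * h + (w + x) ≡ g * h + (w + G * h + x)
              l₂ = solve-∀

  -- Degrees

  Σᶠ-below : ∀ {n} i → Σᶠ {n} (λ k → 𝟙 (toℕ k <ᵇ i)) ≤ i
  Σᶠ-below {zero}  i       = z≤n
  Σᶠ-below {suc n} zero    = ≤-reflexive (trans (Σᶠ-const {suc n} 0) (*-zeroʳ (suc n)))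
  Σᶠ-below {suc n} (suc i) = ≤-trans (≤-reflexive (Σᶠ-suc {n} (λ k → 𝟙 (toℕ k <ᵇ suc i)))) (s≤s (Σᶠ-below {n} i))

  injective⇒hits : ∀ {n} (π : Fin n → Fin n) → (∀ u v → π u ≡ π v → u ≡ v) → ∀ v → ∃ λ k → π k ≡ v
  injective⇒hits {suc n} π inj v with any? (λ k → π k ≟ᶠ v)
  ... | yes p = p
  ... | no ¬p = ⊥-elim (1+n≰n (injective⇒≤ {f = λ k → punchOut {i = v} {π k} (λ e → ¬p (k , sym e))}
          (λ {x} {y} e → inj x y (punchOut-injective {i = v} _ _ e))))

  Σᶠ-permute : ∀ {n} (π : Fin n → Fin n) → (∀ u v → π u ≡ π v → u ≡ v) → ∀ f → Σᶠ f ≤ Σᶠ (λ k → f (π k))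
  Σᶠ-permute {n} π inj f = begin
    Σᶠ f                                          ≤⟨ wt-≤ (allFin n) (λ {v} _ → hit v) ⟩
    Σᶠ (λ v → Σᶠ (λ k → δ (π k) v * f v))         ≡⟨ wt-fubini (λ v k → δ (π k) v * f v) (allFin n) (allFin n) ⟩
    Σᶠ (λ k → Σᶠ (λ v → δ (π k) v * f v))         ≡⟨ wt-cong (allFin n)
        (λ k → trans (wt-cong (allFin n) (at k)) (Σᶠ-δ* (π k) (f (π k)))) ⟩
    Σᶠ (λ k → f (π k))                            ∎
    where
    open ≤-Reasoning
    at : ∀ k v → δ (π k) v * f v ≡ δ (π k) v * f (π k)
    at k v with v ≟ᶠ π k
    ... | yes refl = refl
    ... | no _     = refl
    hit : ∀ v → f v ≤ Σᶠ (λ k → δ (π k) v * f v)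
    hit v with injective⇒hits π inj v
    ... | k , refl = ≤-trans (≤-reflexive (trans (sym (*-identityˡ _)) (cong (_* f (π k)) (sym (δ-same (π k))))))
            (Σᶠ-one (λ i → δ (π i) (π k) * f (π k)) k)

  module Levels {n : ℕ} (G : Graph n) (q : ℕ) ⦃ nz : NonZero n ⦄ where

    level u : Fin n → ℕ
    level v = q * degree G v / n
    u v     = suc q ∸ level v

    degree≤n : ∀ v → degree G v ≤ n
    degree≤n v = ≤-trans (wt≤length (allFin n) (λ w → 𝟙≤1 (adj G v w)))
        (≤-reflexive (length-tabulate {n = n} (λ i → i)))

    level≤q : ∀ v → level v ≤ q
    level≤q v = ≤-trans (/-mono-≤ {o = n} (*-monoʳ-≤ q (degree≤n v)) ≤-refl) (≤-reflexive (m*n/n≡m q n))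

    1≤u : ∀ v → 1 ≤ u v
    1≤u v = ≤-trans (≤-reflexive (sym (trans (+-∸-assoc 1 {level v} ≤-refl) (cong suc (n∸n≡0 (level v))))))
        (∸-monoˡ-≤ (level v) (s≤s (level≤q v)))

    u≤ : ∀ v → u v ≤ suc q
    u≤ v = m∸n≤m (suc q) (level v)

    level-order : ∀ y v → level v ≤ level y → q * degree G v ≤ q * degree G y + n
    level-order y v le = begin
      q * degree G v                                   ≡⟨ m≡m%n+[m/n]*n (q * degree G v) n ⟩
      q * degree G v % n + level v * n                 ≤⟨ +-mono-≤ (<⇒≤ (m%n<n (q * degree G v) n)) (*-monoˡ-≤ n le) ⟩
      n + level y * n                                  ≤⟨ +-monoʳ-≤ n (m/n*n≤m (q * degree G y) n) ⟩
      n + q * degree G y                               ≡⟨ +-comm n _ ⟩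
      q * degree G y + n                               ∎
      where open ≤-Reasoning

    notCheaper-sound : ∀ y v → 1 ≤ notCheaper u y v → level v ≤ level y
    notCheaper-sound y v h with u v <ᵇ u y in eq
    ... | false = ≮⇒≥ (λ lt → <ᵇ-false (∸-monoʳ-< lt (≤-trans (level≤q v) (n≤1+n q))) eq)
      where
      <ᵇ-false : ∀ {a b} → a < b → (a <ᵇ b) ≡ false → ⊥
      <ᵇ-false {a} {b} lt e = subst IsTrue e (<⇒<ᵇ lt)

    module _ (π : Fin n → Fin n) (sorts : SortsDegrees G π) where

      degree-below : ∀ y (k : Fin n) → suc (toℕ k) ≤ Σᶠ (notCheaper u y) → q * degree G (π k) ≤ q * degree G y + n
      degree-below y k k< with any? (λ k′ → (toℕ k ≤? toℕ k′) ×-dec (1 ≤? notCheaper u y (π k′)))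
      ... | yes (k′ , k≤k′ , in-set) = ≤-trans (*-monoʳ-≤ q (proj₂ sorts k k′ k≤k′))
          (level-order y (π k′) (notCheaper-sound y (π k′) in-set))
      ... | no ¬ex = ⊥-elim (<⇒≱ k< (≤-trans (Σᶠ-permute π (proj₁ sorts) (notCheaper u y))
          (≤-trans (wt-≤ (allFin n) (λ {i} _ → pointwise i)) (Σᶠ-below {n} (toℕ k)))))
        where
        pointwise : ∀ i → notCheaper u y (π i) ≤ 𝟙 (toℕ i <ᵇ toℕ k)
        pointwise i with toℕ i <ᵇ toℕ k in eq
        ... | true  = 𝟙≤1 _
        ... | false = ≤-pred (≰⇒> (λ h → ¬ex (i , ≮⇒≥ (λ lt → subst IsTrue eq (<⇒<ᵇ lt)) , h)))

      y-in-own-set : ∀ y → 1 ≤ Σᶠ (notCheaper u y)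
      y-in-own-set y = ≤-trans (≤-reflexive (sym self)) (Σᶠ-one (notCheaper u y) y)
        where
        irr : ∀ a → (a <ᵇ a) ≡ false
        irr zero    = refl
        irr (suc a) = irr a
        self : notCheaper u y y ≡ 1
        self = cong (𝟙 ∘ not) (irr (u y))

      module _ (ρ P0 Q0 B0 : ℕ) (1≤B0 : 1 ≤ B0) (B0≤n : B0 ≤ n) (1≤P0 : 1 ≤ P0)
        (degrees : ∀ (k : Fin n) → B0 * suc (toℕ k) ≤ P0 * n → ρ * P0 * P0 * n + B0 * (Q0 * suc (toℕ k)) ≤ B0 * P0 *
            degree G (π k)) where

        at-rank : ∀ y i → 1 ≤ i → i ≤ Σᶠ (notCheaper u y) → B0 * i ≤ P0 * n →
          q * (ρ * P0 * P0 * n + B0 * (Q0 * i)) ≤ B0 * P0 * (q * degree G y + n)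
        at-rank y (suc i) _ i≤ small = begin
          q * (ρ * P0 * P0 * n + B0 * (Q0 * suc i))     ≤⟨ *-monoʳ-≤ q
              (subst (λ j → ρ * P0 * P0 * n + B0 * (Q0 * suc j) ≤ B0 * P0 * degree G (π k)) k≡
              (degrees k (subst (λ j → B0 * suc j ≤ P0 * n) (sym k≡) small))) ⟩
          q * (B0 * P0 * degree G (π k))                ≡⟨ lem q (B0 * P0) (degree G (π k)) ⟩
          B0 * P0 * (q * degree G (π k))                ≤⟨ *-monoʳ-≤ (B0 * P0)
              (degree-below y k (subst (λ j → suc j ≤ Σᶠ (notCheaper u y)) (sym k≡) i≤)) ⟩
          B0 * P0 * (q * degree G y + n)                ∎
          where
          open ≤-Reasoning
          lem : ∀ q b d → q * (b * d) ≡ b * (q * d)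
          lem = solve-∀
          i<n : i < n
          i<n = ≤-trans i≤ (≤-trans (wt≤length (allFin n) (λ v → 𝟙≤1 _))
              (≤-reflexive (length-tabulate {n = n} (λ i → i))))
          k : Fin n
          k = fromℕ< i<n
          k≡ : toℕ k ≡ i
          k≡ = toℕ-fromℕ< i<n

        low : ∀ y → B0 * Σᶠ (notCheaper u y) ≤ P0 * n →
          q * (ρ * P0 * P0 * n + B0 * (Q0 * Σᶠ (notCheaper u y))) ≤ B0 * P0 * (q * degree G y + n) + q * (B0 * Q0)
        low y x≤ = ≤-trans (at-rank y (Σᶠ (notCheaper u y)) (y-in-own-set y) ≤-refl x≤) (m≤m+n _ _)

        high : ∀ y → P0 * n ≤ B0 * Σᶠ (notCheaper u y) →
          q * ((ρ * P0 + Q0) * P0 * n) ≤ B0 * P0 * (q * degree G y + n) + q * (B0 * Q0)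
        high y x≥ = begin
          q * ((ρ * P0 + Q0) * P0 * n)                             ≡⟨ l₁ q ρ P0 Q0 n ⟩
          q * (ρ * P0 * P0 * n + Q0 * (P0 * n))                    ≤⟨ *-monoʳ-≤ q
              (+-monoʳ-≤ (ρ * P0 * P0 * n) (*-monoʳ-≤ Q0 P0n≤)) ⟩
          q * (ρ * P0 * P0 * n + Q0 * (B0 * i + B0))               ≡⟨ l₂ q (ρ * P0 * P0 * n) Q0 B0 i ⟩
          q * (ρ * P0 * P0 * n + B0 * (Q0 * i)) + q * (B0 * Q0)    ≤⟨ +-monoˡ-≤ (q * (B0 * Q0))
              (at-rank y i 1≤i (*-cancelˡ-≤ B0 (≤-trans B0i≤ x≥)) B0i≤) ⟩
          B0 * P0 * (q * degree G y + n) + q * (B0 * Q0)           ∎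
          where
          open ≤-Reasoning
          instance
            nzB : NonZero B0
            nzB = >-nonZero 1≤B0
          i : ℕ
          i = P0 * n / B0
          B0i≤ : B0 * i ≤ P0 * n
          B0i≤ = ≤-trans (≤-reflexive (*-comm B0 i)) (m/n*n≤m (P0 * n) B0)
          P0n≤ : P0 * n ≤ B0 * i + B0
          P0n≤ = ≤-trans (≤-reflexive (trans (m≡m%n+[m/n]*n (P0 * n) B0) (+-comm (P0 * n % B0) (i * B0))))
            (+-mono-≤ (≤-reflexive (*-comm i B0)) (<⇒≤ (m%n<n (P0 * n) B0)))
          1≤i : 1 ≤ i
          1≤i = ≤-trans (≤-reflexive (sym (m*n/n≡m 1 B0))) (/-mono-≤ {o = B0} (*-mono-≤ 1≤P0 B0≤n) ≤-refl)
          l₁ : ∀ q ρ P0 Q0 n → q * ((ρ * P0 + Q0) * P0 * n) ≡ q * (ρ * P0 * P0 * n + Q0 * (P0 * n))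
          l₁ = solve-∀
          l₂ : ∀ q a Q0 B0 i → q * (a + Q0 * (B0 * i + B0)) ≡ q * (a + B0 * (Q0 * i)) + q * (B0 * Q0)
          l₂ = solve-∀

  -- The theorem over the natural numbers

  final-arith : ∀ e E h Z f ρ M B n Gh w L t → E ≡ 4 * e * h → e ≤ Z → 8 * e * suc ρ ≤ B →
    4 * (Z * w) ≤ n → E * Gh ≤ n → Gh ≤ n → f * (B * M) ≤ n + Gh → L ≡ w + Gh * h + f * (suc ρ * M) →
    n ≤ t * h + L → e * (n ∸ t * h) ≤ n
  final-arith e E h Z f ρ M B n Gh w L t refl e≤Z B-big few few-ghosts Gh≤n size refl n≤ =
    *-cancelˡ-≤ 8 (begin
      8 * (e * (n ∸ t * h))                                           ≤⟨ *-monoʳ-≤ 8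
          (*-monoʳ-≤ e (m≤n+o⇒m∸n≤o n (t * h) n≤)) ⟩
      8 * (e * (w + Gh * h + f * (suc ρ * M)))                        ≡⟨ l₁ e w Gh h f ρ M ⟩
      2 * (4 * (e * w)) + 2 * (4 * e * h * Gh) + 8 * e * suc ρ * (f * M)  ≤⟨ +-mono-≤
          (+-mono-≤ (*-monoʳ-≤ 2 (≤-trans (*-monoʳ-≤ 4 (*-monoˡ-≤ w e≤Z)) few)) (*-monoʳ-≤ 2 few-ghosts))
          (*-monoˡ-≤ (f * M) B-big) ⟩
      2 * n + 2 * n + B * (f * M)                                     ≡⟨ cong (2 * n + 2 * n +_) (l₂ B f M) ⟩
      2 * n + 2 * n + f * (B * M)                                     ≤⟨ +-monoʳ-≤ (2 * n + 2 * n)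
          (≤-trans size (+-monoʳ-≤ n Gh≤n)) ⟩
      2 * n + 2 * n + (n + n)                                         ≤⟨ m≤m+n _ (2 * n) ⟩
      2 * n + 2 * n + (n + n) + 2 * n                                 ≡⟨ l₃ n ⟩
      8 * n                                                           ∎)
    where
    open ≤-Reasoning
    l₁ : ∀ e w Gh h f ρ M → 8 * (e * (w + Gh * h + f * (suc ρ * M))) ≡ 2 * (4 * (e * w)) + 2 * (4 * e * h * Gh) + 8 *
        e * suc ρ * (f * M)
    l₁ = solve-∀
    l₂ : ∀ B f M → B * (f * M) ≡ f * (B * M)
    l₂ = solve-∀
    l₃ : ∀ n → 2 * n + 2 * n + (n + n) + 2 * n ≡ 8 * n
    l₃ = solve-∀

  -- Large classes get P0 k + 1 instead of P0 k vertices, so that P > Q and hence an exact gain is possible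
  -- even if σ = h/r; the error this causes is absorbed by taking k large.
  module Constants (ρ Q0 D0 e h M : ℕ) where

    P0 B0 E k Q Δ P B ε q Z C U α Y T : ℕ
    patterns reserve : ℕ → ℕ
    P0 = Q0 + D0
    B0 = suc ρ * P0 + Q0
    E  = 4 * e * h
    k  = 8 * ((ρ * P0 + Q0) * Q0) * suc E + 8 * e * suc ρ
    Q  = Q0 * k
    Δ  = D0 * k + 1
    P  = Q + Δ
    B  = suc ρ * P + Q
    ε  = P0 * (suc (suc ρ) * (P * B)) + Q0 * P
    Z  = 8 * (B0 * P0) * E
    q  = Z
    C  = B + 8 * (B0 * ε) * suc E
    U  = suc q
    α  = suc U * (4 * suc E)
    Y  = 4 * (Z * (B * C + (P + Δ * B)))
    T  = suc (2 * Y * (α * suc (suc ρ) + U))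
    patterns m = (P * m + Δ * B * m) * 2 ^ (B * (C * m) + suc U)
    reserve m  = 3 * (B0 * P0) * (suc E * patterns m)

    threshold : ℕ
    threshold = roundsNeed Z Y P B C reserve T M + 8 * (B0 * Q0) * E + B0

  module AlmostTiling (ρ Q0 P0 e h M s s′ a b : ℕ) (B0 E k Q Δ q Z C U α Y T : ℕ) (patterns reserve : ℕ → ℕ)
    (1≤P0 : 1 ≤ P0) (1≤e : 1 ≤ e) (1≤h : 1 ≤ h) (1≤M : 1 ≤ M)
    (B0≡ : B0 ≡ suc ρ * P0 + Q0) (E≡ : E ≡ 4 * e * h) (Q≡ : Q ≡ Q0 * k) (P≡ : Q + Δ ≡ P0 * k + 1) (1≤Δ : 1 ≤ Δ)
    (k-big : 8 * ((ρ * P0 + Q0) * Q0) * suc E ≤ k) (k-big′ : 8 * e * suc ρ ≤ k)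
    (Z≡ : Z ≡ 8 * ((suc ρ * P0 + Q0) * P0) * E) (q≡ : q ≡ Z) (U≡ : U ≡ suc q)
    (C-big : 8 * ((suc ρ * P0 + Q0) * (P0 * (suc (suc ρ) * ((Q + Δ) * (suc ρ * (Q + Δ) + Q))) + Q0 * (Q + Δ))) * suc E
        ≤ C)
    (B≤C : suc ρ * (Q + Δ) + Q ≤ C)
    (α≡ : α ≡ suc U * (4 * suc E))
    (Y≡ : Y ≡ 4 * (Z * ((suc ρ * (Q + Δ) + Q) * C + ((Q + Δ) + Δ * (suc ρ * (Q + Δ) + Q)))))
    (T≡ : T ≡ suc (2 * Y * (α * suc (suc ρ) + U)))
    (patterns≡ : ∀ m → patterns m ≡ ((Q + Δ) * m + Δ * (suc ρ * (Q + Δ) + Q) * m) * 2 ^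
        ((suc ρ * (Q + Δ) + Q) * (C * m) + suc U))
    (reserve≡ : ∀ m → reserve m ≡ 3 * ((suc ρ * P0 + Q0) * P0) * (suc E * patterns m))
    (H : Graph h) (χ₀ : Fin h → Fin (suc (suc ρ))) (proper : ProperColouring H (suc (suc ρ)) χ₀)
        (j₀ : Fin (suc (suc ρ)))
    (size-s : colourClassSize χ₀ j₀ ≡ s) (h≡ : h ≡ s + s′)
    (large : a * h + b * s′ ≡ P0 * M) (small : a * h + b * (suc ρ * s) ≡ Q0 * M)
    {n : ℕ} (G : Graph n) (π : Fin n → Fin n) (sorts : SortsDegrees G π)
    (degrees : ∀ (i : Fin n) → B0 * suc (toℕ i) ≤ P0 * n →
      ρ * P0 * P0 * n + B0 * (Q0 * suc (toℕ i)) ≤ B0 * P0 * degree G (π i))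
    (n-big : roundsNeed Z Y (Q + Δ) (suc ρ * (Q + Δ) + Q) C reserve T M + 8 * ((suc ρ * P0 + Q0) * Q0) * E + B0 ≤ n)
        where

    private
      P B : ℕ
      P = Q + Δ
      B = suc ρ * P + Q
      1≤B0 : 1 ≤ B0
      1≤B0 = ≤-trans (≤-trans 1≤P0 (≤-trans (m≤m+n P0 (ρ * P0)) (m≤m+n _ Q0))) (≤-reflexive (sym B0≡))
      B0≤n : B0 ≤ n
      B0≤n = ≤-trans (m≤n+m B0 _) n-big
      1≤n : 1 ≤ n
      1≤n = ≤-trans 1≤B0 B0≤n
      instance
        nzn : NonZero n
        nzn = >-nonZero 1≤n
      1≤E : 1 ≤ E
      1≤E = ≤-trans (*-mono-≤ {1} {4 * e} (*-mono-≤ {1} {4} (s≤s z≤n) 1≤e) 1≤h) (≤-reflexive (sym E≡))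
      E≤Z : E ≤ Z
      E≤Z = ≤-trans (≤-trans (≤-reflexive (sym (*-identityˡ E))) (*-monoˡ-≤ E (*-mono-≤ {1} {8} (s≤s z≤n)
        (*-mono-≤ {1} {suc ρ * P0 + Q0} (≤-trans 1≤B0 (≤-reflexive B0≡)) 1≤P0)))) (≤-reflexive (sym Z≡))
      1≤q : 1 ≤ q
      1≤q = ≤-trans (≤-trans 1≤E E≤Z) (≤-reflexive (sym q≡))
      k≤B : k ≤ B
      k≤B = ≤-trans (≤-trans (≤-trans (≤-reflexive (sym (*-identityˡ k))) (*-monoˡ-≤ k 1≤P0))
          (≤-trans (m≤m+n (P0 * k) 1) (≤-reflexive (sym P≡))))
        (≤-trans (m≤m+n P (ρ * P)) (m≤m+n _ Q))
      1≤B : 1 ≤ B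
      1≤B = ≤-trans 1≤Δ (≤-trans (m≤n+m Δ Q) (≤-trans (m≤m+n P (ρ * P)) (m≤m+n _ Q)))
      PQ : P0 * Q ≤ Q0 * P
      PQ = ≤-trans (≤-reflexive (trans (cong (P0 *_) Q≡) (lem P0 Q0 k)))
          (≤-trans (*-monoʳ-≤ Q0 (m≤m+n (P0 * k) 1)) (≤-reflexive (cong (Q0 *_) (sym P≡))))
        where
        lem : ∀ P0 Q0 k → P0 * (Q0 * k) ≡ Q0 * (P0 * k)
        lem = solve-∀
      BP : (suc ρ * P0 + Q0) * P ≡ P0 * B + Q0
      BP = trans (trans (cong ((suc ρ * P0 + Q0) *_) P≡) (lem ρ P0 Q0 k))
          (cong (λ t → P0 * t + Q0) (sym (cong₂ (λ x y → suc ρ * x + y) P≡ Q≡)))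
        where
        lem : ∀ ρ P0 Q0 k → (suc ρ * P0 + Q0) * (P0 * k + 1) ≡ P0 * (suc ρ * (P0 * k + 1) + Q0 * k) + Q0
        lem = solve-∀
      open Levels G q
      module D = Levels G q
      low′ = D.low π sorts ρ P0 Q0 (suc ρ * P0 + Q0) (subst (1 ≤_) B0≡ 1≤B0) (subst (_≤ n) B0≡ B0≤n) 1≤P0
        (subst (λ B0 → ∀ (i : Fin n) → B0 * suc (toℕ i) ≤ P0 * n → ρ * P0 * P0 * n + B0 * (Q0 * suc (toℕ i)) ≤ B0 * P0
            * degree G (π i)) B0≡ degrees)
      high′ = D.high π sorts ρ P0 Q0 (suc ρ * P0 + Q0) (subst (1 ≤_) B0≡ 1≤B0) (subst (_≤ n) B0≡ B0≤n) 1≤P0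
        (subst (λ B0 → ∀ (i : Fin n) → B0 * suc (toℕ i) ≤ P0 * n → ρ * P0 * P0 * n + B0 * (Q0 * suc (toℕ i)) ≤ B0 * P0
            * degree G (π i)) B0≡ degrees)

      open Blocks G ρ Q Δ using (Tile; onReal; ghost; ws; tiles-size; real+ghost)
      module R = Rounds G ρ Q Δ 1≤Δ C B≤C u 1≤u P0 Q0 q 1≤P0 1≤q PQ BP U E
        (λ v → ≤-trans (u≤ v) (≤-reflexive (sym U≡))) 1≤E 1≤n low′ high′
        (≤-trans (≤-reflexive (sym Z≡)) (≤-reflexive (sym q≡))) (≤-trans k-big k≤B)
        (≤-trans C-big (≤-trans (≤-reflexive (sym (*-identityʳ C))) (*-monoʳ-≤ C 1≤B)))
        (≤-trans (≤-trans (m≤n+m _ _) (m≤m+n _ B0)) n-big)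
        Z α Y patterns reserve Z≡ α≡ Y≡ patterns≡ reserve≡
      module K = Copies G ρ Q Δ H

    result : ∃ λ t → Tiling H G t × e * (n ∸ t * h) ≤ n
    result = from-state (R.finished M 1≤M
        (≤-trans (≤-trans (≤-trans (≤-reflexive (cong (λ t → roundsNeed Z Y P B C reserve t M) (sym T≡)))
            (m≤m+n _ (8 * ((suc ρ * P0 + Q0) * Q0) * E))) (m≤m+n _ B0)) n-big))
      where
      from-state : Σ (R.State M) R.Finished → ∃ λ t → Tiling H G t × e * (n ∸ t * h) ≤ n
      from-state (st , fin) = from-copies (K.extract χ₀ proper j₀ s s′ size-s h≡ a b k M P0 Q0 large small Q≡ P≡ Ts W
          (R.State.conserved st))
        where
        Ts = R.State.tiles st
        W  = R.State.left-over st
        few-ghosts : E * ws ghost Ts ≤ n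
        few-ghosts = <⇒≤ fin
        size≤ : length Ts * (B * M) ≤ n + ws ghost Ts
        size≤ = ≤-trans (≤-reflexive (sym (tiles-size Ts))) (≤-trans
            (≤-reflexive (trans (wt-cong Ts (λ K → trans (wt-cong (allFin _)
            (λ c → wt-cong (Tile.cls K c) λ { (just _) → refl ; nothing → refl }))
            (Blocks.w-+ G ρ Q Δ (onReal (λ _ → 1)) ghost (Tile.cls K))))
                (wt-+ (Blocks.wᵗ G ρ Q Δ (onReal (λ _ → 1))) (Blocks.wᵗ G ρ Q Δ ghost) Ts)))
            (+-monoˡ-≤ (ws ghost Ts) (≤-trans (m≤n+m _ (wt (λ _ → 1) W))
                (≤-reflexive (trans (R.State.conserved st (λ _ → 1)) (trans (Σᶠ-const {n} 1) (*-identityʳ n)))))))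
        from-copies : (∃ λ t → Tiling H G t × n ≤ t * h + (length W + ws ghost Ts * h + length Ts * (suc ρ * M))) → ∃
            λ t → Tiling H G t × e * (n ∸ t * h) ≤ n
        from-copies (t , tl , n≤) = t , tl , final-arith e E h Z (length Ts) ρ M B n (ws ghost Ts) (length W) _ t E≡
            e≤Z (≤-trans k-big′ k≤B)
            (R.State.few-left st) few-ghosts
            (≤-trans (≤-trans (≤-reflexive (sym (*-identityˡ (ws ghost Ts)))) (*-monoˡ-≤ (ws ghost Ts) 1≤E))
                few-ghosts) size≤ refl n≤
          where
          e≤Z : e ≤ Z
          e≤Z = ≤-trans (≤-trans (≤-trans (m≤m+n e (3 * e)) (≤-trans (≤-reflexive (sym (*-identityʳ (4 * e))))
              (*-monoʳ-≤ (4 * e) 1≤h))) (≤-reflexive (sym E≡))) E≤Z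

  almost-tiling : ∀ (ρ Q0 D0 e : ℕ) {h} M s s′ a b → 1 ≤ Q0 + D0 → 1 ≤ e → 1 ≤ h → 1 ≤ M →
    (H : Graph h) (χ₀ : Fin h → Fin (suc (suc ρ))) → ProperColouring H (suc (suc ρ)) χ₀ → (j₀ : Fin (suc (suc ρ))) →
    colourClassSize χ₀ j₀ ≡ s → h ≡ s + s′ →
    a * h + b * s′ ≡ (Q0 + D0) * M → a * h + b * (suc ρ * s) ≡ Q0 * M →
    ∃ λ n₀ → ∀ n (G : Graph n) → n₀ ≤ n → (π : Fin n → Fin n) → SortsDegrees G π →
      (∀ (i : Fin n) → (suc ρ * (Q0 + D0) + Q0) * suc (toℕ i) ≤ (Q0 + D0) * n →
        ρ * (Q0 + D0) * (Q0 + D0) * n + (suc ρ * (Q0 + D0) + Q0) * (Q0 * suc (toℕ i)) ≤ (suc ρ * (Q0 + D0) + Q0) *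
            (Q0 + D0) * degree G (π i)) →
      ∃ λ t → Tiling H G t × e * (n ∸ t * h) ≤ n
  almost-tiling ρ Q0 D0 e {h} M s s′ a b 1≤P0 1≤e 1≤h 1≤M H χ₀ proper j₀ size-s h≡ large small =
    threshold , λ n G n≥ π sorts degrees →
      AlmostTiling.result ρ Q0 P0 e h M s s′ a b B0 E k Q Δ q Z C U α Y T patterns reserve 1≤P0 1≤e 1≤h 1≤M
        refl refl refl (lem Q0 D0 k) (m≤n+m 1 (D0 * k)) (m≤m+n _ _) (m≤n+m _ _) refl refl refl (m≤n+m _ B) (m≤m+n B _)
        refl refl refl (λ _ → refl) (λ _ → refl) H χ₀ proper j₀ size-s h≡ large small G π sorts degrees n≥
    where
    open Constants ρ Q0 D0 e h M
    lem : ∀ Q0 D0 k → Q0 * k + (D0 * k + 1) ≡ (Q0 + D0) * k + 1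
    lem = solve-∀

  -- Rational parameters

  module _ {h : ℕ} (H : Graph h) (r : ℕ) where

    private
      proper? : ∀ (c : Fin h → Fin r) → Dec (ProperColouring H r c)
      proper? c = all? (λ u → all? (λ v → adj? u v →-dec ¬? (c u ≟ᶠ c v)))
        where
        adj? : ∀ u v → Dec (adj H u v ≡ true)
        adj? u v = adj H u v ≟ᵇ true

      decode : Fin (r ^ h) → Fin h → Fin r
      decode = finToFun
      decode-code : ∀ c v → decode (funToFin c) v ≡ c v
      decode-code c v = finToFun-funToFin c v

    smallest-class : ∀ N c → ProperColouring H r c → ∀ j → colourClassSize c j ≤ N → ∃ (IsSigma H r)
    smallest-class zero    c p j ≤0 = colourClassSize c j , (c , p , j , refl) , λ _ _ _ → ≤-trans ≤0 z≤n
    smallest-class (suc N) c p j ≤N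
      with any? {n = r ^ h} (λ i → proper? (decode i) ×-dec any?
          (λ j′ → colourClassSize (decode i) j′ <? colourClassSize c j))
    ... | yes (i , p′ , j′ , lt) = smallest-class N (decode i) p′ j′ (≤-pred (≤-trans lt ≤N))
    ... | no ¬ex = colourClassSize c j , (c , p , j , refl) , λ c′ p′ j′ → ≮⇒≥ (λ lt → ¬ex (funToFin c′ ,
            (λ u v e eq → p′ u v e (trans (sym (decode-code c′ u)) (trans eq (decode-code c′ v)))) , j′ ,
            ≤-<-trans (≤-reflexive (wt-cong (allFin h) (λ v → cong (δ j′) (decode-code c′ v)))) lt))

  toℚᵘ-ℕ : ∀ m → toℚᵘ (ℕ→ℚ m) ≃ mkℚᵘ (ℤ.+ m) 0
  toℚᵘ-ℕ m = ℚ.toℚᵘ-fromℚᵘ (mkℚᵘ (ℤ.+ m) 0)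

  ℕ→ℚ-+ : ∀ a b → ℕ→ℚ (a + b) ≡ ℕ→ℚ a ℚ.+ ℕ→ℚ b
  ℕ→ℚ-+ a b = ℚ.toℚᵘ-injective (ℚᵘ.≃-trans (toℚᵘ-ℕ (a + b)) (ℚᵘ.≃-trans
    (*≡* (cong (ℤ._* (ℤ.+ 1)) (trans (ℤ.pos-+ a b) (sym (cong₂ ℤ._+_ (ℤ.*-identityʳ (ℤ.+ a))
        (ℤ.*-identityʳ (ℤ.+ b)))))))
    (ℚᵘ.≃-sym (ℚᵘ.≃-trans (ℚ.toℚᵘ-homo-+ (ℕ→ℚ a) (ℕ→ℚ b)) (ℚᵘ.+-cong (toℚᵘ-ℕ a) (toℚᵘ-ℕ b))))))

  ℕ→ℚ-* : ∀ a b → ℕ→ℚ (a * b) ≡ ℕ→ℚ a ℚ.* ℕ→ℚ b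
  ℕ→ℚ-* a b = ℚ.toℚᵘ-injective (ℚᵘ.≃-trans (toℚᵘ-ℕ (a * b)) (ℚᵘ.≃-trans
    (*≡* (cong (ℤ._* (ℤ.+ 1)) (ℤ.pos-* a b)))
    (ℚᵘ.≃-sym (ℚᵘ.≃-trans (ℚ.toℚᵘ-homo-* (ℕ→ℚ a) (ℕ→ℚ b)) (ℚᵘ.*-cong (toℚᵘ-ℕ a) (toℚᵘ-ℕ b))))))

  ℕ→ℚ-mono : ∀ {a b} → a ≤ b → ℕ→ℚ a ℚ.≤ ℕ→ℚ b
  ℕ→ℚ-mono {a} {b} a≤b = ℚ.toℚᵘ-cancel-≤ (ℚᵘ.≤-respˡ-≃ (ℚᵘ.≃-sym (toℚᵘ-ℕ a)) (ℚᵘ.≤-respʳ-≃ (ℚᵘ.≃-sym (toℚᵘ-ℕ b))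
    (*≤* (ℤ.*-monoʳ-≤-nonNeg (ℤ.+ 1) (ℤ.+≤+ a≤b)))))

  ℕ→ℚ-cancel : ∀ {a b} → ℕ→ℚ a ℚ.≤ ℕ→ℚ b → a ≤ b
  ℕ→ℚ-cancel {a} {b} le with ℚᵘ.≤-respˡ-≃ (toℚᵘ-ℕ a) (ℚᵘ.≤-respʳ-≃ (toℚᵘ-ℕ b) (ℚ.toℚᵘ-mono-≤ le))
  ... | *≤* le′ = ℤ.drop‿+≤+ (ℤ.*-cancelʳ-≤-pos (ℤ.+ a) (ℤ.+ b) (ℤ.+ 1) le′)

  ℕ→ℚ-pos : ∀ {a} → 1 ≤ a → 0ℚ ℚ.< ℕ→ℚ a
  ℕ→ℚ-pos {a} 1≤a = ℚ.<-≤-trans (ℚ.toℚᵘ-cancel-< {0ℚ} {ℕ→ℚ 1} (ℚᵘ.*<* (ℤ.+<+ (s≤s z≤n)))) (ℕ→ℚ-mono 1≤a)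

  ℕ→ℚ-≢0 : ∀ {a} → 1 ≤ a → ℕ→ℚ a ≢ 0ℚ
  ℕ→ℚ-≢0 1≤a e = ℚ.<⇒≢ (ℕ→ℚ-pos 1≤a) (sym e)

  ÷′-* : ∀ p q → q ≢ 0ℚ → (p ÷' q) ℚ.* q ≡ p
  ÷′-* p q q≢0 with q ℚ.≟ 0ℚ
  ... | yes e = ⊥-elim (q≢0 e)
  ... | no ne = trans (ℚ.*-assoc p (ℚ.1/ q) q) (trans (cong (p ℚ.*_) (ℚ.*-inverseˡ q)) (ℚ.*-identityʳ p))
    where instance
      nzq : ℚ.NonZero q
      nzq = ≢-nonZero ne

  *-ℕ-mono : ∀ k {p q} → p ℚ.≤ q → p ℚ.* ℕ→ℚ k ℚ.≤ q ℚ.* ℕ→ℚ k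
  *-ℕ-mono k = ℚ.*-monoʳ-≤-nonNeg (ℕ→ℚ k) ⦃ ℚ.nonNegative (ℕ→ℚ-mono {0} {k} z≤n) ⦄

  *-ℕ-cancel : ∀ k {p q} → 1 ≤ k → p ℚ.* ℕ→ℚ k ℚ.≤ q ℚ.* ℕ→ℚ k → p ℚ.≤ q
  *-ℕ-cancel k {p} {q} 1≤k = ℚ.*-cancelʳ-≤-pos (ℕ→ℚ k) ⦃ ℚ.positive (ℕ→ℚ-pos 1≤k) ⦄

  fraction : ∀ p → 0ℚ ℚ.≤ p → ∃₂ λ a d → 1 ≤ d × p ℚ.* ℕ→ℚ d ≡ ℕ→ℚ a
  fraction p@(mkℚ (ℤ.+ a) d-1 c) _ = a , suc d-1 , s≤s z≤n , ℚ.toℚᵘ-injective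
      (ℚᵘ.≃-trans (ℚ.toℚᵘ-homo-* p (ℕ→ℚ (suc d-1)))
    (ℚᵘ.≃-trans (ℚᵘ.*-cong {toℚᵘ p} {mkℚᵘ (ℤ.+ a) d-1} ℚᵘ.≃-refl (toℚᵘ-ℕ (suc d-1))) (ℚᵘ.≃-trans
      (*≡* (trans (ℤ.*-identityʳ (ℤ.+ a ℤ.* ℤ.+ suc d-1)) (cong (λ t → ℤ.+ a ℤ.* ℤ.+ t)
          (sym (*-identityʳ (suc d-1)))))) (ℚᵘ.≃-sym (toℚᵘ-ℕ a)))))
  fraction p@(mkℚ ℤ.-[1+ a ] d-1 c) 0≤p with ℚ.nonNegative 0≤p
  ... | ()

  clear-denominators : ∀ {σ ω y w z n i h D A ρ Ph Qh X} →
    ω ℚ.* ρ ≡ h ℚ.- σ → σ ℚ.* D ≡ A → y ℚ.* h ≡ ω ℚ.+ σ → w ℚ.* ω ≡ σ → z ℚ.* h ≡ ω ℚ.* n →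
    Ph ℚ.+ A ≡ h ℚ.* D → Qh ≡ ρ ℚ.* A → X ≡ (1ℚ ℚ.- y) ℚ.* n ℚ.+ w ℚ.* i →
    (z ℚ.* (h ℚ.* (ρ ℚ.* D)) ≡ Ph ℚ.* n) ×
    (X ℚ.* ((h ℚ.* (ρ ℚ.* D)) ℚ.* Ph) ≡ (h ℚ.* (ρ ℚ.* D) ℚ.- (Ph ℚ.+ Qh)) ℚ.* n ℚ.* Ph ℚ.+ (h ℚ.* (ρ ℚ.* D)) ℚ.* Qh
        ℚ.* i)
  clear-denominators {σ} {ω} {y} {w} {z} {n} {i} {h} {D} {A} {ρ} {Ph} {Qh} {X} eω eσ ey ew ez eP eQ refl = first ,
      second
    where
    open ≡-Reasoning
    open +-*-Solver
    ωρD : ω ℚ.* (ρ ℚ.* D) ≡ Ph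
    ωρD = begin
      ω ℚ.* (ρ ℚ.* D)              ≡⟨ ℚ.*-assoc ω ρ D ⟨
      ω ℚ.* ρ ℚ.* D                ≡⟨ cong (ℚ._* D) eω ⟩
      (h ℚ.- σ) ℚ.* D              ≡⟨ solve 3 (λ h σ D → (h :- σ) :* D := h :* D :- σ :* D) refl h σ D ⟩
      h ℚ.* D ℚ.- σ ℚ.* D          ≡⟨ cong₂ ℚ._-_ (sym eP) eσ ⟩
      Ph ℚ.+ A ℚ.- A               ≡⟨ solve 2 (λ p a → p :+ a :- a := p) refl Ph A ⟩
      Ph                           ∎
    σρD : σ ℚ.* (ρ ℚ.* D) ≡ Qh
    σρD = begin
      σ ℚ.* (ρ ℚ.* D)              ≡⟨ solve 3 (λ σ ρ D → σ :* (ρ :* D) := ρ :* (σ :* D)) refl σ ρ D ⟩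
      ρ ℚ.* (σ ℚ.* D)              ≡⟨ cong (ρ ℚ.*_) eσ ⟩
      ρ ℚ.* A                      ≡⟨ eQ ⟨
      Qh                           ∎
    first : z ℚ.* (h ℚ.* (ρ ℚ.* D)) ≡ Ph ℚ.* n
    first = begin
      z ℚ.* (h ℚ.* (ρ ℚ.* D))      ≡⟨ ℚ.*-assoc z h _ ⟨
      z ℚ.* h ℚ.* (ρ ℚ.* D)        ≡⟨ cong (ℚ._* (ρ ℚ.* D)) ez ⟩
      ω ℚ.* n ℚ.* (ρ ℚ.* D)        ≡⟨ solve 3 (λ ω n x → ω :* n :* x := ω :* x :* n) refl ω n (ρ ℚ.* D) ⟩
      ω ℚ.* (ρ ℚ.* D) ℚ.* n        ≡⟨ cong (ℚ._* n) ωρD ⟩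
      Ph ℚ.* n                     ∎
    yB : y ℚ.* (h ℚ.* (ρ ℚ.* D)) ≡ Ph ℚ.+ Qh
    yB = begin
      y ℚ.* (h ℚ.* (ρ ℚ.* D))                ≡⟨ ℚ.*-assoc y h _ ⟨
      y ℚ.* h ℚ.* (ρ ℚ.* D)                  ≡⟨ cong (ℚ._* (ρ ℚ.* D)) ey ⟩
      (ω ℚ.+ σ) ℚ.* (ρ ℚ.* D)                ≡⟨ ℚ.*-distribʳ-+ (ρ ℚ.* D) ω σ ⟩
      ω ℚ.* (ρ ℚ.* D) ℚ.+ σ ℚ.* (ρ ℚ.* D)    ≡⟨ cong₂ ℚ._+_ ωρD σρD ⟩
      Ph ℚ.+ Qh                              ∎
    wP : w ℚ.* Ph ≡ Qh
    wP = begin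
      w ℚ.* Ph                     ≡⟨ cong (w ℚ.*_) ωρD ⟨
      w ℚ.* (ω ℚ.* (ρ ℚ.* D))      ≡⟨ ℚ.*-assoc w ω _ ⟨
      w ℚ.* ω ℚ.* (ρ ℚ.* D)        ≡⟨ cong (ℚ._* (ρ ℚ.* D)) ew ⟩
      σ ℚ.* (ρ ℚ.* D)              ≡⟨ σρD ⟩
      Qh                           ∎
    second : ((1ℚ ℚ.- y) ℚ.* n ℚ.+ w ℚ.* i) ℚ.* ((h ℚ.* (ρ ℚ.* D)) ℚ.* Ph) ≡
      (h ℚ.* (ρ ℚ.* D) ℚ.- (Ph ℚ.+ Qh)) ℚ.* n ℚ.* Ph ℚ.+ (h ℚ.* (ρ ℚ.* D)) ℚ.* Qh ℚ.* i
    second = begin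
      ((1ℚ ℚ.- y) ℚ.* n ℚ.+ w ℚ.* i) ℚ.* (B ℚ.* Ph)              ≡⟨ solve 6
          (λ y n w i B P → ((con 1ℚ :- y) :* n :+ w :* i) :* (B :* P) := (B :- y :* B) :* n :* P :+ B :* (w :* P) :*
          i) refl y n w i B Ph ⟩
      (B ℚ.- y ℚ.* B) ℚ.* n ℚ.* Ph ℚ.+ B ℚ.* (w ℚ.* Ph) ℚ.* i    ≡⟨ cong₂
          (λ s t → (B ℚ.- s) ℚ.* n ℚ.* Ph ℚ.+ B ℚ.* t ℚ.* i) yB wP ⟩
      (B ℚ.- (Ph ℚ.+ Qh)) ℚ.* n ℚ.* Ph ℚ.+ B ℚ.* Qh ℚ.* i        ∎
      where
      B = h ℚ.* (ρ ℚ.* D)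

  -- Solves for the numbers a, b of balanced and of unbalanced rotation families filling a tile.
  multiplicities : ∀ ρ h s s′ A D y → h ≡ s + s′ → 1 ≤ h → s * D ≤ A → suc (suc ρ) * s ≤ h → h * D ≡ suc (suc ρ) * A +
      y →
    ∃ λ M → ∃₂ λ a b → 1 ≤ M × a * h + b * s′ ≡ (suc ρ * A + y) * M × a * h + b * (suc ρ * s) ≡ suc ρ * A * M
  multiplicities ρ h s s′ A D y h≡ 1≤h sD≤A rs≤h hD = cases (h ∸ suc (suc ρ) * s) (A ∸ s * D) (sym (m+[n∸m]≡n rs≤h))
      (sym (m+[n∸m]≡n sD≤A))
    where
    r = suc (suc ρ)
    cases : ∀ M x → h ≡ r * s + M → A ≡ s * D + x → _
    cases M x eh eA = pickM M eh Mrxy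
      where
      Mrxy : M * D ≡ r * x + y
      Mrxy = +-cancelˡ-≡ (r * (s * D)) _ _ (trans (trans (l₁ r s M D) (cong (_* D) (sym eh)))
          (trans hD (trans (cong (λ A → r * A + y) eA) (l₂ r (s * D) x y))))
        where
        l₁ : ∀ r s M D → r * (s * D) + M * D ≡ (r * s + M) * D
        l₁ = solve-∀
        l₂ : ∀ r q x y → r * (q + x) + y ≡ r * q + (r * x + y)
        l₂ = solve-∀
      es′ : ∀ M → h ≡ r * s + M → s′ ≡ suc ρ * s + M
      es′ M eh = +-cancelˡ-≡ s _ _ (trans (sym h≡) (trans eh (+-assoc s (suc ρ * s) M)))
      pickM : ∀ M → h ≡ r * s + M → M * D ≡ r * x + y →
        ∃ λ M → ∃₂ λ a b → 1 ≤ M × a * h + b * s′ ≡ (suc ρ * A + y) * M × a * h + b * (suc ρ * s) ≡ suc ρ * A * M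
      pickM zero eh e = h , suc ρ * A + y , 0 , 1≤h , +-identityʳ _ ,
        trans (+-identityʳ _) (cong (_* h) (trans (cong (suc ρ * A +_) (m+n≡0⇒n≡0 (r * x) (sym e))) (+-identityʳ _)))
      pickM M@(suc _) eh e = M , suc ρ * x , y , s≤s z≤n ,
        (begin
          suc ρ * x * h + y * s′                                            ≡⟨ cong₂ (λ p q → suc ρ * x * p + y * q)
              eh (es′ M eh) ⟩
          suc ρ * x * (r * s + M) + y * (suc ρ * s + M)                     ≡⟨ l₁ ρ x s M y ⟩
          suc ρ * s * (r * x + y) + suc ρ * x * M + y * M                   ≡⟨ cong
              (λ t → suc ρ * s * t + suc ρ * x * M + y * M) (sym e) ⟩
          suc ρ * s * (M * D) + suc ρ * x * M + y * M                       ≡⟨ l₂ ρ s M D x y ⟩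
          (suc ρ * (s * D + x) + y) * M                                     ≡⟨ cong (λ A → (suc ρ * A + y) * M) eA ⟨
          (suc ρ * A + y) * M                                               ∎) ,
        (begin
          suc ρ * x * h + y * (suc ρ * s)                                   ≡⟨ cong
              (λ p → suc ρ * x * p + y * (suc ρ * s)) eh ⟩
          suc ρ * x * (r * s + M) + y * (suc ρ * s)                         ≡⟨ l₃ ρ x s M y ⟩
          suc ρ * s * (r * x + y) + suc ρ * x * M                           ≡⟨ cong
              (λ t → suc ρ * s * t + suc ρ * x * M) (sym e) ⟩
          suc ρ * s * (M * D) + suc ρ * x * M                               ≡⟨ l₄ ρ s M D x ⟩
          suc ρ * (s * D + x) * M                                           ≡⟨ cong (λ A → suc ρ * A * M) eA ⟨
          suc ρ * A * M                                                     ∎)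
        where
        open ≡-Reasoning
        l₁ : ∀ ρ x s M y → suc ρ * x * (suc (suc ρ) * s + M) + y * (suc ρ * s + M) ≡ suc ρ * s * (suc (suc ρ) * x + y)
            + suc ρ * x * M + y * M
        l₁ = solve-∀
        l₂ : ∀ ρ s M D x y → suc ρ * s * (M * D) + suc ρ * x * M + y * M ≡ (suc ρ * (s * D + x) + y) * M
        l₂ = solve-∀
        l₃ : ∀ ρ x s M y → suc ρ * x * (suc (suc ρ) * s + M) + y * (suc ρ * s) ≡ suc ρ * s * (suc (suc ρ) * x + y) +
            suc ρ * x * M
        l₃ = solve-∀
        l₄ : ∀ ρ s M D x → suc ρ * s * (M * D) + suc ρ * x * M ≡ suc ρ * (s * D + x) * M
        l₄ = solve-∀

  module Conclusion (η σ : ℚ) {h : ℕ} (H : Graph h) (ρ : ℕ) (1≤h : 1 ≤ h) (s A D a e : ℕ)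
    (1≤D : 1 ≤ D) (σD : σ ℚ.* ℕ→ℚ D ≡ ℕ→ℚ A) (1≤e : 1 ≤ e) (1≤a : 1 ≤ a) (ηe : η ℚ.* ℕ→ℚ e ≡ ℕ→ℚ a)
    (s≤σ : ℕ→ℚ s ℚ.≤ σ) (σ≤ : σ ℚ.≤ ℕ→ℚ h ÷' ℕ→ℚ (suc (suc ρ)))
    (χ₀ : Fin h → Fin (suc (suc ρ))) (proper : ProperColouring H (suc (suc ρ)) χ₀) (j₀ : Fin (suc (suc ρ)))
    (size-s : colourClassSize χ₀ j₀ ≡ s) where

    r D0 Q0 P0 B0 s′ : ℕ
    r  = suc (suc ρ)
    D0 = h * D ∸ r * A
    Q0 = suc ρ * A
    P0 = Q0 + D0
    B0 = suc ρ * P0 + Q0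
    s′ = h ∸ s

    ω : ℚ
    ω = (ℕ→ℚ h ℚ.- σ) ÷' ℕ→ℚ (suc ρ)

    sD≤A : s * D ≤ A
    sD≤A = ℕ→ℚ-cancel (ℚ.≤-trans (ℚ.≤-reflexive (ℕ→ℚ-* s D)) (ℚ.≤-trans (*-ℕ-mono D s≤σ) (ℚ.≤-reflexive σD)))

    rA≤hD : r * A ≤ h * D
    rA≤hD = ≤-trans (≤-reflexive (*-comm r A)) (ℕ→ℚ-cancel (begin
      ℕ→ℚ (A * r)                             ≡⟨ ℕ→ℚ-* A r ⟩
      ℕ→ℚ A ℚ.* ℕ→ℚ r                         ≡⟨ cong (ℚ._* ℕ→ℚ r) σD ⟨
      σ ℚ.* ℕ→ℚ D ℚ.* ℕ→ℚ r                   ≤⟨ *-ℕ-mono r (*-ℕ-mono D σ≤) ⟩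
      x ℚ.* ℕ→ℚ D ℚ.* ℕ→ℚ r                   ≡⟨ ℚ.*-assoc x (ℕ→ℚ D) (ℕ→ℚ r) ⟩
      x ℚ.* (ℕ→ℚ D ℚ.* ℕ→ℚ r)                 ≡⟨ cong (x ℚ.*_) (ℚ.*-comm (ℕ→ℚ D) (ℕ→ℚ r)) ⟩
      x ℚ.* (ℕ→ℚ r ℚ.* ℕ→ℚ D)                 ≡⟨ ℚ.*-assoc x (ℕ→ℚ r) (ℕ→ℚ D) ⟨
      x ℚ.* ℕ→ℚ r ℚ.* ℕ→ℚ D                   ≡⟨ cong (ℚ._* ℕ→ℚ D) (÷′-* (ℕ→ℚ h) (ℕ→ℚ r) (ℕ→ℚ-≢0 {r} (s≤s z≤n))) ⟩
      ℕ→ℚ h ℚ.* ℕ→ℚ D                         ≡⟨ ℕ→ℚ-* h D ⟨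
      ℕ→ℚ (h * D)                             ∎))
      where
      open ℚ.≤-Reasoning
      x = ℕ→ℚ h ÷' ℕ→ℚ r

    hD : h * D ≡ r * A + D0
    hD = sym (m+[n∸m]≡n rA≤hD)

    rs≤h : r * s ≤ h
    rs≤h = *-cancelʳ-≤ (r * s) h D ⦃ >-nonZero 1≤D ⦄ (≤-trans (≤-reflexive (*-assoc r s D))
        (≤-trans (*-monoʳ-≤ r sD≤A) rA≤hD))

    h≡ : h ≡ s + s′
    h≡ = sym (m+[n∸m]≡n (≤-trans (m≤m+n s (suc ρ * s)) rs≤h))

    P0+A : P0 + A ≡ h * D
    P0+A = trans (lem ρ A D0) (sym hD)
      where
      lem : ∀ ρ A y → suc ρ * A + y + A ≡ suc (suc ρ) * A + y
      lem = solve-∀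

    B0≡ : B0 ≡ h * (suc ρ * D)
    B0≡ = trans (lem₁ ρ P0 A) (trans (cong (suc ρ *_) P0+A) (lem₂ ρ h D))
      where
      lem₁ : ∀ ρ P A → suc ρ * P + suc ρ * A ≡ suc ρ * (P + A)
      lem₁ = solve-∀
      lem₂ : ∀ ρ h D → suc ρ * (h * D) ≡ h * (suc ρ * D)
      lem₂ = solve-∀

    1≤P0 : 1 ≤ P0
    1≤P0 = n≢0⇒n>0 λ P≡0 → <⇒≱ (*-mono-≤ 1≤h 1≤D) (≤-reflexive (trans (sym P0+A)
      (trans (cong (_+ A) P≡0) (m+n≡0⇒m≡0 A (m+n≡0⇒m≡0 (suc ρ * A) P≡0)))))

    1≤B0 : 1 ≤ B0
    1≤B0 = ≤-trans 1≤P0 (≤-trans (m≤m+n P0 (ρ * P0)) (m≤m+n _ Q0))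

    eω : ω ℚ.* ℕ→ℚ (suc ρ) ≡ ℕ→ℚ h ℚ.- σ
    eω = ÷′-* (ℕ→ℚ h ℚ.- σ) (ℕ→ℚ (suc ρ)) (ℕ→ℚ-≢0 {suc ρ} (s≤s z≤n))

    eP : ℕ→ℚ P0 ℚ.+ ℕ→ℚ A ≡ ℕ→ℚ h ℚ.* ℕ→ℚ D
    eP = trans (sym (ℕ→ℚ-+ P0 A)) (trans (cong ℕ→ℚ P0+A) (ℕ→ℚ-* h D))

    eB : ℕ→ℚ h ℚ.* (ℕ→ℚ (suc ρ) ℚ.* ℕ→ℚ D) ≡ ℕ→ℚ B0
    eB = trans (cong (ℕ→ℚ h ℚ.*_) (sym (ℕ→ℚ-* (suc ρ) D))) (trans (sym (ℕ→ℚ-* h (suc ρ * D))) (cong ℕ→ℚ (sym B0≡)))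

    ω≢0 : ω ≢ 0ℚ
    ω≢0 ω≡0 = ℕ→ℚ-≢0 1≤P0 (trans (sym (ℚ.+-identityʳ (ℕ→ℚ P0)))
      (trans (cong (ℕ→ℚ P0 ℚ.+_) (sym (ℚ.+-inverseʳ (ℕ→ℚ A))))
        (trans (sym (ℚ.+-assoc (ℕ→ℚ P0) (ℕ→ℚ A) (ℚ.- ℕ→ℚ A)))
          (trans (cong (ℚ._- ℕ→ℚ A) (trans eP (cong (ℚ._* ℕ→ℚ D) h≡σ)))
            (trans (cong (ℚ._- ℕ→ℚ A) σD) (ℚ.+-inverseʳ (ℕ→ℚ A)))))))
      where
      h-σ≡0 : ℕ→ℚ h ℚ.- σ ≡ 0ℚ
      h-σ≡0 = trans (sym eω) (trans (cong (ℚ._* ℕ→ℚ (suc ρ)) ω≡0) (ℚ.*-zeroˡ (ℕ→ℚ (suc ρ))))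
      h≡σ : ℕ→ℚ h ≡ σ
      h≡σ = trans (sym (ℚ.+-identityʳ (ℕ→ℚ h))) (trans (cong (ℕ→ℚ h ℚ.+_) (sym (ℚ.+-inverseˡ σ)))
        (trans (sym (ℚ.+-assoc (ℕ→ℚ h) (ℚ.- σ) σ)) (trans (cong (ℚ._+ σ) h-σ≡0) (ℚ.+-identityˡ σ))))

    module _ {n : ℕ} (i d : ℕ) where

      y z w X : ℚ
      y = (ω ℚ.+ σ) ÷' ℕ→ℚ h
      z = (ω ℚ.* ℕ→ℚ n) ÷' ℕ→ℚ h
      w = σ ÷' ω
      X = (1ℚ ℚ.- y) ℚ.* ℕ→ℚ n ℚ.+ w ℚ.* ℕ→ℚ i

      cleared : (z ℚ.* (ℕ→ℚ h ℚ.* (ℕ→ℚ (suc ρ) ℚ.* ℕ→ℚ D)) ≡ ℕ→ℚ P0 ℚ.* ℕ→ℚ n) ×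
        (X ℚ.* ((ℕ→ℚ h ℚ.* (ℕ→ℚ (suc ρ) ℚ.* ℕ→ℚ D)) ℚ.* ℕ→ℚ P0) ≡
          (ℕ→ℚ h ℚ.* (ℕ→ℚ (suc ρ) ℚ.* ℕ→ℚ D) ℚ.- (ℕ→ℚ P0 ℚ.+ ℕ→ℚ Q0)) ℚ.* ℕ→ℚ n ℚ.* ℕ→ℚ P0
            ℚ.+ (ℕ→ℚ h ℚ.* (ℕ→ℚ (suc ρ) ℚ.* ℕ→ℚ D)) ℚ.* ℕ→ℚ Q0 ℚ.* ℕ→ℚ i)
      cleared = clear-denominators {σ} {ω} {y} {w} {z} {ℕ→ℚ n} {ℕ→ℚ i} {ℕ→ℚ h} {ℕ→ℚ D} {ℕ→ℚ A} {ℕ→ℚ (suc ρ)} {ℕ→ℚ P0}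
          {ℕ→ℚ Q0}
        eω σD (÷′-* (ω ℚ.+ σ) (ℕ→ℚ h) (ℕ→ℚ-≢0 1≤h)) (÷′-* σ ω ω≢0) (÷′-* (ω ℚ.* ℕ→ℚ n) (ℕ→ℚ h) (ℕ→ℚ-≢0 1≤h)) eP
            (ℕ→ℚ-* (suc ρ) A) refl

      in-range : B0 * i ≤ P0 * n → ℕ→ℚ i ℚ.≤ z
      in-range le = *-ℕ-cancel B0 1≤B0 (begin
        ℕ→ℚ i ℚ.* ℕ→ℚ B0           ≡⟨ ℕ→ℚ-* i B0 ⟨
        ℕ→ℚ (i * B0)               ≤⟨ ℕ→ℚ-mono (≤-trans (≤-reflexive (*-comm i B0)) le) ⟩
        ℕ→ℚ (P0 * n)               ≡⟨ ℕ→ℚ-* P0 n ⟩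
        ℕ→ℚ P0 ℚ.* ℕ→ℚ n           ≡⟨ proj₁ cleared ⟨
        z ℚ.* (ℕ→ℚ h ℚ.* (ℕ→ℚ (suc ρ) ℚ.* ℕ→ℚ D)) ≡⟨ cong (z ℚ.*_) eB ⟩
        z ℚ.* ℕ→ℚ B0               ∎)
        where open ℚ.≤-Reasoning

      scaled : X ℚ.* ℕ→ℚ (B0 * P0) ≡ ℕ→ℚ (ρ * P0 * P0 * n + B0 * (Q0 * i))
      scaled = begin
        X ℚ.* ℕ→ℚ (B0 * P0)                ≡⟨ cong (X ℚ.*_) (trans (ℕ→ℚ-* B0 P0) (cong (ℚ._* ℕ→ℚ P0) (sym eB))) ⟩
        X ℚ.* ((ℕ→ℚ h ℚ.* (ℕ→ℚ (suc ρ) ℚ.* ℕ→ℚ D)) ℚ.* ℕ→ℚ P0)    ≡⟨ proj₂ cleared ⟩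
        (ℕ→ℚ h ℚ.* (ℕ→ℚ (suc ρ) ℚ.* ℕ→ℚ D) ℚ.- (ℕ→ℚ P0 ℚ.+ ℕ→ℚ Q0)) ℚ.* ℕ→ℚ n ℚ.* ℕ→ℚ P0 ℚ.+
            (ℕ→ℚ h ℚ.* (ℕ→ℚ (suc ρ) ℚ.* ℕ→ℚ D)) ℚ.* ℕ→ℚ Q0 ℚ.* ℕ→ℚ i
          ≡⟨ cong (λ b → (b ℚ.- (ℕ→ℚ P0 ℚ.+ ℕ→ℚ Q0)) ℚ.* ℕ→ℚ n ℚ.* ℕ→ℚ P0 ℚ.+ b ℚ.* ℕ→ℚ Q0 ℚ.* ℕ→ℚ i) eB ⟩
        (ℕ→ℚ B0 ℚ.- (ℕ→ℚ P0 ℚ.+ ℕ→ℚ Q0)) ℚ.* ℕ→ℚ n ℚ.* ℕ→ℚ P0 ℚ.+ ℕ→ℚ B0 ℚ.* ℕ→ℚ Q0 ℚ.* ℕ→ℚ i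
          ≡⟨ cong (λ b → b ℚ.* ℕ→ℚ n ℚ.* ℕ→ℚ P0 ℚ.+ ℕ→ℚ B0 ℚ.* ℕ→ℚ Q0 ℚ.* ℕ→ℚ i) difference ⟩
        ℕ→ℚ (ρ * P0) ℚ.* ℕ→ℚ n ℚ.* ℕ→ℚ P0 ℚ.+ ℕ→ℚ B0 ℚ.* ℕ→ℚ Q0 ℚ.* ℕ→ℚ i
          ≡⟨ cong₂ ℚ._+_ (sym (trans (ℕ→ℚ-* (ρ * P0 * n) P0) (cong (ℚ._* ℕ→ℚ P0) (ℕ→ℚ-* (ρ * P0) n))))
               (sym (trans (ℕ→ℚ-* (B0 * Q0) i) (cong (ℚ._* ℕ→ℚ i) (ℕ→ℚ-* B0 Q0)))) ⟩
        ℕ→ℚ (ρ * P0 * n * P0) ℚ.+ ℕ→ℚ (B0 * Q0 * i)      ≡⟨ ℕ→ℚ-+ (ρ * P0 * n * P0) (B0 * Q0 * i) ⟨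
        ℕ→ℚ (ρ * P0 * n * P0 + B0 * Q0 * i)              ≡⟨ cong ℕ→ℚ (lem ρ P0 n B0 Q0 i) ⟩
        ℕ→ℚ (ρ * P0 * P0 * n + B0 * (Q0 * i))            ∎
        where
        open ≡-Reasoning
        lem : ∀ ρ P n B Q i → ρ * P * n * P + B * Q * i ≡ ρ * P * P * n + B * (Q * i)
        lem = solve-∀
        difference : ℕ→ℚ B0 ℚ.- (ℕ→ℚ P0 ℚ.+ ℕ→ℚ Q0) ≡ ℕ→ℚ (ρ * P0)
        difference = begin
          ℕ→ℚ B0 ℚ.- p                          ≡⟨ cong (λ b → ℕ→ℚ b ℚ.- p) (lem₂ ρ P0 Q0) ⟩
          ℕ→ℚ (ρ * P0 + (P0 + Q0)) ℚ.- p        ≡⟨ cong (ℚ._- p)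
              (trans (ℕ→ℚ-+ (ρ * P0) (P0 + Q0)) (cong (ℕ→ℚ (ρ * P0) ℚ.+_) (ℕ→ℚ-+ P0 Q0))) ⟩
          ℕ→ℚ (ρ * P0) ℚ.+ p ℚ.- p              ≡⟨ ℚ.+-assoc (ℕ→ℚ (ρ * P0)) p (ℚ.- p) ⟩
          ℕ→ℚ (ρ * P0) ℚ.+ (p ℚ.- p)            ≡⟨ cong (ℕ→ℚ (ρ * P0) ℚ.+_) (ℚ.+-inverseʳ p) ⟩
          ℕ→ℚ (ρ * P0) ℚ.+ 0ℚ                   ≡⟨ ℚ.+-identityʳ _ ⟩
          ℕ→ℚ (ρ * P0)                          ∎
          where
          p = ℕ→ℚ P0 ℚ.+ ℕ→ℚ Q0
          lem₂ : ∀ ρ P Q → suc ρ * P + Q ≡ ρ * P + (P + Q)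
          lem₂ = solve-∀

      degree-cleared : X ℚ.≤ ℕ→ℚ d → ρ * P0 * P0 * n + B0 * (Q0 * i) ≤ B0 * P0 * d
      degree-cleared le = ≤-trans (ℕ→ℚ-cancel (ℚ.≤-trans (ℚ.≤-reflexive (sym scaled))
          (ℚ.≤-trans (*-ℕ-mono (B0 * P0) le) (ℚ.≤-reflexive (sym (ℕ→ℚ-* d (B0 * P0)))))))
        (≤-reflexive (*-comm d (B0 * P0)))

    few-missing : ∀ m n → e * m ≤ n → ℕ→ℚ m ℚ.≤ η ℚ.* ℕ→ℚ n
    few-missing m n le = *-ℕ-cancel e 1≤e (begin
      ℕ→ℚ m ℚ.* ℕ→ℚ e               ≡⟨ ℕ→ℚ-* m e ⟨
      ℕ→ℚ (m * e)                   ≤⟨ ℕ→ℚ-mono (≤-trans (≤-reflexive (*-comm m e))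
          (≤-trans le (≤-trans (≤-reflexive (sym (*-identityˡ n))) (*-monoˡ-≤ n 1≤a)))) ⟩
      ℕ→ℚ (a * n)                   ≡⟨ ℕ→ℚ-* a n ⟩
      ℕ→ℚ a ℚ.* ℕ→ℚ n               ≡⟨ cong (ℚ._* ℕ→ℚ n) ηe ⟨
      η ℚ.* ℕ→ℚ e ℚ.* ℕ→ℚ n         ≡⟨ ℚ.*-assoc η (ℕ→ℚ e) (ℕ→ℚ n) ⟩
      η ℚ.* (ℕ→ℚ e ℚ.* ℕ→ℚ n)       ≡⟨ cong (η ℚ.*_) (ℚ.*-comm (ℕ→ℚ e) (ℕ→ℚ n)) ⟩
      η ℚ.* (ℕ→ℚ n ℚ.* ℕ→ℚ e)       ≡⟨ ℚ.*-assoc η (ℕ→ℚ n) (ℕ→ℚ e) ⟨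
      η ℚ.* ℕ→ℚ n ℚ.* ℕ→ℚ e         ∎)
      where open ℚ.≤-Reasoning

    Claim : ℕ → Set
    Claim n₀ = ∀ (n : ℕ) (G : Graph n) → n₀ ≤ n → (π : Fin n → Fin n) → SortsDegrees G π →
      (∀ (k : Fin n) → ℕ→ℚ (suc (toℕ k)) ℚ.≤ (ω ℚ.* ℕ→ℚ n) ÷' ℕ→ℚ h →
        (1ℚ ℚ.- ((ω ℚ.+ σ) ÷' ℕ→ℚ h)) ℚ.* ℕ→ℚ n ℚ.+ (σ ÷' ω) ℚ.* ℕ→ℚ (suc (toℕ k)) ℚ.≤ ℕ→ℚ (degree G (π k))) →
      ∃ λ t → Σ (Tiling H G t) λ _ → ℕ→ℚ (n ∸ t * h) ℚ.≤ η ℚ.* ℕ→ℚ n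

    ℕ-Claim : ℕ → Set
    ℕ-Claim n₀ = ∀ n (G : Graph n) → n₀ ≤ n → (π : Fin n → Fin n) → SortsDegrees G π →
      (∀ (i : Fin n) → B0 * suc (toℕ i) ≤ P0 * n →
        ρ * P0 * P0 * n + B0 * (Q0 * suc (toℕ i)) ≤ B0 * P0 * degree G (π i)) →
      ∃ λ t → Tiling H G t × e * (n ∸ t * h) ≤ n

    to-ℚ : ∃ ℕ-Claim → ∃ Claim
    to-ℚ (n₀ , claim) = n₀ , λ n G n≥ π sorts degrees →
        finish n G (claim n G n≥ π sorts (λ k le → degree-cleared (suc (toℕ k)) (degree G (π k))
            (degrees k (in-range (suc (toℕ k)) (degree G (π k)) le))))
      where
      finish : ∀ n (G : Graph n) → (∃ λ t → Tiling H G t × e * (n ∸ t * h) ≤ n) → ∃ λ t → Σ (Tiling H G t) λ _ → ℕ→ℚ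
          (n ∸ t * h) ℚ.≤ η ℚ.* ℕ→ℚ n
      finish n G (t , tl , le) = t , tl , few-missing (n ∸ t * h) n le

    conclusion : ∃ Claim
    conclusion = to-ℚ (with-multiplicities (multiplicities ρ h s s′ A D D0 h≡ 1≤h sD≤A rs≤h hD))
      where
      with-multiplicities : (∃ λ M → ∃₂ λ a b → 1 ≤ M × a * h + b * s′ ≡ P0 * M × a * h + b * (suc ρ * s) ≡ Q0 * M) →
          ∃ ℕ-Claim
      with-multiplicities (M , a , b , 1≤M , large , small) =
        almost-tiling ρ Q0 D0 e M s s′ a b 1≤P0 1≤e 1≤h 1≤M H χ₀ proper j₀ size-s h≡ large small

  degree-sequence-Komlós : (η σ : ℚ) → 0ℚ ℚ.< η →
    {h : ℕ} (H : Graph h) (r : ℕ) → HasEdge H → IsChromaticNumber H r →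
    (∀ s → IsSigma H r s → ℕ→ℚ s ℚ.≤ σ) → σ ℚ.≤ ℕ→ℚ h ÷' ℕ→ℚ r →
    let ω = (ℕ→ℚ h ℚ.- σ) ÷' ℕ→ℚ (r ∸ 1) in
    ∃ λ n₀ → ∀ (n : ℕ) (G : Graph n) → n₀ ≤ n →
      (π : Fin n → Fin n) → SortsDegrees G π →
      (∀ (k : Fin n) → let i = suc (toℕ k) in
        ℕ→ℚ i ℚ.≤ (ω ℚ.* ℕ→ℚ n) ÷' ℕ→ℚ h →
        (1ℚ ℚ.- ((ω ℚ.+ σ) ÷' ℕ→ℚ h)) ℚ.* ℕ→ℚ n ℚ.+ (σ ÷' ω) ℚ.* ℕ→ℚ i ℚ.≤ ℕ→ℚ (degree G (π k))) →
      ∃ λ t → Σ (Tiling H G t) λ _ → ℕ→ℚ (n ∸ t * h) ℚ.≤ η ℚ.* ℕ→ℚ n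
  degree-sequence-Komlós η σ 0<η H zero (u , _) ((c , _) , _) _ _ = ⊥-elim (no-colour (c u))
    where
    no-colour : Fin 0 → ⊥
    no-colour ()
  degree-sequence-Komlós η σ 0<η H (suc zero) (u , v , e) ((c , p) , _) _ _ = ⊥-elim
      (p u v e (one-colour (c u) (c v)))
    where
    one-colour : ∀ (a b : Fin 1) → a ≡ b
    one-colour zero zero = refl
  degree-sequence-Komlós η σ 0<η {h} H (suc (suc ρ)) (u , _) ((c , p) , _) σ≥ σ≤ = from-smallest
      (smallest-class H r (colourClassSize c zero) c p zero ≤-refl)
    where
    r = suc (suc ρ)
    1≤h : 1 ≤ h
    1≤h = ≤-trans (s≤s z≤n) (toℕ<n u)
    from-smallest : ∃ (IsSigma H r) → _
    from-smallest (s , isσ@((χ₀ , proper , j₀ , size-s) , _)) =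
        from-fractions (fraction σ (ℚ.≤-trans (ℕ→ℚ-mono {0} {s} z≤n) (σ≥ s isσ))) (fraction η (ℚ.<⇒≤ 0<η))
      where
      from-fractions : (∃₂ λ A D → 1 ≤ D × σ ℚ.* ℕ→ℚ D ≡ ℕ→ℚ A) → (∃₂ λ a e → 1 ≤ e × η ℚ.* ℕ→ℚ e ≡ ℕ→ℚ a) → _
      from-fractions (A , D , 1≤D , σD) (a , e , 1≤e , ηe) =
          Conclusion.conclusion η σ H ρ 1≤h s A D a e 1≤D σD 1≤e 1≤a ηe (σ≥ s isσ) σ≤ χ₀ proper j₀ size-s
        where
        1≤a : 1 ≤ a
        1≤a = n≢0⇒n>0 λ a≡0 → ℚ.<-irrefl refl (ℚ.<-≤-trans 0<η
            (*-ℕ-cancel e 1≤e (ℚ.≤-reflexive (trans ηe (trans (cong ℕ→ℚ a≡0) (sym (ℚ.*-zeroˡ (ℕ→ℚ e))))))))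

open import Defs
open import Data.Nat as ℕ using (ℕ; suc; _∸_)
open import Data.Fin using (Fin; toℕ)
open import Data.Rational as ℚ using (ℚ; 0ℚ; 1ℚ; _<_; _≤_; _+_; _-_; _*_)
open import Data.Product using (Σ; ∃; _×_; _,_)

theorem8p1 : (η σ : ℚ) → 0ℚ < η →
    {h : ℕ} (H : Graph h) (r : ℕ) → HasEdge H → IsChromaticNumber H r →
    (∀ s → IsSigma H r s → ℕ→ℚ s ≤ σ) → σ ≤ ℕ→ℚ h ÷' ℕ→ℚ r →
    let ω = (ℕ→ℚ h - σ) ÷' ℕ→ℚ (r ∸ 1) in
    ∃ λ n₀ → ∀ (n : ℕ) (G : Graph n) → n₀ ℕ.≤ n →
    (π : Fin n → Fin n) → SortsDegrees G π →
    (∀ (k : Fin n) → let i = suc (toℕ k) in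
    ℕ→ℚ i ≤ (ω * ℕ→ℚ n) ÷' ℕ→ℚ h →
    (1ℚ - ((ω + σ) ÷' ℕ→ℚ h)) * ℕ→ℚ n + (σ ÷' ω) * ℕ→ℚ i ≤ ℕ→ℚ (degree G (π k))) →
    ∃ λ t → Σ (Tiling H G t) λ _ → ℕ→ℚ (n ∸ t ℕ.* h) ≤ η * ℕ→ℚ n
theorem8p1 = DegreeSequenceKomlós.degree-sequence-Komlós
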